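{- The following problem is decidable: given $d\ge 1$, $q<\omega$, a characteristic $\sigma\in\Sigma_d^+(q)$, and an ordinal $\alpha$ presented by its Cantor normal form, decide whether there exists a $d$-colored ordinal of order type exactly $\alpha$ satisfying $\sigma$.
   Context: A $d$-colored ordinal is a structure $(A,<,C_0,\dots,C_{d-1})$ where $(A,<)$ is an ordinal and the unary predicates $C_i$ partition $A$. $\equiv_q$ means agreement on all first-order sentences of quantifier rank at most $q$. $\Sigma_d^+(q)$ is a finite set containing, for each $\equiv_q$-class of $d$-colored ordinals that has a nonempty representative, exactly one $q$-characteristic sentence, i.e. a sentence of quantifier rank at most $q$ whose $d$-colored ordinal models are exactly the members of that class. Presentation of inputs: the ordinal is presented by its Cantor normal form with effective notations for the relevant exponents and cofinalities; in particular, writing $\alpha=\alpha_0+\theta$ with $\alpha_0$ the sum of the terms with exponent $\ge\omega$ and $\theta<\omega^\omega$ the sum of the terms with finite exponent, one can effectively read off from the presentation the Cantor normal form of $\theta$, whether $\alpha_0=0$, and, if $\alpha_0>0$, whether $\operatorname{cf}(\alpha_0)=\omega$ or $\operatorname{cf}(\alpha_0)>\omega$. -}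

module Defs where

open import Data.Empty.Polymorphic using (⊥)
open import Data.Fin.Base using (Fin)
import Data.Fin.Induction as Fin
import Data.Fin.Properties as Fin
open import Data.List.Base using (List; []; _∷_; foldr; map)
open import Data.List.NonEmpty.Base using (List⁺; toList)
open import Data.List.Membership.Propositional using (_∈_)
open import Data.List.Relation.Binary.Lex.Core using (base; halt; this; next)
import Data.List.Relation.Binary.Lex.Strict as Lex
open import Data.List.Relation.Unary.Linked as Linked using (Linked; []; [-]; _∷_)
open import Data.Nat.Base as ℕ using (ℕ; zero; suc; _⊔_; NonZero)
import Data.Nat.Induction as ℕ
import Data.Nat.Properties as ℕ
open import Data.Product using (Σ; ∃; ∃!; Σ-syntax; ∃-syntax; _×_; _,_; proj₁; proj₂)
open import Data.Product.Relation.Binary.Lex.Strict using (×-strictTotalOrder)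
open import Data.Sum.Base using (_⊎_; inj₁; inj₂)
open import Data.Sum.Relation.Binary.LeftOrder using (⊎-<-isStrictTotalOrder; ⊎-<-wellFounded)
open import Data.Unit.Polymorphic using (⊤)
open import Data.Vec.Base using (Vec; []; _∷_; lookup)
open import Function.Bundles using (_⇔_)
open import Function.Definitions using (Congruent)
open import Induction.WellFounded using (WellFounded; Acc; acc)
open import Level using (Level; 0ℓ) renaming (suc to lsuc; _⊔_ to _⊔ˡ_)
open import Relation.Binary.Bundles using (StrictTotalOrder)
import Relation.Binary.Construct.On as On
open import Relation.Binary.Morphism.Structures using (IsOrderIsomorphism)
open import Relation.Binary.PropositionalEquality.Core using (_≡_; refl)
open import Relation.Nullary.Negation.Core using (¬_)

private
  variable
    ℓ ℓ₁ ℓ₂ : Level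

-- Elements are compared up to the setoid equality _≈_ of the order.
record Ordinal (ℓ : Level) : Set (lsuc ℓ) where
  field
    strictTotalOrder : StrictTotalOrder ℓ ℓ ℓ
  open StrictTotalOrder strictTotalOrder public
  field
    wellFounded : WellFounded _<_

∣_∣ : Ordinal ℓ → Set ℓ
∣ α ∣ = Ordinal.Carrier α

infix 4 _≅_ _≺_ _≼_

_≅_ : Ordinal ℓ₁ → Ordinal ℓ₂ → Set (ℓ₁ ⊔ˡ ℓ₂)
α ≅ β = ∃ (IsOrderIsomorphism α._≈_ β._≈_ α._<_ β._<_)
  where
  module α = Ordinal α
  module β = Ordinal β

-- The initial segment of elements below a given one.
_↓_ : (α : Ordinal ℓ) → ∣ α ∣ → Ordinal ℓ
α ↓ a = record
  { strictTotalOrder = On.strictTotalOrder strictTotalOrder π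
  ; wellFounded      = On.wellFounded π wellFounded
  }
  where
  open Ordinal α
  π : Σ[ x ∈ ∣ α ∣ ] x < a → ∣ α ∣
  π = proj₁

_≺_ : Ordinal ℓ₁ → Ordinal ℓ₂ → Set (ℓ₁ ⊔ˡ ℓ₂)
α ≺ β = ∃[ b ] α ≅ β ↓ b

_≼_ : Ordinal ℓ₁ → Ordinal ℓ₂ → Set (ℓ₁ ⊔ˡ ℓ₂)
α ≼ β = α ≺ β ⊎ α ≅ β

ω : Ordinal 0ℓ
ω = record
  { strictTotalOrder = ℕ.<-strictTotalOrder
  ; wellFounded      = ℕ.<-wellFounded
  }

fin : ℕ → Ordinal 0ℓ
fin n = record
  { strictTotalOrder = Fin.<-strictTotalOrder n
  ; wellFounded      = Fin.<-wellFounded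
  }

𝟎 : Ordinal ℓ
𝟎 = record
  { strictTotalOrder = record
    { Carrier            = ⊥
    ; _≈_                = λ ()
    ; _<_                = λ ()
    ; isStrictTotalOrder = record
      { isStrictPartialOrder = record
        { isEquivalence = record
          { refl  = λ { {()} }
          ; sym   = λ { {()} }
          ; trans = λ { {()} }
          }
        ; irrefl   = λ { {()} }
        ; trans    = λ { {()} }
        ; <-resp-≈ = (λ { {()} }) , (λ { {()} })
        }
      ; compare = λ ()
      }
    }
  ; wellFounded = λ ()
  }

infixl 6 _+_
infixl 7 _·_

_+_ : Ordinal ℓ₁ → Ordinal ℓ₂ → Ordinal (ℓ₁ ⊔ˡ ℓ₂)
α + β = record
  { strictTotalOrder = record
    { isStrictTotalOrder = ⊎-<-isStrictTotalOrder α.isStrictTotalOrder β.isStrictTotalOrder }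
  ; wellFounded = ⊎-<-wellFounded α.wellFounded β.wellFounded
  }
  where
  module α = Ordinal α
  module β = Ordinal β

_·_ : Ordinal ℓ → ℕ → Ordinal ℓ
α · zero  = 𝟎
α · suc n = α · n + α

-- Exponentiation as the set of finitely supported functions α → ω, where
-- f < g when f a < g a at the largest a at which they differ.  A function
-- f is given by the list of the pairs (a , n) with f a = suc n, in strictly
-- decreasing order of a, so that the order becomes the lexicographic one.
module _ (α : Ordinal ℓ) where
  private
    module α = Ordinal α

    lex : StrictTotalOrder ℓ ℓ ℓ
    lex = Lex.<-strictTotalOrder (×-strictTotalOrder α.strictTotalOrder ℕ.<-strictTotalOrder)

    Decreasing : List (∣ α ∣ × ℕ) → Set ℓ
    Decreasing = Linked (λ s t → proj₁ t α.< proj₁ s)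

    π : Σ (List (∣ α ∣ × ℕ)) Decreasing → List (∣ α ∣ × ℕ)
    π = proj₁

    order : StrictTotalOrder ℓ ℓ ℓ
    order = On.strictTotalOrder lex π

    open StrictTotalOrder order using (_<_)

    acc-[] : Acc _<_ ([] , [])
    acc-[] = acc λ { {_ ∷ _ , _} () ; {[] , _} (base ()) }

    acc-∷ : ∀ {a} → Acc α._<_ a → ∀ {b} → b α.≈ a → ∀ {n t} (d : Decreasing ((b , n) ∷ t)) →
            Acc _<_ ((b , n) ∷ t , d)
    acc-∷ {a} (acc rec) b≈a d = go b≈a (ℕ.<-wellFounded _) (acc-tail b≈a d) d
      where
      acc-tail : ∀ {b} → b α.≈ a → ∀ {n t} (d : Decreasing ((b , n) ∷ t)) →
                 Acc _<_ (t , Linked.tail d)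
      acc-tail b≈a [-]       = acc-[]
      acc-tail b≈a (c<b ∷ d) = acc-∷ (rec (α.<-respʳ-≈ b≈a c<b)) α.Eq.refl d

      below : ∀ {b} → b α.≈ a → ∀ {n} → Acc ℕ._<_ n → ∀ {t e} → Acc _<_ (t , e) →
              (d : Decreasing ((b , n) ∷ t)) → ∀ {s} → s < ((b , n) ∷ t , d) → Acc _<_ s
      go    : ∀ {b} → b α.≈ a → ∀ {n} → Acc ℕ._<_ n → ∀ {t e} → Acc _<_ (t , e) →
              (d : Decreasing ((b , n) ∷ t)) → Acc _<_ ((b , n) ∷ t , d)

      go b≈a accₙ accₜ d = acc (below b≈a accₙ accₜ d)

      below b≈a _ _ _ {[] , []} _ = acc-[]
      below b≈a _ _ _ {_ ∷ _ , d} (this (inj₁ c<b)) =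
        acc-∷ (rec (α.<-respʳ-≈ b≈a c<b)) α.Eq.refl d
      below b≈a (acc recₙ) _ _ {_ ∷ _ , d} (this (inj₂ (c≈b , m<n))) =
        go c≈a (recₙ m<n) (acc-tail c≈a d) d
        where c≈a = α.Eq.trans c≈b b≈a
      below b≈a accₙ (acc recₜ) _ {_ ∷ _ , d} (next (c≈b , refl) s<t) =
        go (α.Eq.trans c≈b b≈a) accₙ (recₜ {_ , Linked.tail d} s<t) d

  infix 8 ω^_

  ω^_ : Ordinal ℓ
  ω^_ = record
    { strictTotalOrder = order
    ; wellFounded      = λ where
        ([]    , [])  → acc-[]
        (_ ∷ _ , d)   → acc-∷ (α.wellFounded _) α.Eq.refl d
    }

-- For total orders, ¬ (f i < a) says a ≤ f i.
CofinalMap : Ordinal ℓ₁ → Ordinal ℓ₂ → Set (ℓ₁ ⊔ˡ ℓ₂)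
CofinalMap κ α =
  Σ[ f ∈ (∣ κ ∣ → ∣ α ∣) ] Congruent κ._≈_ α._≈_ f × (∀ a → ∃[ i ] ¬ (f i α.< a))
  where
  module κ = Ordinal κ
  module α = Ordinal α

-- κ is the least ordinal with a cofinal map into α.
IsCofinalityOf : Ordinal ℓ₁ → Ordinal ℓ₂ → Set (ℓ₁ ⊔ˡ lsuc ℓ₂)
IsCofinalityOf {ℓ₂ = ℓ₂} κ α =
  CofinalMap κ α × ((μ : Ordinal ℓ₂) → CofinalMap μ α → κ ≼ μ)

data Cofinality : Set where
  cf=ω cf>ω : Cofinality

HasCofinality : Ordinal ℓ → Cofinality → Set (lsuc ℓ)
HasCofinality     α cf=ω = IsCofinalityOf ω α
HasCofinality {ℓ} α cf>ω = Σ[ κ ∈ Ordinal ℓ ] IsCofinalityOf κ α × ω ≺ κ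

record ColouredOrdinal (d : ℕ) (ℓ : Level) : Set (lsuc ℓ) where
  field
    ordinal : Ordinal ℓ
  open Ordinal ordinal public
  field
    Colour    : Fin d → Carrier → Set ℓ
    respects  : ∀ {i x y} → x ≈ y → Colour i x → Colour i y
    partition : ∀ x → ∃! _≡_ (λ i → Colour i x)

infix  9 _≐_ _<′_
infixr 7 _∧′_
infixr 6 _∨′_
infixr 5 _⇒′_

-- Formulas with free variables among n de Bruijn indices.
data Formula (d n : ℕ) : Set where
  _≐_ _<′_         : Fin n → Fin n → Formula d n
  colour           : Fin d → Fin n → Formula d n
  ⊤′ ⊥′            : Formula d n
  ¬′_              : Formula d n → Formula d n
  _∧′_ _∨′_ _⇒′_   : Formula d n → Formula d n → Formula d n
  ∀′_ ∃′_          : Formula d (suc n) → Formula d n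

Sentence : ℕ → Set
Sentence d = Formula d 0

rank : ∀ {d n} → Formula d n → ℕ
rank (x ≐ y)      = 0
rank (x <′ y)     = 0
rank (colour i x) = 0
rank ⊤′           = 0
rank ⊥′           = 0
rank (¬′ φ)       = rank φ
rank (φ ∧′ ψ)     = rank φ ⊔ rank ψ
rank (φ ∨′ ψ)     = rank φ ⊔ rank ψ
rank (φ ⇒′ ψ)     = rank φ ⊔ rank ψ
rank (∀′ φ)       = suc (rank φ)
rank (∃′ φ)       = suc (rank φ)

module _ {d} (A : ColouredOrdinal d ℓ) where
  open ColouredOrdinal A

  Holds : ∀ {n} → Formula d n → Vec Carrier n → Set ℓ
  Holds (x ≐ y)      ρ = lookup ρ x ≈ lookup ρ y
  Holds (x <′ y)     ρ = lookup ρ x < lookup ρ y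
  Holds (colour i x) ρ = Colour i (lookup ρ x)
  Holds ⊤′           ρ = ⊤
  Holds ⊥′           ρ = ⊥
  Holds (¬′ φ)       ρ = ¬ Holds φ ρ
  Holds (φ ∧′ ψ)     ρ = Holds φ ρ × Holds ψ ρ
  Holds (φ ∨′ ψ)     ρ = Holds φ ρ ⊎ Holds ψ ρ
  Holds (φ ⇒′ ψ)     ρ = Holds φ ρ → Holds ψ ρ
  Holds (∀′ φ)       ρ = ∀ x → Holds φ (x ∷ ρ)
  Holds (∃′ φ)       ρ = ∃[ x ] Holds φ (x ∷ ρ)

infix 4 _⊨_ _≡[_]_

_⊨_ : ∀ {d} → ColouredOrdinal d ℓ → Sentence d → Set ℓ
A ⊨ φ = Holds A φ []

_≡[_]_ : ∀ {d} → ColouredOrdinal d ℓ → ℕ → ColouredOrdinal d ℓ → Set ℓ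
A ≡[ q ] B = ∀ φ → rank φ ℕ.≤ q → A ⊨ φ ⇔ B ⊨ φ

-- σ is a q-characteristic sentence of the ≡[ q ]-class of A.
IsCharacteristic : ∀ {d} → ℕ → Sentence d → ColouredOrdinal d ℓ → Set (lsuc ℓ)
IsCharacteristic q σ A = rank σ ℕ.≤ q × (∀ B → B ⊨ σ ⇔ A ≡[ q ] B)

Nonempty : ∀ {d} → ColouredOrdinal d ℓ → Set ℓ
Nonempty A = ColouredOrdinal.Carrier A

-- The finite set listed by S is an admissible choice of Σ⁺_d(q).
record IsΣ⁺ (ℓ : Level) (d q : ℕ) (S : List (Sentence d)) : Set (lsuc ℓ) where
  field
    characteristic : ∀ {σ} → σ ∈ S →
                     Σ[ A ∈ ColouredOrdinal d ℓ ] Nonempty A × IsCharacteristic q σ A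
    exactlyOne     : (A : ColouredOrdinal d ℓ) → Nonempty A →
                     ∃! _≡_ (λ σ → σ ∈ S × IsCharacteristic q σ A)

-- ω ^ exponent · coefficient
record Term (E : Set) : Set where
  field
    exponent        : E
    coefficient     : ℕ
    .{{isPositive}} : NonZero coefficient

open Term

-- The data an algorithm has access to: codes for the infinite exponents,
-- and the cofinality of a nonempty sum of terms with such exponents.  What
-- these data mean is kept separate, in Interpretation.
record Notations : Set₁ where
  field
    Code : Set
    cf   : List⁺ (Term Code) → Cofinality

-- The terms with infinite exponents make up α₀, the others make up θ.
record CNF (N : Notations) : Set where
  field
    infiniteTerms : List (Term (Notations.Code N))
    finiteTerms   : List (Term ℕ)

sum : {E : Set} → (E → Ordinal ℓ) → List (Term E) → Ordinal ℓ
sum ⟦_⟧ ts = foldr _+_ 𝟎 (map (λ t → ω^ ⟦ exponent t ⟧ · coefficient t) ts)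

DecreasingExponents : {E : Set} → (E → Ordinal ℓ) → List (Term E) → Set ℓ
DecreasingExponents ⟦_⟧ = Linked (λ s t → ⟦ exponent t ⟧ ≺ ⟦ exponent s ⟧)

record Interpretation (ℓ : Level) (N : Notations) : Set (lsuc ℓ) where
  open Notations N
  field
    ⟦_⟧        : Code → Ordinal ℓ
    infinite   : ∀ c → ω ≼ ⟦ c ⟧
    cf-correct : ∀ ts → DecreasingExponents ⟦_⟧ (toList ts) →
                 HasCofinality (sum ⟦_⟧ (toList ts)) (cf ts)

module _ {N : Notations} (I : Interpretation ℓ N) where
  open Interpretation I
  open CNF

  IsCNF : CNF N → Set ℓ
  IsCNF α = DecreasingExponents ⟦_⟧ (infiniteTerms α) × DecreasingExponents fin (finiteTerms α)

  ordinalOf : CNF N → Ordinal ℓ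
  ordinalOf α = sum ⟦_⟧ (infiniteTerms α) + sum fin (finiteTerms α)

{-# OPTIONS --safe #-}

-- The rank-q theory of a coloured ordinal is encoded by a finite type, and
-- the types of sums and of ω-sums with constant summand are computed from
-- the types of the summands.  So the set of types of the colourings of α is
-- multiplicative in α, and by Ramsey's theorem that of ω^(n+1) is computable
-- from that of ω^n.  These sets stabilise, to P say.  A multiple α₀ > 0 of a
-- large power of ω then has exactly the types in P when cf α₀ = ω, and the
-- types s e with s, e ∈ P and e e = e = e^ω when cf α₀ > ω.  For the second
-- case one finds a closed unbounded set of points that look like the end of
-- α₀; going past such points requires that every type in P factors as s e p
-- with s, e, p ∈ P and e as before.
module Submission where

open import Axiom.ExcludedMiddle using (ExcludedMiddle)
open import Data.Bool.Base using (Bool; true; false; if_then_else_)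
open import Data.Empty using (⊥; ⊥-elim)
open import Data.Fin.Base as Fin using (Fin; toℕ; fromℕ; inject₁)
import Data.Fin.Properties as Fin
open import Data.Fin.Relation.Unary.Top using (view; ‵fromℕ; ‵inject₁)
open import Data.List.Base using (List)
open import Data.List.Membership.Propositional using (_∈_)
open import Data.Nat.Base as ℕ using (ℕ; NonZero; _≤_; z≤n; s≤s)
import Data.Nat.Properties as ℕ
open import Data.Product using (Σ; Σ-syntax; ∃; ∃-syntax; ∃₂; _×_; _,_; proj₁; proj₂)
open import Data.Product.Function.NonDependent.Propositional using (_×-↔_)
open import Data.Product.Relation.Binary.Lex.Strict using (×-strictTotalOrder)
open import Data.Sum.Base as ⊎ using (_⊎_; inj₁; inj₂; [_,_]′)
open import Data.Sum.Relation.Binary.LeftOrder using (₁∼₁; ₁∼₂; ₂∼₂)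
open import Data.Sum.Relation.Binary.Pointwise using (inj₁; inj₂)
open import Data.Unit.Base using (⊤; tt)
open import Data.Unit.Polymorphic.Base using () renaming (⊤ to ⊤ₚ; tt to ttₚ)
open import Data.Vec.Base as Vec using (Vec; []; _∷_; lookup)
import Data.Vec.Properties as Vec
open import Defs using (Ordinal)
open import Function.Base using (_∘_; id)
open import Function.Bundles using (_↔_; _⇔_; Inverse; mk↔ₛ′; mk⇔)
open import Function.Construct.Composition using (_↔-∘_; _⇔-∘_)
open import Function.Construct.Identity using (↔-id)
open import Function.Construct.Symmetry using (↔-sym)
open import Induction.WellFounded using (Acc; acc)
open import Level using (Level; 0ℓ; Lift; lift) renaming (suc to lsuc; _⊔_ to _⊔ˡ_)
open import Relation.Binary.Bundles using (StrictTotalOrder)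
import Relation.Binary.Construct.On as On
open import Relation.Binary.Definitions using (tri<; tri≈; tri>)
import Relation.Binary.Morphism.Construct.Identity as Identity
open import Relation.Binary.Morphism.Structures using (IsOrderIsomorphism)
open import Relation.Binary.PropositionalEquality
  using (_≡_; _≗_; refl; sym; trans; cong; cong₂; subst; subst₂; module ≡-Reasoning)
open import Relation.Nullary.Decidable
  using (Dec; yes; no; does; map′; dec-true; decidable-stable; ¬?; _×-dec_; _⊎-dec_; _→-dec_)
open import Relation.Nullary.Negation using (¬_; contradiction)

-- The decision function is produced before excluded middle is assumed, while statements about
-- actual coloured orders are classical. So types, their operations and sets of types are finite
-- data that can be searched, and excluded middle enters with correctness. The laws of the algebra
-- are proved on the data, since an element need not be the type of any structure. Iterating an
-- operation on finitely many sets only guarantees a cycle. Period one comes from absorption, ω^m +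
-- ω^n = ω^n for m < n: sets on the cycle absorb one another, and (y x)^ω = y (x y)^ω then
-- identifies the sets of their ω-sums. The ordinal α₀ is a multiple of ω^K for each finite K
-- because K is an initial segment of every infinite exponent. In α₀ = ω^K · B the factor B is an
-- arbitrary well-order. It is treated by induction on initial segments, which have a maximum, a
-- cofinal ω-sequence, or neither. No longer sums are needed in the last case: by reflection the
-- final part has the type of an interval that ends earlier.

-- Finite types and their subsets

module FiniteSets where
  open import Data.Fin.Base using (zero; suc; finToFun; funToFin)
  open import Data.Nat.Base using (zero; suc; _^_; _*_)

  private variable
    p : Level

  record Finite (A : Set) : Set where
    field
      size  : ℕ
      index : A ↔ Fin size

    open Inverse index public using (to; from; strictlyInverseˡ; strictlyInverseʳ)

  open Finite

  ⊤-finite : Finite ⊤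
  ⊤-finite = record { size = 1 ; index = ↔-sym Fin.1↔⊤ }

  Fin-finite : ∀ n → Finite (Fin n)
  Fin-finite n = record { size = n ; index = ↔-id _ }

  ×-finite : {A B : Set} → Finite A → Finite B → Finite (A × B)
  ×-finite F G = record { size = size F * size G ; index = ↔-sym Fin.*↔× ↔-∘ (index F ×-↔ index G) }

  index-injective : {A : Set} (F : Finite A) {x y : A} → to F x ≡ to F y → x ≡ y
  index-injective F {x} {y} eq =
    trans (sym (strictlyInverseʳ F x)) (trans (cong (from F) eq) (strictlyInverseʳ F y))

  any-finite : {A : Set} (F : Finite A) {P : A → Set p} → (∀ x → Dec (P x)) → Dec (∃ P)
  any-finite F {P} P? = map′ (λ (i , h) → from F i , h)
                             (λ (x , h) → to F x , subst P (sym (strictlyInverseʳ F x)) h)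
                             (Fin.any? (P? ∘ from F))

  all-finite : {A : Set} (F : Finite A) {P : A → Set p} → (∀ x → Dec (P x)) → Dec (∀ x → P x)
  all-finite F P? = map′ (λ h x → decidable-stable (P? x) (λ ¬p → h (x , ¬p)))
                         (λ h (x , ¬p) → ¬p (h x))
                         (¬? (any-finite F (¬? ∘ P?)))

  ≟-finite : {A : Set} → Finite A → (x y : A) → Dec (x ≡ y)
  ≟-finite F x y = map′ (index-injective F) (cong (to F)) (to F x Fin.≟ to F y)

  -- A subset is coded by a number and is not a predicate: then subsets with the same members are
  -- propositionally equal without function extensionality (`ℙ-ext`), and a set of subsets is again
  -- finite. The record keeps `F` inferable from the type.
  record ℙ {A : Set} (F : Finite A) : Set where
    constructor encode
    field bits : Fin (2 ^ size F)

  open ℙ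

  ℙ-finite : {A : Set} (F : Finite A) → Finite (ℙ F)
  ℙ-finite F = record { size = 2 ^ size F ; index = mk↔ₛ′ bits encode (λ _ → refl) (λ _ → refl) }

  module _ {A : Set} {F : Finite A} where

    infix 4 _∋_ _∋?_

    record _∋_ (X : ℙ F) (x : A) : Set where
      constructor is-set
      field bit-set : finToFun (bits X) (to F x) ≡ suc zero

    open _∋_

    _∋?_ : ∀ X x → Dec (X ∋ x)
    X ∋? x = map′ is-set bit-set (finToFun (bits X) (to F x) Fin.≟ suc zero)

    abstract

      private
        bit : {P : A → Set p} → (∀ x → Dec (P x)) → Fin (size F) → Fin 2
        bit P? i = if does (P? (from F i)) then suc zero else zero

      ⟪_⟫ : {P : A → Set p} → (∀ x → Dec (P x)) → ℙ F
      ⟪ P? ⟫ = encode (funToFin (bit P?))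

      private
        bit-to : {P : A → Set p} (P? : ∀ x → Dec (P x)) → ∀ x →
                 finToFun (funToFin (bit P?)) (to F x) ≡ (if does (P? x) then suc zero else zero)
        bit-to P? x = trans (Fin.finToFun-funToFin (bit P?) (to F x))
          (cong (λ y → if does (P? y) then suc zero else zero) (strictlyInverseʳ F x))

      ⟪⟫⁺ : {P : A → Set p} (P? : ∀ x → Dec (P x)) → ∀ {x} → P x → ⟪ P? ⟫ ∋ x
      ⟪⟫⁺ P? {x} h with P? x in eq
      ... | yes _ = is-set (trans (bit-to P? x) (cong (λ D → if does D then suc zero else zero) eq))
      ... | no ¬h = contradiction h ¬h

      ⟪⟫⁻ : {P : A → Set p} (P? : ∀ x → Dec (P x)) → ∀ {x} → ⟪ P? ⟫ ∋ x → P x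
      ⟪⟫⁻ P? {x} h with P? x | bit-to P? x
      ... | yes h′ | _  = h′
      ... | no _   | eq = contradiction (trans (sym (bit-set h)) eq) λ ()

    ∅ : ℙ F
    ∅ = ⟪ (λ _ → no ⊥-elim) ⟫

    ∅⁻ : ∀ {x} → ¬ ∅ ∋ x
    ∅⁻ = ⟪⟫⁻ (λ _ → no ⊥-elim)

    private
      bit-≡ : (i j : Fin 2) → (i ≡ suc zero → j ≡ suc zero) → (j ≡ suc zero → i ≡ suc zero) → i ≡ j
      bit-≡ zero       zero       _ _ = refl
      bit-≡ zero       (suc zero) _ g = g refl
      bit-≡ (suc zero) j          f _ = sym (f refl)

      funToFin-cong : ∀ {m n} {f g : Fin m → Fin n} → f ≗ g → funToFin f ≡ funToFin g
      funToFin-cong {zero}  h = refl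
      funToFin-cong {suc m} h =
        cong₂ Fin.combine (h zero) (funToFin-cong (λ i → h (suc i)))

    ℙ-ext : {X Y : ℙ F} → (∀ x → X ∋ x → Y ∋ x) → (∀ x → Y ∋ x → X ∋ x) → X ≡ Y
    ℙ-ext {encode X} {encode Y} f g = cong encode
      (trans (sym (Fin.funToFin-finToFin {size F} {2} X))
        (trans (funToFin-cong same) (Fin.funToFin-finToFin {size F} {2} Y)))
      where
      same : finToFun X ≗ finToFun Y
      same i = subst (λ j → finToFun X j ≡ finToFun Y j) (strictlyInverseˡ F i)
        (bit-≡ _ _ (bit-set ∘ f (from F i) ∘ is-set) (bit-set ∘ g (from F i) ∘ is-set))

  pigeonhole-ℕ : {A : Set} (F : Finite A) (f : ℕ → A) →
                 ∃₂ λ i j → i ℕ.< j × j ℕ.≤ size F × f i ≡ f j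
  pigeonhole-ℕ F f with Fin.pigeonhole (ℕ.n<1+n (size F)) (to F ∘ f ∘ toℕ)
  ... | i , j , i<j , eq = toℕ i , toℕ j , i<j , ℕ.s≤s⁻¹ (Fin.toℕ<n j) , index-injective F eq

open FiniteSets

-- A record, so that excluded middle can be an instance argument, at several levels at once. No
-- definition that the decision procedure evaluates takes it.
record EM (a : Level) : Set (lsuc a) where
  field em : (P : Set a) → Dec P

open EM ⦃ ... ⦄ public

-- The finite algebra of types: product, star and ω-power

module Types (d : ℕ) where
  open import Data.Nat.Base using (zero; suc)

  -- A type of rank q + 1 consists of the type of rank q and of the set of
  -- the triples (type before x, colour of x, type after x), all x.
  Ty : ℕ → Set
  Ty-finite : ∀ q → Finite (Ty q)

  Triple-finite : ∀ q → Finite (Ty q × Fin d × Ty q)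
  Triple-finite q = ×-finite (Ty-finite q) (×-finite (Fin-finite d) (Ty-finite q))

  Ty zero    = ⊤
  Ty (suc q) = Ty q × ℙ (Triple-finite q)

  Ty-finite zero    = ⊤-finite
  Ty-finite (suc q) = ×-finite (Ty-finite q) (ℙ-finite (Triple-finite q))

  private variable
    q : ℕ

  infix 4 _≟ᵗ_
  _≟ᵗ_ : (t u : Ty q) → Dec (t ≡ u)
  _≟ᵗ_ = ≟-finite (Ty-finite _)

  Tys : ℕ → Set
  Tys q = ℙ (Ty-finite q)

  any-Ty : ∀ {p} {P : Ty q → Set p} → (∀ x → Dec (P x)) → Dec (∃ P)
  any-Ty = any-finite (Ty-finite _)

  ε : Ty q
  ε {zero}  = tt
  ε {suc q} = ε , ∅

  point : Fin d → Ty q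
  point {zero}  c = tt
  point {suc q} c = point c , ⟪ (λ t → ≟-finite (Triple-finite q) t (ε , c , ε)) ⟫

  -- A point of a sum lies in the left summand, and then the whole right summand comes after it, or
  -- in the right one, and then the whole left summand comes before it. The product of the lower
  -- rank is a parameter because `_∙_` is being defined by recursion on the rank.
  module Product {q} (_∙_ : Ty q → Ty q → Ty q) (t : Ty q) (T : ℙ (Triple-finite q))
                 (u : Ty q) (U : ℙ (Triple-finite q)) where

    In : Ty q × Fin d × Ty q → Set
    In (l , c , r) = (∃[ r′ ] T ∋ (l , c , r′) × r ≡ r′ ∙ u) ⊎ (∃[ l′ ] U ∋ (l′ , c , r) × l ≡ t ∙ l′)

    In? : ∀ x → Dec (In x)
    In? (l , c , r) = any-Ty (λ r′ → (T ∋? (l , c , r′)) ×-dec (r ≟ᵗ (r′ ∙ u))) ⊎-dec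
                      any-Ty (λ l′ → (U ∋? (l′ , c , r)) ×-dec (l ≟ᵗ (t ∙ l′)))

    abstract
      set : ℙ (Triple-finite q)
      set = ⟪ In? ⟫

      set⁺ : ∀ {x} → In x → set ∋ x
      set⁺ = ⟪⟫⁺ In?

      set⁻ : ∀ {x} → set ∋ x → In x
      set⁻ = ⟪⟫⁻ In?

  infixl 7 _∙_
  _∙_ : Ty q → Ty q → Ty q
  _∙_ {zero}  _       _       = tt
  _∙_ {suc q} (t , T) (u , U) = t ∙ u , Product.set _∙_ t T u U

  pow : Ty q → ℕ → Ty q
  pow e zero    = ε
  pow e (suc n) = e ∙ pow e n

  data Star (P : Ty q → Set) : Ty q → Set where
    []  : Star P ε
    _∷_ : ∀ {x u} → P x → Star P u → Star P (x ∙ u)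

  Closed : Tys q → Tys q → Set
  Closed X Y = Y ∋ ε × (∀ x → X ∋ x → ∀ u → Y ∋ u → Y ∋ (x ∙ u))

  -- Membership in the generated submonoid is made decidable by quantifying
  -- over the finitely many sets of types.
  star? : (X : Tys q) (p : Ty q) → Dec (∀ Y → Closed X Y → Y ∋ p)
  star? X p = all-finite (ℙ-finite (Ty-finite _))
    (λ Y → ((Y ∋? ε) ×-dec all-finite (Ty-finite _) (λ x → (X ∋? x) →-dec
             all-finite (Ty-finite _) (λ u → (Y ∋? u) →-dec (Y ∋? (x ∙ u))))) →-dec (Y ∋? p))

  abstract
    star : Tys q → Tys q
    star X = ⟪ star? X ⟫

    star⁺-closed : (X : Tys q) → ∀ {p} → (∀ Y → Closed X Y → Y ∋ p) → star X ∋ p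
    star⁺-closed X = ⟪⟫⁺ (star? X)

    star⁻-closed : (X : Tys q) → ∀ {p} → star X ∋ p → ∀ Y → Closed X Y → Y ∋ p
    star⁻-closed X = ⟪⟫⁻ (star? X)

  single : Ty q → Tys q
  single e = ⟪ _≟ᵗ e ⟫

  -- A point of an ω-sum has finitely many complete copies before its own copy and ω copies after
  -- it. The number of copies is unbounded, but their type p ranges over the decidable set of powers
  -- of t.
  module Omega {q : ℕ} (t : Ty q) (T : ℙ (Triple-finite q)) (tω : Ty q) where

    In : Ty q × Fin d × Ty q → Set
    In (l , c , r) = ∃[ p ] ∃[ l′ ] ∃[ r′ ] star (single t) ∋ p × T ∋ (l′ , c , r′) × l ≡ p ∙ l′ × r ≡ r′ ∙ tω

    In? : ∀ x → Dec (In x)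
    In? (l , c , r) = any-Ty (λ p → any-Ty λ l′ → any-Ty λ r′ →
      (star (single t) ∋? p) ×-dec (T ∋? (l′ , c , r′)) ×-dec (l ≟ᵗ p ∙ l′) ×-dec (r ≟ᵗ r′ ∙ tω))

    abstract
      set : ℙ (Triple-finite q)
      set = ⟪ In? ⟫

      set⁺ : ∀ {x} → In x → set ∋ x
      set⁺ = ⟪⟫⁺ In?

      set⁻ : ∀ {x} → set ∋ x → In x
      set⁻ = ⟪⟫⁻ In?

  infix 8 _^ω
  _^ω : Ty q → Ty q
  _^ω {zero}  _       = tt
  _^ω {suc q} (t , T) = t ^ω , Omega.set t T (t ^ω)

  ε-identityˡ : (t : Ty q) → ε ∙ t ≡ t
  ε-identityˡ {zero}  _       = refl
  ε-identityˡ {suc q} (t , T) = cong₂ _,_ (ε-identityˡ t) (ℙ-ext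
    (λ x h → to (Product.set⁻ _∙_ ε _ t T h))
    (λ (l , c , r) h → Product.set⁺ _∙_ ε _ t T (inj₂ (l , h , sym (ε-identityˡ l)))))
    where
    to : ∀ {l c r} → Product.In _∙_ ε (proj₂ (ε {suc q})) t T (l , c , r) → T ∋ (l , c , r)
    to (inj₁ (_ , h , _))   = contradiction h ∅⁻
    to (inj₂ (l′ , h , eq)) = subst (λ l → T ∋ (l , _)) (sym (trans eq (ε-identityˡ l′))) h

  ε-identityʳ : (t : Ty q) → t ∙ ε ≡ t
  ε-identityʳ {zero}  _       = refl
  ε-identityʳ {suc q} (t , T) = cong₂ _,_ (ε-identityʳ t) (ℙ-ext
    (λ x h → to (Product.set⁻ _∙_ t T ε _ h))
    (λ (l , c , r) h → Product.set⁺ _∙_ t T ε _ (inj₁ (r , h , sym (ε-identityʳ r)))))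
    where
    to : ∀ {l c r} → Product.In _∙_ t T ε (proj₂ (ε {suc q})) (l , c , r) → T ∋ (l , c , r)
    to (inj₂ (_ , h , _))   = contradiction h ∅⁻
    to (inj₁ (r′ , h , eq)) = subst (λ r → T ∋ (_ , _ , r)) (sym (trans eq (ε-identityʳ r′))) h

  module Assoc (t : Ty q) (T : ℙ (Triple-finite q)) (u : Ty q) (U : ℙ (Triple-finite q))
               (v : Ty q) (V : ℙ (Triple-finite q))
               (assoc : (t u v : Ty q) → (t ∙ u) ∙ v ≡ t ∙ (u ∙ v)) where

    module TU   = Product {q} _∙_ t T u U
    module UV   = Product {q} _∙_ u U v V
    module TU-V = Product {q} _∙_ (t ∙ u) TU.set v V
    module T-UV = Product {q} _∙_ t T (u ∙ v) UV.set

    to : ∀ x → TU-V.In x → T-UV.In x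
    to x (inj₁ (_ , h , refl)) with TU.set⁻ h
    ... | inj₁ (r , k , refl) = inj₁ (r , k , assoc r u v)
    ... | inj₂ (l , k , refl) = inj₂ (l , UV.set⁺ (inj₁ (_ , k , refl)) , refl)
    to x (inj₂ (l , h , refl)) = inj₂ (_ , UV.set⁺ (inj₂ (l , h , refl)) , assoc t u l)

    from : ∀ x → T-UV.In x → TU-V.In x
    from x (inj₁ (r , k , refl)) = inj₁ (_ , TU.set⁺ (inj₁ (r , k , refl)) , sym (assoc r u v))
    from x (inj₂ (_ , h , refl)) with UV.set⁻ h
    ... | inj₁ (_ , k , refl) = inj₁ (_ , TU.set⁺ (inj₂ (_ , k , refl)) , refl)
    ... | inj₂ (l , k , refl) = inj₂ (l , k , sym (assoc t u l))

    set-assoc : TU-V.set ≡ T-UV.set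
    set-assoc = ℙ-ext (λ x h → T-UV.set⁺ (to x (TU-V.set⁻ h)))
                      (λ x h → TU-V.set⁺ (from x (T-UV.set⁻ h)))

  ∙-assoc : (t u v : Ty q) → (t ∙ u) ∙ v ≡ t ∙ (u ∙ v)
  ∙-assoc {zero}  _ _ _ = refl
  ∙-assoc {suc q} (t , T) (u , U) (v , V) =
    cong₂ _,_ (∙-assoc t u v) (Assoc.set-assoc t T u U v V ∙-assoc)

  module _ ⦃ _ : EM 0ℓ ⦄ where

    star⁺ : (X : Tys q) → ∀ {p} → Star (X ∋_) p → star X ∋ p
    star⁺ X s = star⁺-closed X (λ Y (ε∈ , ∷∈) → go Y ε∈ ∷∈ s)
      where
      go : ∀ Y → Y ∋ ε → (∀ x → X ∋ x → ∀ u → Y ∋ u → Y ∋ (x ∙ u)) → ∀ {p} → Star (X ∋_) p → Y ∋ p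
      go Y ε∈ ∷∈ []      = ε∈
      go Y ε∈ ∷∈ (x ∷ s) = ∷∈ _ x _ (go Y ε∈ ∷∈ s)

    -- Excluded middle makes `Star` itself one of the sets `Y` over which `star` quantifies, and
    -- this set is closed.
    star⁻ : (X : Tys q) → ∀ {p} → star X ∋ p → Star (X ∋_) p
    star⁻ X h = ⟪⟫⁻ S? (star⁻-closed X h ⟪ S? ⟫
      (⟪⟫⁺ S? [] , λ x x∈ u u∈ → ⟪⟫⁺ S? (x∈ ∷ ⟪⟫⁻ S? u∈)))
      where S? = λ p → em (Star (X ∋_) p)

    pow∈star : (e : Ty q) → ∀ n → star (single e) ∋ pow e n
    pow∈star e n = star⁺ (single e) (go n)
      where
      go : ∀ n → Star (single e ∋_) (pow e n)
      go zero    = []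
      go (suc n) = ⟪⟫⁺ (_≟ᵗ e) refl ∷ go n

    star-pow : (e : Ty q) → ∀ {p} → star (single e) ∋ p → ∃[ n ] p ≡ pow e n
    star-pow e h = go (star⁻ (single e) h)
      where
      go : ∀ {p} → Star (single e ∋_) p → ∃[ n ] p ≡ pow e n
      go []      = 0 , refl
      go (x ∷ s) with ⟪⟫⁻ (_≟ᵗ e) x | go s
      ... | refl | n , refl = suc n , refl

    InOmega : (t : Ty q) (T : ℙ (Triple-finite q)) → Ty q × Fin d × Ty q → Set
    InOmega t T (l , c , r) =
      ∃[ n ] ∃[ l′ ] ∃[ r′ ] T ∋ (l′ , c , r′) × l ≡ pow t n ∙ l′ × r ≡ r′ ∙ t ^ω

    ω⁺ : (t : Ty q) (T : ℙ (Triple-finite q)) → ∀ {x} → InOmega t T x → proj₂ ((t , T) ^ω) ∋ x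
    ω⁺ t T (n , l , r , h , eq) = Omega.set⁺ t T (t ^ω) (_ , l , r , pow∈star t n , h , eq)

    ω⁻ : (t : Ty q) (T : ℙ (Triple-finite q)) → ∀ {x} → proj₂ ((t , T) ^ω) ∋ x → InOmega t T x
    ω⁻ t T h with Omega.set⁻ t T (t ^ω) h
    ... | _ , l , r , p , k , eq with star-pow t p
    ...   | n , refl = n , l , r , k , eq

    pow-∙ : (t u : Ty q) → ∀ n → pow (t ∙ u) n ∙ t ≡ t ∙ pow (u ∙ t) n
    pow-∙ t u zero    = trans (ε-identityˡ t) (sym (ε-identityʳ t))
    pow-∙ t u (suc n) = begin
      t ∙ u ∙ pow (t ∙ u) n ∙ t    ≡⟨ ∙-assoc (t ∙ u) _ t ⟩
      t ∙ u ∙ (pow (t ∙ u) n ∙ t)  ≡⟨ cong (t ∙ u ∙_) (pow-∙ t u n) ⟩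
      t ∙ u ∙ (t ∙ pow (u ∙ t) n)  ≡⟨ ∙-assoc t u _ ⟩
      t ∙ (u ∙ (t ∙ pow (u ∙ t) n)) ≡⟨ cong (t ∙_) (∙-assoc u t _) ⟨
      t ∙ (u ∙ t ∙ pow (u ∙ t) n)  ∎
      where open ≡-Reasoning

    -- The sequence t u t u ... is regrouped after its first t. A point in the u-part of block n
    -- stays in block n; a point in the t-part moves to block n - 1, or into the leading t if n is
    -- 0. What follows the point is compared at the lower rank, where both orders of t and u occur;
    -- hence the two hypotheses.
    module Unroll (t : Ty q) (T : ℙ (Triple-finite q)) (u : Ty q) (U : ℙ (Triple-finite q))
                  (unroll-tu : (t ∙ u) ^ω ≡ t ∙ (u ∙ t) ^ω) (unroll-ut : (u ∙ t) ^ω ≡ u ∙ (t ∙ u) ^ω) where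
      open ≡-Reasoning
      module TU    = Product {q} _∙_ t T u U
      module UT    = Product {q} _∙_ u U t T
      module T-UTω = Product {q} _∙_ t T ((u ∙ t) ^ω) (Omega.set (u ∙ t) UT.set ((u ∙ t) ^ω))

      r-eq : ∀ r → r ∙ u ∙ (t ∙ u) ^ω ≡ r ∙ (u ∙ t) ^ω
      r-eq r = trans (∙-assoc r u _) (cong (r ∙_) (sym unroll-ut))

      r-eq′ : ∀ r → r ∙ (t ∙ u) ^ω ≡ r ∙ t ∙ (u ∙ t) ^ω
      r-eq′ r = trans (cong (r ∙_) unroll-tu) (sym (∙-assoc r t _))

      l-eq : ∀ n l → pow (t ∙ u) n ∙ (t ∙ l) ≡ t ∙ (pow (u ∙ t) n ∙ l)
      l-eq n l = begin
        pow (t ∙ u) n ∙ (t ∙ l)  ≡⟨ ∙-assoc _ t l ⟨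
        pow (t ∙ u) n ∙ t ∙ l    ≡⟨ cong (_∙ l) (pow-∙ t u n) ⟩
        t ∙ pow (u ∙ t) n ∙ l    ≡⟨ ∙-assoc t _ l ⟩
        t ∙ (pow (u ∙ t) n ∙ l)  ∎

      l-eq′ : ∀ n l → pow (t ∙ u) (suc n) ∙ l ≡ t ∙ (pow (u ∙ t) n ∙ (u ∙ l))
      l-eq′ n l = begin
        t ∙ u ∙ pow (t ∙ u) n ∙ l          ≡⟨ cong (_∙ l) (∙-assoc t u _) ⟩
        t ∙ (u ∙ pow (t ∙ u) n) ∙ l        ≡⟨ cong (λ x → t ∙ x ∙ l) (pow-∙ u t n) ⟨
        t ∙ (pow (u ∙ t) n ∙ u) ∙ l        ≡⟨ ∙-assoc t _ l ⟩
        t ∙ (pow (u ∙ t) n ∙ u ∙ l)        ≡⟨ cong (t ∙_) (∙-assoc _ u l) ⟩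
        t ∙ (pow (u ∙ t) n ∙ (u ∙ l))      ∎

      to : ∀ x → InOmega (t ∙ u) TU.set x → T-UTω.In x
      to x (n , l , _ , h , refl , refl) with TU.set⁻ h
      to x (n , _ , r , h , refl , refl) | inj₂ (l , k , refl) =
        inj₂ (_ , ω⁺ (u ∙ t) UT.set (n , l , r ∙ t , UT.set⁺ (inj₁ (_ , k , refl)) , refl , r-eq′ r) , l-eq n l)
      to x (zero , l , _ , h , refl , refl) | inj₁ (r , k , refl) =
        inj₁ (r , subst (λ l → T ∋ (l , _)) (sym (ε-identityˡ l)) k , r-eq r)
      to x (suc n , l , _ , h , refl , refl) | inj₁ (r , k , refl) =
        inj₂ (_ , ω⁺ (u ∙ t) UT.set (n , _ , r , UT.set⁺ (inj₂ (l , k , refl)) , refl , r-eq r) , l-eq′ n l)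

      from : ∀ x → T-UTω.In x → InOmega (t ∙ u) TU.set x
      from x (inj₁ (r , k , refl)) =
        0 , _ , _ , TU.set⁺ (inj₁ (r , k , refl)) , sym (ε-identityˡ _) , sym (r-eq r)
      from x (inj₂ (_ , h , refl)) with ω⁻ (u ∙ t) UT.set h
      ... | n , _ , _ , k , refl , refl with UT.set⁻ k
      ...   | inj₁ (r , m , refl) =
        n , _ , _ , TU.set⁺ (inj₂ (_ , m , refl)) , sym (l-eq n _) , sym (r-eq′ r)
      ...   | inj₂ (l , m , refl) =
        suc n , l , _ , TU.set⁺ (inj₁ (_ , m , refl)) , sym (l-eq′ n l) , sym (r-eq _)

      unroll : ((t , T) ∙ (u , U)) ^ω ≡ (t , T) ∙ ((u , U) ∙ (t , T)) ^ω
      unroll = cong₂ _,_ unroll-tu (ℙ-ext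
        (λ x h → T-UTω.set⁺ (to x (ω⁻ (t ∙ u) TU.set h)))
        (λ x h → ω⁺ (t ∙ u) TU.set (from x (T-UTω.set⁻ h))))

    ω-unroll : (t u : Ty q) → (t ∙ u) ^ω ≡ t ∙ (u ∙ t) ^ω
    ω-unroll {zero}  _       _       = refl
    ω-unroll {suc q} (t , T) (u , U) = Unroll.unroll t T u U (ω-unroll t u) (ω-unroll u t)

    ω-absorb : (t : Ty q) → t ∙ t ^ω ≡ t ^ω
    ω-absorb t = sym (begin
      t ^ω             ≡⟨ cong _^ω (ε-identityʳ t) ⟨
      (t ∙ ε) ^ω       ≡⟨ ω-unroll t ε ⟩
      t ∙ (ε ∙ t) ^ω   ≡⟨ cong (λ x → t ∙ x ^ω) (ε-identityˡ t) ⟩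
      t ∙ t ^ω         ∎)
      where open ≡-Reasoning

-- Types of coloured orders, and their sums

module Semantics (d : ℕ) where
  open import Data.Nat.Base using (zero; suc)
  open Types d

  module _ {a} ⦃ _ : EM a ⦄ (O : StrictTotalOrder a a a) where
    open StrictTotalOrder O

    below above : (Carrier → Set a) → Carrier → Carrier → Set a
    below I x y = I y × y < x
    above I x y = I y × x < y

    -- Types are assigned to subsets of one fixed order. Cutting at a point then only strengthens a
    -- predicate, and no suborder has to be formed.
    tp : ∀ q → (Carrier → Fin d) → (Carrier → Set a) → Ty q

    Realised : ∀ q → (Carrier → Fin d) → (Carrier → Set a) → Ty q × Fin d × Ty q → Set a
    Realised q χ I (l , c , r) =
      ∃[ x ] I x × χ x ≡ c × tp q χ (below I x) ≡ l × tp q χ (above I x) ≡ r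

    triples : ∀ q → (Carrier → Fin d) → (Carrier → Set a) → ℙ (Triple-finite q)
    triples q χ I = ⟪ (λ t → em (Realised q χ I t)) ⟫

    tp zero    χ I = tt
    tp (suc q) χ I = tp q χ I , triples q χ I

    module _ {q : ℕ} {χ : Carrier → Fin d} {I : Carrier → Set a} where

      triples⁺ : ∀ {x} → Realised q χ I x → triples q χ I ∋ x
      triples⁺ = ⟪⟫⁺ _

      triples⁻ : ∀ {x} → triples q χ I ∋ x → Realised q χ I x
      triples⁻ = ⟪⟫⁻ _

  module _ {a b} ⦃ _ : EM a ⦄ ⦃ _ : EM b ⦄ (O₁ : StrictTotalOrder a a a) (O₂ : StrictTotalOrder b b b) where
    private
      module O₁ = StrictTotalOrder O₁
      module O₂ = StrictTotalOrder O₂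

    -- A relation and not a map: points matter only up to `_≈_`, and the same relation serves all
    -- the pairs of subsets met when points are named, as cutting at related points keeps it total
    -- on both sides.
    record Correspondence {r} (χ₁ : O₁.Carrier → Fin d) (χ₂ : O₂.Carrier → Fin d)
                          (R : O₁.Carrier → O₂.Carrier → Set r) : Set (a ⊔ˡ b ⊔ˡ r) where
      field
        mono   : ∀ {x y x′ y′} → R x y → R x′ y′ → x O₁.< x′ → y O₂.< y′
        comono : ∀ {x y x′ y′} → R x y → R x′ y′ → y O₂.< y′ → x O₁.< x′
        colour : ∀ {x y} → R x y → χ₁ x ≡ χ₂ y

    Bitotal : ∀ {r} → (O₁.Carrier → O₂.Carrier → Set r) → (O₁.Carrier → Set a) → (O₂.Carrier → Set b) →
              Set (a ⊔ˡ b ⊔ˡ r)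
    Bitotal R I J = (∀ x → I x → ∃[ y ] J y × R x y) × (∀ y → J y → ∃[ x ] I x × R x y)

  module _ {a b r : Level} ⦃ _ : EM a ⦄ ⦃ _ : EM b ⦄ {O₁ : StrictTotalOrder a a a} {O₂ : StrictTotalOrder b b b} where
    private
      module O₁ = StrictTotalOrder O₁
      module O₂ = StrictTotalOrder O₂

    module _ {χ₁ : O₁.Carrier → Fin d} {χ₂ : O₂.Carrier → Fin d}
             {R : O₁.Carrier → O₂.Carrier → Set r} (C : Correspondence O₁ O₂ χ₁ χ₂ R) where
      open Correspondence C

      below-bitotal : ∀ {I J x y} → R x y → Bitotal O₁ O₂ R I J →
                      Bitotal O₁ O₂ R (below O₁ I x) (below O₂ J y)
      below-bitotal Rxy (f , g) =
        (λ x′ (i , lt) → let y′ , j , R′ = f x′ i in y′ , (j , mono R′ Rxy lt) , R′) ,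
        (λ y′ (j , lt) → let x′ , i , R′ = g y′ j in x′ , (i , comono R′ Rxy lt) , R′)

      above-bitotal : ∀ {I J x y} → R x y → Bitotal O₁ O₂ R I J →
                      Bitotal O₁ O₂ R (above O₁ I x) (above O₂ J y)
      above-bitotal Rxy (f , g) =
        (λ x′ (i , lt) → let y′ , j , R′ = f x′ i in y′ , (j , mono Rxy R′ lt) , R′) ,
        (λ y′ (j , lt) → let x′ , i , R′ = g y′ j in x′ , (i , comono Rxy R′ lt) , R′)

      tp-correspondence : ∀ q {I J} → Bitotal O₁ O₂ R I J → tp O₁ q χ₁ I ≡ tp O₂ q χ₂ J
      tp-correspondence zero    t = refl
      tp-correspondence (suc q) {I} {J} t@(f , g) = cong₂ _,_ (tp-correspondence q t) (ℙ-ext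
        (λ x h → triples⁺ O₂ (to x (triples⁻ O₁ h)))
        (λ x h → triples⁺ O₁ (from x (triples⁻ O₂ h))))
        where
        to : ∀ x → Realised O₁ q χ₁ I x → Realised O₂ q χ₂ J x
        to _ (x , i , refl , refl , refl) = let y , j , Rxy = f x i in
          y , j , sym (colour Rxy) ,
          sym (tp-correspondence q (below-bitotal Rxy t)) , sym (tp-correspondence q (above-bitotal Rxy t))

        from : ∀ x → Realised O₂ q χ₂ J x → Realised O₁ q χ₁ I x
        from _ (y , j , refl , refl , refl) = let x , i , Rxy = g y j in
          x , i , colour Rxy , tp-correspondence q (below-bitotal Rxy t) , tp-correspondence q (above-bitotal Rxy t)

  module _ {a} ⦃ _ : EM a ⦄ (O : StrictTotalOrder a a a) where
    open StrictTotalOrder O hiding (trans)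
    private module O = StrictTotalOrder O

    tp-cong : ∀ q {χ₁ χ₂ : Carrier → Fin d} {I J : Carrier → Set a} →
              (∀ {x} → I x → J x) → (∀ {x} → J x → I x) → (∀ {x} → I x → χ₁ x ≡ χ₂ x) →
              tp O q χ₁ I ≡ tp O q χ₂ J
    tp-cong q {χ₁} {χ₂} {I} {J} f g h = tp-correspondence {R = λ x y → x ≡ y × I x}
      (record { mono   = λ { (refl , _) (refl , _) lt → lt }
              ; comono = λ { (refl , _) (refl , _) lt → lt }
              ; colour = λ { (refl , i) → h i } })
      q ((λ x i → x , f i , refl , i) , (λ x j → x , g j , refl , g j))

    record Sum (K I J : Carrier → Set a) : Set a where
      field
        split   : ∀ {x} → K x → I x ⊎ J x
        left    : ∀ {x} → I x → K x
        right   : ∀ {x} → J x → K x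
        ordered : ∀ {x y} → I x → J y → x < y

      below-left : ∀ {x y} → I x → below O K x y → below O I x y
      below-left i (k , lt) with split k
      ... | inj₁ i′ = i′ , lt
      ... | inj₂ j  = contradiction (ordered i j) (asym lt)

      above-right : ∀ {x y} → J x → above O K x y → above O J x y
      above-right j (k , lt) with split k
      ... | inj₂ j′ = j′ , lt
      ... | inj₁ i  = contradiction (ordered i j) (asym lt)

    open Sum

    above-left : ∀ {K I J x} → Sum K I J → I x → Sum (above O K x) (above O I x) J
    above-left {K} {I} {J} {x} s i = record
      { split   = split′
      ; left    = λ (i′ , lt) → left s i′ , lt
      ; right   = λ j → right s j , ordered s i j
      ; ordered = λ (i′ , _) j → ordered s i′ j
      }
      where
      split′ : ∀ {y} → above O K x y → above O I x y ⊎ J y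
      split′ (k , lt) with split s k
      ... | inj₁ i′ = inj₁ (i′ , lt)
      ... | inj₂ j  = inj₂ j

    below-right : ∀ {K I J x} → Sum K I J → J x → Sum (below O K x) I (below O J x)
    below-right {K} {I} {J} {x} s j = record
      { split   = split′
      ; left    = λ i → left s i , ordered s i j
      ; right   = λ (j′ , lt) → right s j′ , lt
      ; ordered = λ i (j′ , _) → ordered s i j′
      }
      where
      split′ : ∀ {y} → below O K x y → I y ⊎ below O J x y
      split′ (k , lt) with split s k
      ... | inj₁ i  = inj₁ i
      ... | inj₂ j′ = inj₂ (j′ , lt)

    ⋃ : (ℕ → Carrier → Set a) → Carrier → Set a
    ⋃ I x = ∃[ n ] I n x

    ⋃< : ℕ → (ℕ → Carrier → Set a) → Carrier → Set a
    ⋃< n I x = ∃[ m ] m ℕ.< n × I m x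

    Ordered : (ℕ → Carrier → Set a) → Set a
    Ordered I = ∀ {m n x y} → m ℕ.< n → I m x → I n y → x < y

    module _ {χ : Carrier → Fin d} where

      tp-≗ : ∀ q {I J : Carrier → Set a} → (∀ {x} → I x → J x) → (∀ {x} → J x → I x) →
             tp O q χ I ≡ tp O q χ J
      tp-≗ q f g = tp-cong q f g (λ _ → refl)

      tp-empty : ∀ q {I : Carrier → Set a} → (∀ x → ¬ I x) → tp O q χ I ≡ ε
      tp-empty zero    h = refl
      tp-empty (suc q) h = cong₂ _,_ (tp-empty q h) (ℙ-ext
        (λ _ k → let x , i , _ = triples⁻ O k in ⊥-elim (h x i))
        (λ _ k → ⊥-elim (∅⁻ k)))

      tp-point : ∀ q {I : Carrier → Set a} {x} → I x → (∀ {y z} → I y → I z → ¬ y < z) →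
                 (∀ {y} → I y → χ y ≡ χ x) → tp O q χ I ≡ point (χ x)
      tp-point zero    _ _ _ = refl
      tp-point (suc q) {I} {x} i h k = cong₂ _,_ (tp-point q i h k) (ℙ-ext
        (λ _ m → ⟪⟫⁺ _ (to _ (triples⁻ O m)))
        (λ t m → triples⁺ O (subst (Realised O q χ I) (sym (⟪⟫⁻ _ m))
          (x , i , refl , tp-empty q (λ y (j , lt) → h j i lt) , tp-empty q (λ y (j , lt) → h i j lt)))))
        where
        to : ∀ t → Realised O q χ I t → t ≡ (ε , χ x , ε)
        to _ (y , j , refl , refl , refl) = cong₂ _,_ (tp-empty q (λ z (l , lt) → h l j lt))
          (cong₂ _,_ (k j) (tp-empty q (λ z (l , lt) → h j l lt)))

      -- What precedes a point of `I` lies in `I`, and what follows it is a sum of a part of `I` and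
      -- all of `J`, to which the lower rank applies; dually for a point of `J`.
      tp-sum : ∀ q {K I J} → Sum K I J → tp O q χ K ≡ tp O q χ I ∙ tp O q χ J
      tp-sum zero    s = refl
      tp-sum (suc q) {K} {I} {J} s = cong₂ _,_ (tp-sum q s) (ℙ-ext
        (λ x h → set⁺ (to x (triples⁻ O h)))
        (λ x h → triples⁺ O (from x (set⁻ h))))
        where
        open Product _∙_ (tp O q χ I) (triples O q χ I) (tp O q χ J) (triples O q χ J)

        to : ∀ t → Realised O q χ K t → In t
        to _ (x , k , refl , refl , refl) with split s k
        ... | inj₁ i = inj₁ (_ , triples⁺ O (x , i , refl ,
                tp-≗ q (λ (i′ , lt) → left s i′ , lt) (below-left s i) , refl) , tp-sum q (above-left s i))
        ... | inj₂ j = inj₂ (_ , triples⁺ O (x , j , refl , refl ,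
                tp-≗ q (λ (j′ , lt) → right s j′ , lt) (above-right s j)) , tp-sum q (below-right s j))

        from : ∀ t → In t → Realised O q χ K t
        from t (inj₁ (_ , h , refl)) with triples⁻ O h
        ... | x , i , refl , refl , refl = x , left s i , refl ,
                tp-≗ q (below-left s i) (λ (i′ , lt) → left s i′ , lt) , tp-sum q (above-left s i)
        from t (inj₂ (_ , h , refl)) with triples⁻ O h
        ... | x , j , refl , refl , refl = x , right s j , refl , tp-sum q (below-right s j) ,
                tp-≗ q (above-right s j) (λ (j′ , lt) → right s j′ , lt)

      tp-⋃< : ∀ q {I e} → Ordered I → (∀ n → tp O q χ (I n) ≡ e) → ∀ n → tp O q χ (⋃< n I) ≡ pow e n
      tp-⋃< q o h zero    = tp-empty q (λ { _ (_ , () , _) })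
      tp-⋃< q {I} {e} o h (suc n) = trans (tp-sum q s)
        (cong₂ _∙_ (h 0) (tp-⋃< q (λ lt → o (ℕ.s<s lt)) (λ m → h (suc m)) n))
        where
        s : Sum (⋃< (suc n) I) (I 0) (⋃< n (I ∘ suc))
        s = record
          { split   = λ { (zero , _ , i) → inj₁ i ; (suc m , ℕ.s<s lt , i) → inj₂ (m , lt , i) }
          ; left    = λ i → 0 , ℕ.z<s , i
          ; right   = λ (m , lt , i) → suc m , ℕ.s<s lt , i
          ; ordered = λ i (m , lt , j) → o ℕ.z<s i j
          }

  module _ {a} ⦃ _ : EM 0ℓ ⦄ ⦃ _ : EM a ⦄ (O : StrictTotalOrder a a a) where
    open StrictTotalOrder O hiding (trans)

    below-⋃ : ∀ {I n x} → Ordered O I → I n x → Sum O (below O (⋃ O I) x) (⋃< O n I) (below O (I n) x)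
    below-⋃ {I} {n} {x} o i = record
      { split   = split′
      ; left    = λ (m , lt , j) → (m , j) , o lt j i
      ; right   = λ (j , lt) → (n , j) , lt
      ; ordered = λ (m , lt , j) (j′ , _) → o lt j j′
      }
      where
      split′ : ∀ {y} → below O (⋃ O I) x y → ⋃< O n I y ⊎ below O (I n) x y
      split′ ((m , j) , lt) with ℕ.<-cmp m n
      ... | tri< m<n _ _  = inj₁ (m , m<n , j)
      ... | tri≈ _ refl _ = inj₂ (j , lt)
      ... | tri> _ _ n<m  = contradiction (o n<m i j) (asym lt)

    above-⋃ : ∀ {I n x} → Ordered O I → I n x →
              Sum O (above O (⋃ O I) x) (above O (I n) x) (⋃ O (λ m → I (suc (m ℕ.+ n))))
    above-⋃ {I} {n} {x} o i = record
      { split   = split′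
      ; left    = λ (j , lt) → (n , j) , lt
      ; right   = λ (m , j) → (_ , j) , o (ℕ.s≤s (ℕ.m≤n+m n m)) i j
      ; ordered = λ (j′ , _) (m , j) → o (ℕ.s≤s (ℕ.m≤n+m n m)) j′ j
      }
      where
      split′ : ∀ {y} → above O (⋃ O I) x y → above O (I n) x y ⊎ ⋃ O (λ m → I (suc (m ℕ.+ n))) y
      split′ {y} ((m , j) , lt) with ℕ.<-cmp m n
      ... | tri< m<n _ _  = contradiction (o m<n j i) (asym lt)
      ... | tri≈ _ refl _ = inj₁ (j , lt)
      ... | tri> _ _ n<m  = inj₂ (m ℕ.∸ suc n , subst (λ m → I m y)
              (sym (trans (sym (ℕ.+-suc (m ℕ.∸ suc n) n)) (ℕ.m∸n+n≡m n<m))) j)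

    module _ {χ : Carrier → Fin d} where

      -- Before its own summand a point of `I n` has n summands of type e, and after it the family
      -- shifted by `suc n`, which satisfies the same hypotheses at the lower rank. This is the
      -- shape of `InOmega`.
      tp-⋃ : ∀ q {I e} → Ordered O I → (∀ n → tp O q χ (I n) ≡ e) → tp O q χ (⋃ O I) ≡ e ^ω
      tp-⋃ zero    o h = refl
      tp-⋃ (suc q) {I} {e , E} o h = cong₂ _,_ (tp-⋃ q o (cong proj₁ ∘ h)) (ℙ-ext
        (λ x k → ω⁺ e E (to x (triples⁻ O k)))
        (λ x k → triples⁺ O (from x (ω⁻ e E k))))
        where
        left-tp : ∀ {n x} → I n x → tp O q χ (below O (⋃ O I) x) ≡ pow e n ∙ tp O q χ (below O (I n) x)
        left-tp {n} i = trans (tp-sum O q (below-⋃ o i)) (cong (_∙ _) (tp-⋃< O q o (cong proj₁ ∘ h) n))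

        right-tp : ∀ {n x} → I n x → tp O q χ (above O (⋃ O I) x) ≡ tp O q χ (above O (I n) x) ∙ e ^ω
        right-tp {n} i = trans (tp-sum O q (above-⋃ o i))
          (cong (_ ∙_) (tp-⋃ q (λ lt → o (ℕ.s<s (ℕ.+-monoˡ-< n lt))) (λ m → cong proj₁ (h _))))

        to : ∀ t → Realised O q χ (⋃ O I) t → InOmega e E t
        to _ (x , (n , i) , refl , refl , refl) = n , _ , _ ,
          subst (_∋ _) (cong proj₂ (h n)) (triples⁺ O (x , i , refl , refl , refl)) , left-tp i , right-tp i

        from : ∀ t → InOmega e E t → Realised O q χ (⋃ O I) t
        from _ (n , _ , _ , k , refl , refl) with triples⁻ O (subst (_∋ _) (sym (cong proj₂ (h n))) k)
        ... | x , i , refl , refl , refl = x , (n , i) , refl , left-tp i , right-tp i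

-- Evaluating sentences on types

module Evaluation (d : ℕ) where
  open import Defs hiding (_+_; _·_; sum)
  open import Data.Nat.Base using (zero; suc)
  open Types d
  open Semantics d

  private variable
    q n : ℕ

  -- The types of the gaps between finitely many named points, and the
  -- colours of these points.
  data Configuration (q : ℕ) : Set where
    end   : Ty q → Configuration q
    _◂_◂_ : Ty q → Fin d → Configuration q → Configuration q

  data Position {q : ℕ} : Configuration q → Set where
    here  : ∀ {t c κ} → Position (t ◂ c ◂ κ)
    there : ∀ {t c κ} → Position κ → Position (t ◂ c ◂ κ)

  data _<ₚ_ {q : ℕ} : {κ : Configuration q} → Position κ → Position κ → Set where
    here<there  : ∀ {t c κ} {i : Position κ} → _<ₚ_ {κ = t ◂ c ◂ κ} here (there i)
    there<there : ∀ {t c κ} {i j : Position κ} → i <ₚ j → _<ₚ_ {κ = t ◂ c ◂ κ} (there i) (there j)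

  <ₚ-cmp : {κ : Configuration q} (i j : Position κ) → i <ₚ j ⊎ i ≡ j ⊎ j <ₚ i
  <ₚ-cmp here      here      = inj₂ (inj₁ refl)
  <ₚ-cmp here      (there j) = inj₁ here<there
  <ₚ-cmp (there i) here      = inj₂ (inj₂ here<there)
  <ₚ-cmp (there i) (there j) with <ₚ-cmp i j
  ... | inj₁ lt          = inj₁ (there<there lt)
  ... | inj₂ (inj₁ refl) = inj₂ (inj₁ refl)
  ... | inj₂ (inj₂ gt)   = inj₂ (inj₂ (there<there gt))

  _<ₚ?_ : {κ : Configuration q} (i j : Position κ) → Dec (i <ₚ j)
  here    <ₚ? here    = no λ ()
  here    <ₚ? there j = yes here<there
  there i <ₚ? here    = no λ ()
  there i <ₚ? there j with i <ₚ? j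
  ... | yes lt = yes (there<there lt)
  ... | no ¬lt = no λ { (there<there lt) → ¬lt lt }

  _≟ₚ_ : {κ : Configuration q} (i j : Position κ) → Dec (i ≡ j)
  here    ≟ₚ here    = yes refl
  here    ≟ₚ there j = no λ ()
  there i ≟ₚ here    = no λ ()
  there i ≟ₚ there j with i ≟ₚ j
  ... | yes refl = yes refl
  ... | no ¬eq   = no λ { refl → ¬eq refl }

  colourAt : (κ : Configuration q) → Position κ → Fin d
  colourAt (t ◂ c ◂ κ) here      = c
  colourAt (t ◂ c ◂ κ) (there i) = colourAt κ i

  lower : Configuration (suc q) → Configuration q
  lower (end (t , _))     = end t
  lower ((t , _) ◂ c ◂ κ) = t ◂ c ◂ lower κ

  lowerₚ : {κ : Configuration (suc q)} → Position κ → Position (lower κ)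
  lowerₚ here      = here
  lowerₚ (there i) = there (lowerₚ i)

  liftₚ : ∀ {p} {κ : Configuration p} {κ′ : Configuration q} {t t′ c} →
          (Position κ → Position κ′) → Position (t ◂ c ◂ κ) → Position (t′ ◂ c ◂ κ′)
  liftₚ f here      = here
  liftₚ f (there i) = there (f i)

  -- SomeExtension κ K says that K holds of some configuration naming one
  -- more (possibly old) point, given with the position of that point and
  -- the new positions of the old points.
  SomeExtension : (κ : Configuration (suc q)) →
                  (∀ (κ′ : Configuration q) → Position κ′ → (Position κ → Position κ′) → Set) → Set
  SomeExtension (end (t , T)) K =
    ∃[ l ] ∃[ c ] ∃[ r ] T ∋ (l , c , r) × K (l ◂ c ◂ end r) here (λ ())
  SomeExtension ((t , T) ◂ c ◂ κ) K =
    (∃[ l ] ∃[ c′ ] ∃[ r ] T ∋ (l , c′ , r) × K (l ◂ c′ ◂ (r ◂ c ◂ lower κ)) here (there ∘ liftₚ lowerₚ)) ⊎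
    K (t ◂ c ◂ lower κ) here lowerₚ ⊎
    SomeExtension κ (λ κ′ i f → K (t ◂ c ◂ κ′) (there i) (liftₚ f))

  someExtension? : (κ : Configuration (suc q)) {K : ∀ κ′ → Position κ′ → (Position κ → Position κ′) → Set} →
                   (∀ κ′ i f → Dec (K κ′ i f)) → Dec (SomeExtension κ K)
  someExtension? (end (t , T)) K? =
    any-Ty λ l → Fin.any? λ c → any-Ty λ r → (T ∋? (l , c , r)) ×-dec K? _ _ _
  someExtension? ((t , T) ◂ c ◂ κ) K? =
    (any-Ty λ l → Fin.any? λ c → any-Ty λ r → (T ∋? (l , c , r)) ×-dec K? _ _ _) ⊎-dec
    K? _ _ _ ⊎-dec
    someExtension? κ (λ κ′ i f → K? _ _ _)

  Sat : (φ : Formula d n) (κ : Configuration q) → Vec (Position κ) n → Set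
  Sat (x ≐ y)      κ v = lookup v x ≡ lookup v y
  Sat (x <′ y)     κ v = lookup v x <ₚ lookup v y
  Sat (colour i x) κ v = colourAt κ (lookup v x) ≡ i
  Sat ⊤′           κ v = ⊤
  Sat ⊥′           κ v = ⊥
  Sat (¬′ φ)       κ v = ¬ Sat φ κ v
  Sat (φ ∧′ ψ)     κ v = Sat φ κ v × Sat ψ κ v
  Sat (φ ∨′ ψ)     κ v = Sat φ κ v ⊎ Sat ψ κ v
  Sat (φ ⇒′ ψ)     κ v = Sat φ κ v → Sat ψ κ v
  -- At rank 0 no further point can be named. The value is arbitrary, since `Holds⇔Sat` assumes
  -- `rank φ ≤ q`. At positive rank the universal quantifier is a negated search, so that
  -- `someExtension?` decides both quantifiers.
  Sat {q = zero}  (∀′ φ) κ v = ⊥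
  Sat {q = suc q} (∀′ φ) κ v = ¬ SomeExtension κ (λ κ′ i f → ¬ Sat φ κ′ (i ∷ Vec.map f v))
  Sat {q = zero}  (∃′ φ) κ v = ⊥
  Sat {q = suc q} (∃′ φ) κ v = SomeExtension κ (λ κ′ i f → Sat φ κ′ (i ∷ Vec.map f v))

  Sat? : (φ : Formula d n) (κ : Configuration q) (v : Vec (Position κ) n) → Dec (Sat φ κ v)
  Sat? (x ≐ y)      κ v = lookup v x ≟ₚ lookup v y
  Sat? (x <′ y)     κ v = lookup v x <ₚ? lookup v y
  Sat? (colour i x) κ v = colourAt κ (lookup v x) Fin.≟ i
  Sat? ⊤′           κ v = yes tt
  Sat? ⊥′           κ v = no λ ()
  Sat? (¬′ φ)       κ v = ¬? (Sat? φ κ v)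
  Sat? (φ ∧′ ψ)     κ v = Sat? φ κ v ×-dec Sat? ψ κ v
  Sat? (φ ∨′ ψ)     κ v = Sat? φ κ v ⊎-dec Sat? ψ κ v
  Sat? (φ ⇒′ ψ)     κ v = Sat? φ κ v →-dec Sat? ψ κ v
  Sat? {q = zero}  (∀′ φ) κ v = no λ ()
  Sat? {q = suc q} (∀′ φ) κ v = ¬? (someExtension? κ (λ κ′ i f → ¬? (Sat? φ κ′ (i ∷ Vec.map f v))))
  Sat? {q = zero}  (∃′ φ) κ v = no λ ()
  Sat? {q = suc q} (∃′ φ) κ v = someExtension? κ (λ κ′ i f → Sat? φ κ′ (i ∷ Vec.map f v))

  module _ {a} ⦃ _ : EM a ⦄ (O : StrictTotalOrder a a a) (χ : StrictTotalOrder.Carrier O → Fin d) where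
    open StrictTotalOrder O hiding (trans)
    private module O = StrictTotalOrder O

    Realises : (Carrier → Set a) → Configuration q → Set a
    Realises {q} I (end t)     = Lift a (tp O q χ I ≡ t)
    Realises {q} I (t ◂ c ◂ κ) =
      ∃[ p ] I p × χ p ≡ c × tp O q χ (below O I p) ≡ t × Realises (above O I p) κ

    pt : ∀ {I} {κ : Configuration q} → Realises I κ → Position κ → Carrier
    pt (p , _)             here      = p
    pt (_ , _ , _ , _ , m) (there i) = pt m i

    pt-∈ : ∀ {I} {κ : Configuration q} (m : Realises I κ) i → I (pt m i)
    pt-∈ (_ , p∈ , _)            here      = p∈
    pt-∈ (_ , _ , _ , _ , m)     (there i) = proj₁ (pt-∈ m i)

    pt-mono : ∀ {I} {κ : Configuration q} (m : Realises I κ) {i j} → i <ₚ j → pt m i < pt m j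
    pt-mono (_ , _ , _ , _ , m) (here<there {i = i}) = proj₂ (pt-∈ m i)
    pt-mono (_ , _ , _ , _ , m) (there<there lt)     = pt-mono m lt

    pt-comono : ∀ {I} {κ : Configuration q} (m : Realises I κ) i j → pt m i < pt m j → i <ₚ j
    pt-comono m i j lt with <ₚ-cmp i j
    ... | inj₁ i<j         = i<j
    ... | inj₂ (inj₁ refl) = contradiction lt (irrefl Eq.refl)
    ... | inj₂ (inj₂ j<i)  = contradiction (pt-mono m j<i) (asym lt)

    pt-injective : ∀ {I} {κ : Configuration q} (m : Realises I κ) i j → pt m i ≈ pt m j → i ≡ j
    pt-injective m i j eq with <ₚ-cmp i j
    ... | inj₁ i<j         = contradiction (pt-mono m i<j) (irrefl eq)
    ... | inj₂ (inj₁ refl) = refl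
    ... | inj₂ (inj₂ j<i)  = contradiction (pt-mono m j<i) (irrefl (Eq.sym eq))

    pt-colour : ∀ {I} {κ : Configuration q} (m : Realises I κ) i → χ (pt m i) ≡ colourAt κ i
    pt-colour {κ = _ ◂ _ ◂ _} (_ , _ , χp , _)    here      = χp
    pt-colour {κ = _ ◂ _ ◂ _} (_ , _ , _ , _ , m) (there i) = pt-colour m i

    realises-≗ : ∀ {I J} → (∀ {x} → I x → J x) → (∀ {x} → J x → I x) → (κ : Configuration q) →
                 (m : Realises I κ) → Σ (Realises J κ) λ m′ → ∀ i → pt m′ i ≡ pt m i
    realises-≗ {q} f g (end t) (lift eq) = lift (trans (tp-≗ O q g f) eq) , λ ()
    realises-≗ {q} f g (t ◂ c ◂ κ) (p , p∈ , χp , eq , m)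
      with m′ , same ← realises-≗ (λ (i , lt) → f i , lt) (λ (j , lt) → g j , lt) κ m =
      (p , f p∈ , χp , trans (tp-≗ O q (λ (j , lt) → g j , lt) (λ (i , lt) → f i , lt)) eq , m′) ,
      λ { here → refl ; (there i) → same i }

    realises-lower : ∀ {I} (κ : Configuration (suc q)) (m : Realises I κ) →
                     Σ (Realises I (lower κ)) λ m′ → ∀ i → pt m′ (lowerₚ i) ≡ pt m i
    realises-lower (end t)     (lift refl) = lift refl , λ ()
    realises-lower (t ◂ c ◂ κ) (p , p∈ , χp , refl , m) with m′ , same ← realises-lower κ m =
      (p , p∈ , χp , refl , m′) , λ { here → refl ; (there i) → same i }

    insert : ∀ {I t c l c′ r} (κ : Configuration q) → (m : Realises I (t ◂ c ◂ κ)) →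
             ∀ x → below O I (proj₁ m) x → χ x ≡ c′ →
             tp O q χ (below O (below O I (proj₁ m)) x) ≡ l → tp O q χ (above O (below O I (proj₁ m)) x) ≡ r →
             Σ (Realises I (l ◂ c′ ◂ (r ◂ c ◂ κ))) λ m′ →
               pt m′ here ≡ x × pt m′ (there here) ≡ pt m here × (∀ i → pt m′ (there (there i)) ≡ pt m (there i))
    insert {q} κ (p , p∈ , χp , eq , m) x (x∈ , x<p) χx eql eqr
      with m′ , same ← realises-≗ (λ (i , p<y) → (i , O.trans x<p p<y) , p<y) (λ ((i , _) , p<y) → i , p<y) κ m =
      (x , x∈ , χx , trans (tp-≗ O q (λ (i , y<x) → (i , O.trans y<x x<p) , y<x) (λ ((i , _) , y<x) → i , y<x)) eql ,
       p , (p∈ , x<p) , χp , trans (tp-≗ O q (λ ((i , u) , v) → (i , v) , u) (λ ((i , u) , v) → (i , v) , u)) eqr ,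
       m′) , refl , refl , same

    -- A gap of rank q + 1 lists its points with the rank q types on either side, so naming a point
    -- leaves a configuration of rank q. The gap that x falls into is found by comparison with the
    -- named points in turn.
    extend⁺ : ∀ {I} (κ : Configuration (suc q)) (m : Realises I κ) x → I x →
              ∀ {K} → (∀ κ′ (m′ : Realises I κ′) i f → pt m′ i ≈ x → (∀ j → pt m′ (f j) ≡ pt m j) → K κ′ i f) →
              SomeExtension κ K
    extend⁺ (end t) (lift refl) x x∈ k = _ , _ , _ , triples⁺ O (x , x∈ , refl , refl , refl) ,
      k _ (x , x∈ , refl , refl , lift refl) here _ Eq.refl λ ()
    extend⁺ (t ◂ c ◂ κ) m₀@(p , p∈ , χp , refl , m) x x∈ k with compare x p
    -- A point equal to a named one is represented by the latter, which is why the new position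
    -- denotes x only up to `_≈_`.
    ... | tri≈ _ x≈p _ = let m′ , same = realises-lower (t ◂ c ◂ κ) m₀ in
      inj₂ (inj₁ (k _ m′ here lowerₚ (Eq.sym x≈p) same))
    ... | tri> _ _ p<x = inj₂ (inj₂ (extend⁺ κ m x (x∈ , p<x) λ κ′ m′ i f eq same →
      k (_ ◂ c ◂ κ′) (p , p∈ , χp , refl , m′) (there i) (liftₚ f) eq λ { here → refl ; (there j) → same j }))
    ... | tri< x<p _ _ =
      let m′ , same = realises-lower κ m
          m″ , eq₁ , eq₂ , eq₃ = insert (lower κ) (p , p∈ , χp , refl , m′) x (x∈ , x<p) refl refl refl
      in inj₁ (_ , _ , _ , triples⁺ O (x , (x∈ , x<p) , refl , refl , refl) ,
           k _ m″ here (there ∘ liftₚ lowerₚ) Eq.refl λ { here → eq₂ ; (there j) → trans (eq₃ (lowerₚ j)) (same j) })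

    extend⁻ : ∀ {I} (κ : Configuration (suc q)) (m : Realises I κ) → ∀ {K} → SomeExtension κ K →
              ∃[ κ′ ] Σ (Realises I κ′) λ m′ → ∃[ i ] ∃[ f ] (∀ j → pt m′ (f j) ≡ pt m j) × K κ′ i f
    extend⁻ (end t) (lift refl) (l , c , r , h , k) with triples⁻ O h
    ... | x , x∈ , χx , eql , eqr = _ , (x , x∈ , χx , eql , lift eqr) , here , (λ ()) , (λ ()) , k
    extend⁻ (t ◂ c ◂ κ) (p , p∈ , χp , refl , m) (inj₁ (l , c′ , r , h , k)) with triples⁻ O h
    ... | x , x∈ , χx , eql , eqr =
      let m′ , same = realises-lower κ m
          m″ , eq₁ , eq₂ , eq₃ = insert (lower κ) (p , p∈ , χp , refl , m′) x x∈ χx eql eqr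
      in _ , m″ , here , (there ∘ liftₚ lowerₚ) , (λ { here → eq₂ ; (there j) → trans (eq₃ (lowerₚ j)) (same j) }) , k
    extend⁻ (t ◂ c ◂ κ) m₀ (inj₂ (inj₁ k)) =
      let m′ , same = realises-lower (t ◂ c ◂ κ) m₀ in _ , m′ , here , lowerₚ , same , k
    extend⁻ (t ◂ c ◂ κ) (p , p∈ , χp , refl , m) (inj₂ (inj₂ s)) with extend⁻ κ m s
    ... | κ′ , m′ , i , f , same , k = _ , (p , p∈ , χp , refl , m′) , there i , liftₚ f ,
      (λ { here → refl ; (there j) → same j }) , k

  module _ {a} ⦃ _ : EM a ⦄ (A : ColouredOrdinal d a) where
    open ColouredOrdinal A hiding (trans)
    private
      module A = ColouredOrdinal A
      O = strictTotalOrder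

    colourOf : Carrier → Fin d
    colourOf x = proj₁ (partition x)

    colour⇒colourOf : ∀ {i x} → Colour i x → colourOf x ≡ i
    colour⇒colourOf {x = x} h = proj₂ (proj₂ (partition x)) h

    colourOf⇒colour : ∀ {i x} → colourOf x ≡ i → Colour i x
    colourOf⇒colour {x = x} refl = proj₁ (proj₂ (partition x))

    colourOf-cong : ∀ {x y} → x ≈ y → colourOf x ≡ colourOf y
    colourOf-cong x≈y = colour⇒colourOf (respects (Eq.sym x≈y) (colourOf⇒colour refl))

    Everything : Carrier → Set a
    Everything _ = ⊤ₚ

    Assigns : {κ : Configuration q} → Realises O colourOf Everything κ → Vec (Position κ) n → Vec Carrier n → Set a
    Assigns m v ρ = ∀ x → lookup ρ x ≈ pt O colourOf m (lookup v x)

    assigns-∷ : ∀ {p} {κ : Configuration p} {κ′ : Configuration q}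
                {m : Realises O colourOf Everything κ} {m′ : Realises O colourOf Everything κ′}
                {v : Vec (Position κ) n} {ρ i f x} →
                Assigns m v ρ → x ≈ pt O colourOf m′ i →
                (∀ j → pt O colourOf m′ (f j) ≡ pt O colourOf m j) → Assigns m′ (i ∷ Vec.map f v) (x ∷ ρ)
    assigns-∷ h eq same Fin.zero = eq
    assigns-∷ {m = m} {m′} {v} {f = f} h eq same (Fin.suc x) = Eq.trans (h x) (Eq.reflexive (sym
      (trans (cong (pt O colourOf m′) (Vec.lookup-map x f v)) (same (lookup v x)))))

    -- The argument of Ehrenfeucht and Fraïssé: a quantifier uses up one rank of the formula, and
    -- the point that it names uses up one rank of the configuration.
    Holds⇔Sat : (φ : Formula d n) (κ : Configuration q) (m : Realises O colourOf Everything κ) →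
                ∀ v ρ → Assigns m v ρ → rank φ ℕ.≤ q → (Holds A φ ρ → Sat φ κ v) × (Sat φ κ v → Holds A φ ρ)
    Holds⇔Sat (x ≐ y) κ m v ρ h _ =
      (λ eq → pt-injective O colourOf m _ _ (Eq.trans (Eq.sym (h x)) (Eq.trans eq (h y)))) ,
      (λ eq → Eq.trans (h x) (Eq.trans (Eq.reflexive (cong (pt O colourOf m) eq)) (Eq.sym (h y))))
    Holds⇔Sat (x <′ y) κ m v ρ h _ =
      (λ lt → pt-comono O colourOf m _ _ (<-respʳ-≈ (h y) (<-respˡ-≈ (h x) lt))) ,
      (λ lt → <-respʳ-≈ (Eq.sym (h y)) (<-respˡ-≈ (Eq.sym (h x)) (pt-mono O colourOf m lt)))
    Holds⇔Sat (colour i x) κ m v ρ h _ =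
      (λ c → trans (sym (pt-colour O colourOf m _)) (trans (sym (colourOf-cong (h x))) (colour⇒colourOf c))) ,
      (λ eq → colourOf⇒colour (trans (colourOf-cong (h x)) (trans (pt-colour O colourOf m _) eq)))
    Holds⇔Sat ⊤′ κ m v ρ h _ = (λ _ → tt) , (λ _ → ttₚ)
    Holds⇔Sat ⊥′ κ m v ρ h _ = (λ ()) , (λ ())
    Holds⇔Sat (¬′ φ) κ m v ρ h le = let f , g = Holds⇔Sat φ κ m v ρ h le in (_∘ g) , (_∘ f)
    Holds⇔Sat (φ ∧′ ψ) κ m v ρ h le =
      let f , g = Holds⇔Sat φ κ m v ρ h (ℕ.m⊔n≤o⇒m≤o _ _ le)
          f′ , g′ = Holds⇔Sat ψ κ m v ρ h (ℕ.m⊔n≤o⇒n≤o (rank φ) _ le)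
      in (λ (x , y) → f x , f′ y) , (λ (x , y) → g x , g′ y)
    Holds⇔Sat (φ ∨′ ψ) κ m v ρ h le =
      let f , g = Holds⇔Sat φ κ m v ρ h (ℕ.m⊔n≤o⇒m≤o _ _ le)
          f′ , g′ = Holds⇔Sat ψ κ m v ρ h (ℕ.m⊔n≤o⇒n≤o (rank φ) _ le)
      in ⊎.map f f′ , ⊎.map g g′
    Holds⇔Sat (φ ⇒′ ψ) κ m v ρ h le =
      let f , g = Holds⇔Sat φ κ m v ρ h (ℕ.m⊔n≤o⇒m≤o _ _ le)
          f′ , g′ = Holds⇔Sat ψ κ m v ρ h (ℕ.m⊔n≤o⇒n≤o (rank φ) _ le)
      in (λ k x → f′ (k (g x))) , (λ k x → g′ (k (f x)))
    Holds⇔Sat {q = suc q} (∀′ φ) κ m v ρ h (ℕ.s≤s le) = to , from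
      where
      to : (∀ x → Holds A φ (x ∷ ρ)) → ¬ SomeExtension κ (λ κ′ i f → ¬ Sat φ κ′ (i ∷ Vec.map f v))
      to all s with extend⁻ O colourOf κ m s
      ... | κ′ , m′ , i , f , same , ¬sat =
        ¬sat (proj₁ (Holds⇔Sat φ κ′ m′ _ _ (assigns-∷ {m = m} {m′} {v} h Eq.refl same) le) (all _))

      from : ¬ SomeExtension κ (λ κ′ i f → ¬ Sat φ κ′ (i ∷ Vec.map f v)) → ∀ x → Holds A φ (x ∷ ρ)
      from none x with em (Holds A φ (x ∷ ρ))
      ... | yes holds = holds
      ... | no ¬holds = contradiction
        (extend⁺ O colourOf κ m x ttₚ (λ κ′ m′ i f eq same sat →
          ¬holds (proj₂ (Holds⇔Sat φ κ′ m′ _ _ (assigns-∷ {m = m} {m′} {v} h (Eq.sym eq) same) le) sat))) none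
    Holds⇔Sat {q = suc q} (∃′ φ) κ m v ρ h (ℕ.s≤s le) = to , from
      where
      to : ∃[ x ] Holds A φ (x ∷ ρ) → SomeExtension κ (λ κ′ i f → Sat φ κ′ (i ∷ Vec.map f v))
      to (x , holds) = extend⁺ O colourOf κ m x ttₚ (λ κ′ m′ i f eq same →
        proj₁ (Holds⇔Sat φ κ′ m′ _ _ (assigns-∷ {m = m} {m′} {v} h (Eq.sym eq) same) le) holds)

      from : SomeExtension κ (λ κ′ i f → Sat φ κ′ (i ∷ Vec.map f v)) → ∃[ x ] Holds A φ (x ∷ ρ)
      from s with extend⁻ O colourOf κ m s
      ... | κ′ , m′ , i , f , same , sat =
        _ , proj₂ (Holds⇔Sat φ κ′ m′ _ _ (assigns-∷ {m = m} {m′} {v} h Eq.refl same) le) sat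

    -- With no point named, a configuration is a single gap. Hence the truth of σ depends only on
    -- the type of the whole structure.
    ⊨⇔Sat : (σ : Sentence d) → rank σ ℕ.≤ q →
            (A ⊨ σ → Sat σ (end (tp O q colourOf Everything)) []) ×
            (Sat σ (end (tp O q colourOf Everything)) [] → A ⊨ σ)
    ⊨⇔Sat σ = Holds⇔Sat σ _ (lift refl) [] [] (λ ())

-- Sets of types, their stabilisation, and factorisation in the limit set

module Algebra (d : ℕ) where
  open import Data.Nat.Base using (zero; suc)
  open Types d

  private variable
    q : ℕ

  infixl 7 _⊗_

  abstract
    _⊗_ : Tys q → Tys q → Tys q
    X ⊗ Y = ⟪ (λ t → any-Ty λ x → any-Ty λ y → (X ∋? x) ×-dec (Y ∋? y) ×-dec (t ≟ᵗ x ∙ y)) ⟫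

    ⊗⁺ : (X Y : Tys q) → ∀ {x y} → X ∋ x → Y ∋ y → (X ⊗ Y) ∋ (x ∙ y)
    ⊗⁺ X Y x∈ y∈ = ⟪⟫⁺ _ (_ , _ , x∈ , y∈ , refl)

    ⊗⁻ : (X Y : Tys q) → ∀ {t} → (X ⊗ Y) ∋ t → ∃₂ λ x y → X ∋ x × Y ∋ y × t ≡ x ∙ y
    ⊗⁻ X Y = ⟪⟫⁻ _

  plus : Tys q → Tys q
  plus X = X ⊗ star X

  -- By Ramsey's theorem, these are the types of the ω-sums of structures
  -- with types in X.
  abstract
    ωSums : Tys q → Tys q
    ωSums X = ⟪ (λ t → any-Ty λ s → any-Ty λ e → (star X ∋? s) ×-dec (plus X ∋? e) ×-dec (t ≟ᵗ s ∙ e ^ω)) ⟫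

    ωSums⁺ : (X : Tys q) → ∀ {s e} → star X ∋ s → plus X ∋ e → ωSums X ∋ (s ∙ e ^ω)
    ωSums⁺ X s∈ e∈ = ⟪⟫⁺ _ (_ , _ , s∈ , e∈ , refl)

    ωSums⁻ : (X : Tys q) → ∀ {t} → ωSums X ∋ t → ∃₂ λ s e → star X ∋ s × plus X ∋ e × t ≡ s ∙ e ^ω
    ωSums⁻ X = ⟪⟫⁻ _

  abstract
    points : Tys q
    points = ⟪ (λ t → Fin.any? λ c → t ≟ᵗ point c) ⟫

    points⁺ : ∀ c → points {q} ∋ point c
    points⁺ c = ⟪⟫⁺ _ (c , refl)

    points⁻ : ∀ {t} → points {q} ∋ t → ∃[ c ] t ≡ point c
    points⁻ = ⟪⟫⁻ _

  ω^-types : ℕ → Tys q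
  ω^-types zero    = points
  ω^-types (suc n) = ωSums (ω^-types n)

  -- For exponents beyond this one, the types of the coloured ω ^ n no
  -- longer depend on n.
  threshold : ℕ → ℕ
  threshold q = suc (Finite.size (ℙ-finite (Ty-finite q)))

  limitTypes : Tys q
  limitTypes {q} = ω^-types (threshold q)

  -- For such e, every nonempty well-ordered sum of structures of type e has type e again: this is
  -- `closed-from` for the set of types that consists of e alone.
  Fixed : Ty q → Set
  Fixed e = e ∙ e ≡ e × e ^ω ≡ e

  abstract
    uncountableCofinality : Tys q → Tys q
    uncountableCofinality P = ⟪ (λ t → any-Ty λ s → any-Ty λ e → (P ∋? s) ×-dec (P ∋? e) ×-dec
      ((e ∙ e ≟ᵗ e) ×-dec (e ^ω ≟ᵗ e)) ×-dec (t ≟ᵗ s ∙ e)) ⟫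

    uncountable⁺ : (P : Tys q) → ∀ {s e} → P ∋ s → P ∋ e → Fixed e → uncountableCofinality P ∋ (s ∙ e)
    uncountable⁺ P s∈ e∈ fix = ⟪⟫⁺ _ (_ , _ , s∈ , e∈ , fix , refl)

    uncountable⁻ : (P : Tys q) → ∀ {t} → uncountableCofinality P ∋ t →
                   ∃₂ λ s e → P ∋ s × P ∋ e × Fixed e × t ≡ s ∙ e
    uncountable⁻ P = ⟪⟫⁻ _

  module _ ⦃ _ : EM 0ℓ ⦄ where

    plus⇒star : (X : Tys q) → ∀ {e} → plus X ∋ e → star X ∋ e
    plus⇒star X e∈ with ⊗⁻ X (star X) e∈
    ... | _ , _ , x∈ , s∈ , refl = star⁺ X (x∈ ∷ star⁻ X s∈)

    star-[] : (X : Tys q) → star X ∋ ε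
    star-[] X = star⁺ X []

    star-∷ : (X : Tys q) → ∀ {x s} → X ∋ x → star X ∋ s → star X ∋ (x ∙ s)
    star-∷ X x∈ s∈ = star⁺ X (x∈ ∷ star⁻ X s∈)

    plus-unit : (X : Tys q) → ∀ {x} → X ∋ x → plus X ∋ x
    plus-unit X {x} x∈ = subst (plus X ∋_) (ε-identityʳ x) (⊗⁺ X (star X) x∈ (star-[] X))

    ωSums-⊗⁺ : (X : Tys q) → ∀ {x y} → X ∋ x → ωSums X ∋ y → ωSums X ∋ (x ∙ y)
    ωSums-⊗⁺ X {x} x∈ y∈ with ωSums⁻ X y∈
    ... | s , e , s∈ , e∈ , refl =
      subst (ωSums X ∋_) (∙-assoc x s (e ^ω)) (ωSums⁺ X (star-∷ X x∈ s∈) e∈)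

    ωSums-⊗⁻ : (X : Tys q) → ∀ {y} → ωSums X ∋ y → (X ⊗ ωSums X) ∋ y
    ωSums-⊗⁻ X y∈ with ωSums⁻ X y∈
    ... | s , e , s∈ , e∈ , refl = go (star⁻ X s∈)
      where
      go : ∀ {s} → Star (X ∋_) s → (X ⊗ ωSums X) ∋ (s ∙ e ^ω)
      -- Nothing stands before the periodic part, so the first summand is taken out of a copy of e.
      -- It exists because e lies in `plus X` and not just in `star X`.
      go [] with ⊗⁻ X (star X) e∈
      ... | x , p , x∈ , p∈ , refl = subst ((X ⊗ ωSums X) ∋_)
        (trans (sym (∙-assoc x p (e ^ω))) (trans (ω-absorb e) (sym (ε-identityˡ (e ^ω)))))
        (⊗⁺ X (ωSums X) x∈ (ωSums⁺ X p∈ e∈))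
      go (_∷_ {x} {u} x∈ s) = subst ((X ⊗ ωSums X) ∋_) (sym (∙-assoc x u (e ^ω)))
        (⊗⁺ X (ωSums X) x∈ (ωSums⁺ X (star⁺ X s) e∈))

    -- ω ^ m + ω ^ n = ω ^ n
    absorb⁺ : ∀ {m n} → m ℕ.< n → ∀ {x y} → ω^-types {q} m ∋ x → ω^-types n ∋ y → ω^-types n ∋ (x ∙ y)
    absorb⁺ {m = m} {suc n} (s≤s m≤n) {x} x∈ y∈ with ℕ.m≤n⇒m<n∨m≡n m≤n
    ... | inj₂ refl = ωSums-⊗⁺ (ω^-types n) x∈ y∈
    ... | inj₁ m<n with ⊗⁻ _ _ (ωSums-⊗⁻ (ω^-types n) y∈)
    ...   | x′ , y′ , x′∈ , y′∈ , refl = subst (ωSums (ω^-types n) ∋_) (∙-assoc x x′ y′)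
              (ωSums-⊗⁺ (ω^-types n) (absorb⁺ m<n x∈ x′∈) y′∈)

    absorb⁻ : ∀ {m n} → m ℕ.< n → ∀ {y} → ω^-types {q} n ∋ y → (ω^-types m ⊗ ω^-types n) ∋ y
    absorb⁻ {m = m} {suc n} (s≤s m≤n) y∈ with ℕ.m≤n⇒m<n∨m≡n m≤n
    ... | inj₂ refl = ωSums-⊗⁻ (ω^-types n) y∈
    ... | inj₁ m<n with ⊗⁻ _ _ (ωSums-⊗⁻ (ω^-types n) y∈)
    ...   | x′ , y′ , x′∈ , y′∈ , refl with ⊗⁻ _ _ (absorb⁻ m<n x′∈)
    ...     | x , x″ , x∈ , x″∈ , refl = subst (_ ∋_) (sym (∙-assoc x x″ y′))
                (⊗⁺ (ω^-types m) (ωSums (ω^-types n)) x∈ (ωSums-⊗⁺ (ω^-types n) x″∈ y′∈))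

    absorb : ∀ {m n} → m ℕ.< n → ω^-types {q} m ⊗ ω^-types n ≡ ω^-types n
    absorb {m = m} {n} m<n = ℙ-ext
      (λ t h → let x , y , x∈ , y∈ , eq = ⊗⁻ (ω^-types m) (ω^-types n) h in
               subst (ω^-types n ∋_) (sym eq) (absorb⁺ m<n x∈ y∈))
      (λ t → absorb⁻ m<n)

    module _ {X : Tys q} (XX : X ⊗ X ≡ X) where

      idempotent-∙ : ∀ {x y} → X ∋ x → X ∋ y → X ∋ (x ∙ y)
      idempotent-∙ x∈ y∈ = subst (_∋ _) XX (⊗⁺ X X x∈ y∈)

      idempotent-plus : ∀ {e} → plus X ∋ e → X ∋ e
      idempotent-plus e∈ with ⊗⁻ X (star X) e∈
      ... | x , p , x∈ , p∈ , refl = go x∈ (star⁻ X p∈)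
        where
        go : ∀ {x p} → X ∋ x → Star (X ∋_) p → X ∋ (x ∙ p)
        go {x} x∈ []                = subst (X ∋_) (sym (ε-identityʳ x)) x∈
        go {x} x∈ (_∷_ {y} {u} y∈ s) =
          subst (X ∋_) (∙-assoc x y u) (go (idempotent-∙ x∈ y∈) s)

      idempotent-ωSums⁻ : ∀ {t} → ωSums X ∋ t → ∃₂ λ s e → X ∋ s × X ∋ e × t ≡ s ∙ e ^ω
      idempotent-ωSums⁻ t∈ with ωSums⁻ X t∈
      ... | s , e , s∈ , e∈ , refl = go (star⁻ X s∈)
        where
        e∈X : X ∋ e
        e∈X = idempotent-plus e∈
        go : ∀ {s} → Star (X ∋_) s → ∃₂ λ s′ e′ → X ∋ s′ × X ∋ e′ × s ∙ e ^ω ≡ s′ ∙ e′ ^ω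
        go [] = e , e , e∈X , e∈X , trans (ε-identityˡ (e ^ω)) (sym (ω-absorb e))
        go (x∈ ∷ s) = _ , e , idempotent-plus (⊗⁺ X (star X) x∈ (star⁺ X s)) , e∈X , refl

      idempotent-ωSums⁺ : ∀ {s e} → X ∋ s → X ∋ e → ωSums X ∋ (s ∙ e ^ω)
      idempotent-ωSums⁺ s∈ e∈ = ωSums⁺ X (plus⇒star X (plus-unit X s∈)) (plus-unit X e∈)

    -- A product (y x) ^ω with y x ∈ Y X = X is y (x y) ^ω with x y ∈ X Y = Y.
    ωSums-rotate : {X Y : Tys q} → X ⊗ X ≡ X → Y ⊗ Y ≡ Y → X ⊗ Y ≡ Y → Y ⊗ X ≡ X →
                   ∀ t → ωSums X ∋ t → ωSums Y ∋ t
    ωSums-rotate {X = X} {Y} XX YY XY YX t t∈ with idempotent-ωSums⁻ XX t∈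
    ... | s , e , s∈ , e∈ , refl with ⊗⁻ Y X (subst (_∋ e) (sym YX) e∈)
    ...   | y , x , y∈ , x∈ , refl = subst (ωSums Y ∋_)
      (trans (∙-assoc s y _) (cong (s ∙_) (sym (ω-unroll y x))))
      (idempotent-ωSums⁺ YY (subst (_∋ _) XY (⊗⁺ X Y s∈ y∈)) (subst (_∋ _) XY (⊗⁺ X Y x∈ y∈)))

    -- Let X and Y be the sets for i and i + 1. The repetition lets `absorb` be applied from X to
    -- itself and from Y back to X, so that X and Y are idempotent and absorb each other. Then
    -- `ωSums-rotate` works in both directions, and the period is one.
    eventually-constant : ∀ {i j} → i ℕ.< j → ω^-types {q} i ≡ ω^-types j →
                          ω^-types {q} (suc i) ≡ ω^-types (suc (suc i))
    eventually-constant {q} {i} {j} i<j eq = ℙ-ext (ωSums-rotate XX YY XY YX) (ωSums-rotate YY XX YX XY)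
      where
      X Y : Tys q
      X = ω^-types i
      Y = ω^-types (suc i)
      XX : X ⊗ X ≡ X
      XX = subst (λ Z → X ⊗ Z ≡ Z) (sym eq) (absorb i<j)
      YY : Y ⊗ Y ≡ Y
      YY = subst (λ Z → Y ⊗ Z ≡ Z) (cong ωSums (sym eq)) (absorb (s≤s i<j))
      XY : X ⊗ Y ≡ Y
      XY = absorb (ℕ.n<1+n i)
      YX : Y ⊗ X ≡ X
      YX with ℕ.m≤n⇒m<n∨m≡n i<j
      ... | inj₁ lt   = subst (λ Z → Y ⊗ Z ≡ Z) (sym eq) (absorb lt)
      ... | inj₂ refl = subst (λ Z → Z ⊗ X ≡ X) eq XX

    constant-from : ∀ {i} → ω^-types {q} i ≡ ω^-types (suc i) → ∀ {n} → i ℕ.≤ n →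
                    ω^-types {q} n ≡ ω^-types (suc n)
    constant-from eq {n} i≤n with ℕ.m≤n⇒m<n∨m≡n i≤n
    ... | inj₂ refl = eq
    constant-from eq {suc n} _ | inj₁ (s≤s i≤n) = cong ωSums (constant-from eq i≤n)

    -- The pigeonhole bound on i puts i + 1 below `threshold q`. That the threshold is a successor
    -- is used again in `CofinalityOfProduct`.
    limitTypes-stable : limitTypes {q} ≡ ωSums limitTypes
    limitTypes-stable {q} with pigeonhole-ℕ (ℙ-finite (Ty-finite q)) ω^-types
    ... | i , j , i<j , j≤N , eq =
      constant-from (eventually-constant i<j eq) (s≤s (ℕ.≤-trans (ℕ.<⇒≤ i<j) j≤N))

    limitTypes-idempotent : limitTypes {q} ⊗ limitTypes ≡ limitTypes
    limitTypes-idempotent {q} = subst (λ Z → limitTypes {q} ⊗ Z ≡ Z) (sym limitTypes-stable)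
      (absorb (ℕ.n<1+n (threshold q)))

    pow-+ : (e : Ty q) → ∀ m n → pow e (m ℕ.+ n) ≡ pow e m ∙ pow e n
    pow-+ e zero    n = sym (ε-identityˡ _)
    pow-+ e (suc m) n = trans (cong (e ∙_) (pow-+ e m n)) (sym (∙-assoc e _ _))

    pow-comm : (e : Ty q) → ∀ n → pow e n ∙ e ≡ e ∙ pow e n
    pow-comm e n = begin
      pow e n ∙ e          ≡⟨ cong (λ x → pow x n ∙ e) (ε-identityʳ e) ⟨
      pow (e ∙ ε) n ∙ e    ≡⟨ pow-∙ e ε n ⟩
      e ∙ pow (ε ∙ e) n    ≡⟨ cong (λ x → e ∙ pow x n) (ε-identityˡ e) ⟩
      e ∙ pow e n          ∎
      where open ≡-Reasoning

    -- a = zⁱ a wⁱ for all i, and two of the a wⁱ coincide.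
    absorbs-power : (a z w : Ty q) → a ≡ z ∙ (a ∙ w) → ∃[ k ] a ≡ a ∙ (w ∙ pow w k)
    absorbs-power {q} a z w eq with pigeonhole-ℕ (Ty-finite q) (λ i → a ∙ pow w i)
    ... | i , j , i<j , _ , same = k , (begin
      a                                          ≡⟨ iterate i ⟩
      pow z i ∙ (a ∙ pow w i)                    ≡⟨ cong (pow z i ∙_) same ⟩
      pow z i ∙ (a ∙ pow w j)                    ≡⟨ cong (λ n → pow z i ∙ (a ∙ pow w n)) j≡ ⟩
      pow z i ∙ (a ∙ pow w (i ℕ.+ suc k))        ≡⟨ cong (λ x → pow z i ∙ (a ∙ x)) (pow-+ w i (suc k)) ⟩
      pow z i ∙ (a ∙ (pow w i ∙ pow w (suc k)))  ≡⟨ cong (pow z i ∙_) (∙-assoc a _ _) ⟨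
      pow z i ∙ (a ∙ pow w i ∙ pow w (suc k))    ≡⟨ ∙-assoc (pow z i) _ _ ⟨
      pow z i ∙ (a ∙ pow w i) ∙ pow w (suc k)    ≡⟨ cong (_∙ pow w (suc k)) (iterate i) ⟨
      a ∙ pow w (suc k)                          ∎)
      where
      open ≡-Reasoning
      k = j ℕ.∸ suc i
      j≡ : j ≡ i ℕ.+ suc k
      j≡ = sym (trans (ℕ.+-suc i k) (ℕ.m+[n∸m]≡n i<j))
      iterate : ∀ i → a ≡ pow z i ∙ (a ∙ pow w i)
      iterate zero    = sym (trans (ε-identityˡ _) (ε-identityʳ a))
      iterate (suc i) = begin
        a                                        ≡⟨ eq ⟩
        z ∙ (a ∙ w)                              ≡⟨ cong (λ x → z ∙ (x ∙ w)) (iterate i) ⟩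
        z ∙ (pow z i ∙ (a ∙ pow w i) ∙ w)        ≡⟨ cong (z ∙_) (∙-assoc _ _ w) ⟩
        z ∙ (pow z i ∙ (a ∙ pow w i ∙ w))        ≡⟨ cong (λ x → z ∙ (pow z i ∙ x)) (∙-assoc a _ w) ⟩
        z ∙ (pow z i ∙ (a ∙ (pow w i ∙ w)))      ≡⟨ cong (λ x → z ∙ (pow z i ∙ (a ∙ x))) (pow-comm w i) ⟩
        z ∙ (pow z i ∙ (a ∙ pow w (suc i)))      ≡⟨ ∙-assoc z _ _ ⟨
        pow z (suc i) ∙ (a ∙ pow w (suc i))      ∎

    module _ {P : Tys q} (PP : P ⊗ P ≡ P) (Pω : P ≡ ωSums P) where

      private
        ∙∈ : ∀ {x y} → P ∋ x → P ∋ y → P ∋ (x ∙ y)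
        ∙∈ = idempotent-∙ PP

        ω∈ : ∀ {x} → P ∋ x → P ∋ x ^ω
        ω∈ {x} x∈ = subst (P ∋_) (ω-absorb x)
          (subst (_∋ _) (sym Pω) (idempotent-ωSums⁺ PP x∈ x∈))

        pow∈ : ∀ {y w} → P ∋ y → P ∋ w → ∀ n → P ∋ (y ∙ pow w n)
        pow∈ {y} y∈ w∈ zero        = subst (P ∋_) (sym (ε-identityʳ y)) y∈
        pow∈ {y} {w} y∈ w∈ (suc n) = subst (P ∋_) (∙-assoc y w _) (pow∈ (∙∈ y∈ w∈) w∈ n)

        -- A factorisation of u through the ω-power of v, with a factor from `P` on either side. An
        -- infinite descent through the finitely many types repeats a value and so yields some a
        -- with `a ⊒ a`, the hypothesis of `fixed`.
        _⊒_ : Ty q → Ty q → Set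
        u ⊒ v = ∃₂ λ z y → P ∋ z × P ∋ y × u ≡ z ∙ (v ^ω ∙ y)

        -- In v^ω = v v^ω the factorisation of the first v through w can be inserted.
        ⊒-trans : ∀ {u v w} → P ∋ v → u ⊒ v → v ⊒ w → u ⊒ w
        ⊒-trans {u} {v} {w} v∈ (z , y , z∈ , y∈ , refl) (z′ , y′ , z′∈ , y′∈ , eq) =
          z ∙ z′ , y′ ∙ (v ^ω ∙ y) , ∙∈ z∈ z′∈ , ∙∈ y′∈ (∙∈ (ω∈ v∈) y∈) , (begin
          z ∙ (v ^ω ∙ y)                          ≡⟨ cong (λ x → z ∙ (x ∙ y)) (ω-absorb v) ⟨
          z ∙ (v ∙ v ^ω ∙ y)                      ≡⟨ cong (z ∙_) (∙-assoc v _ y) ⟩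
          z ∙ (v ∙ (v ^ω ∙ y))                    ≡⟨ cong (λ x → z ∙ (x ∙ (v ^ω ∙ y))) eq ⟩
          z ∙ (z′ ∙ (w ^ω ∙ y′) ∙ (v ^ω ∙ y))     ≡⟨ cong (z ∙_) (∙-assoc z′ _ _) ⟩
          z ∙ (z′ ∙ (w ^ω ∙ y′ ∙ (v ^ω ∙ y)))     ≡⟨ ∙-assoc z z′ _ ⟨
          z ∙ z′ ∙ (w ^ω ∙ y′ ∙ (v ^ω ∙ y))       ≡⟨ cong (z ∙ z′ ∙_) (∙-assoc _ y′ _) ⟩
          z ∙ z′ ∙ (w ^ω ∙ (y′ ∙ (v ^ω ∙ y)))     ∎)
          where open ≡-Reasoning

        -- `P ≡ ωSums P` is used twice. After u = s v^ω nothing need stand behind the power; but v^ω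
        -- = v v^ω, and with v = s′ w^ω the power of w is followed by v^ω.
        next : ∀ {u} → P ∋ u → ∃[ v ] P ∋ v × u ⊒ v
        next u∈ with idempotent-ωSums⁻ PP (subst (_∋ _) Pω u∈)
        ... | s , v , s∈ , v∈ , refl with idempotent-ωSums⁻ PP (subst (_∋ _) Pω v∈)
        ...   | s′ , w , s′∈ , w∈ , refl = w , w∈ , s ∙ s′ , v ^ω , ∙∈ s∈ s′∈ , ω∈ v∈ , (begin
          s ∙ v ^ω                ≡⟨ cong (s ∙_) (ω-absorb v) ⟨
          s ∙ (v ∙ v ^ω)          ≡⟨ cong (s ∙_) (∙-assoc s′ _ _) ⟩
          s ∙ (s′ ∙ (w ^ω ∙ v ^ω)) ≡⟨ ∙-assoc s s′ _ ⟨
          s ∙ s′ ∙ (w ^ω ∙ v ^ω)  ∎)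
          where open ≡-Reasoning

        chain : ∀ {p} → P ∋ p → ℕ → ∃[ v ] P ∋ v
        chain p∈ zero    = _ , p∈
        chain p∈ (suc n) = let v , v∈ = chain p∈ n; w , w∈ , _ = next v∈ in w , w∈

        chain-⊒ : ∀ {p} (p∈ : P ∋ p) {i j} → i ℕ.< j → proj₁ (chain p∈ i) ⊒ proj₁ (chain p∈ j)
        chain-⊒ p∈ {i} {suc j} (s≤s i≤j) with ℕ.m≤n⇒m<n∨m≡n i≤j
        ... | inj₂ refl = proj₂ (proj₂ (next (proj₂ (chain p∈ i))))
        ... | inj₁ i<j  = ⊒-trans (proj₂ (chain p∈ j)) (chain-⊒ p∈ i<j) (proj₂ (proj₂ (next (proj₂ (chain p∈ j)))))

        -- If a = z a^ω y with all factors in P, then a = a^ω x for some x ∈ P,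
        -- and x a^ω is fixed by squaring and by the ω-power.
        fixed : ∀ {a} → P ∋ a → a ⊒ a → ∃[ g ] P ∋ g × Fixed g × a ^ω ≡ a ^ω ∙ g
        fixed {a} a∈ (z , y , z∈ , y∈ , eq)
          with k , eq′ ← absorbs-power a z (a ^ω ∙ y)
                 (trans eq (cong (z ∙_) (trans (cong (_∙ y) (sym (ω-absorb a))) (∙-assoc a _ y)))) =
          x ∙ a ^ω , ∙∈ x∈ (ω∈ a∈) , (gg , gω) , (begin
            a ^ω               ≡⟨ ω-absorb a ⟨
            a ∙ a ^ω           ≡⟨ cong (_∙ a ^ω) a≡ ⟩
            a ^ω ∙ x ∙ a ^ω    ≡⟨ ∙-assoc _ x _ ⟩
            a ^ω ∙ (x ∙ a ^ω)  ∎)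
          where
          open ≡-Reasoning
          x : Ty q
          x = y ∙ pow (a ^ω ∙ y) k
          x∈ : P ∋ x
          x∈ = pow∈ y∈ (∙∈ (ω∈ a∈) y∈) k
          a≡ : a ≡ a ^ω ∙ x
          a≡ = begin
            a                                         ≡⟨ eq′ ⟩
            a ∙ (a ^ω ∙ y ∙ pow (a ^ω ∙ y) k)         ≡⟨ cong (a ∙_) (∙-assoc _ y _) ⟩
            a ∙ (a ^ω ∙ x)                            ≡⟨ ∙-assoc a _ x ⟨
            a ∙ a ^ω ∙ x                              ≡⟨ cong (_∙ x) (ω-absorb a) ⟩
            a ^ω ∙ x                                  ∎
          gg : x ∙ a ^ω ∙ (x ∙ a ^ω) ≡ x ∙ a ^ω
          gg = begin
            x ∙ a ^ω ∙ (x ∙ a ^ω)    ≡⟨ ∙-assoc x _ _ ⟩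
            x ∙ (a ^ω ∙ (x ∙ a ^ω))  ≡⟨ cong (x ∙_) (∙-assoc _ x _) ⟨
            x ∙ (a ^ω ∙ x ∙ a ^ω)    ≡⟨ cong (λ b → x ∙ (b ∙ a ^ω)) a≡ ⟨
            x ∙ (a ∙ a ^ω)           ≡⟨ cong (x ∙_) (ω-absorb a) ⟩
            x ∙ a ^ω                 ∎
          gω : (x ∙ a ^ω) ^ω ≡ x ∙ a ^ω
          gω = trans (ω-unroll x (a ^ω)) (cong (λ b → x ∙ b ^ω) (sym a≡))

      -- The descent from p reaches an a with p = z a^ω y and `a ⊒ a`. By `fixed`, a^ω = a^ω g for
      -- some fixed g in `P`, and as g is idempotent, p = (z a^ω g)(g y).
      uncountable-⊗ : ∀ {p} → P ∋ p → (uncountableCofinality P ⊗ P) ∋ p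
      uncountable-⊗ {p} p∈ with pigeonhole-ℕ (Ty-finite q) (λ i → proj₁ (chain p∈ i))
      -- The first relation is p ⊒ a, as 0 < j. The second is a ⊒ a, since members i and j of the
      -- chain coincide.
      ... | i , j , i<j , _ , same with chain-⊒ p∈ (ℕ.≤-trans (s≤s z≤n) i<j)
                                   | fixed (proj₂ (chain p∈ j)) (subst (_⊒ _) same (chain-⊒ p∈ i<j))
      ... | z , y , z∈ , y∈ , p≡ | g , g∈ , fix@(gg , _) , eq = subst (_ ∋_) (begin
        z ∙ a ^ω ∙ g ∙ (g ∙ y)    ≡⟨ ∙-assoc (z ∙ a ^ω) g _ ⟩
        z ∙ a ^ω ∙ (g ∙ (g ∙ y))  ≡⟨ cong (z ∙ a ^ω ∙_) (trans (sym (∙-assoc g g y)) (cong (_∙ y) gg)) ⟩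
        z ∙ a ^ω ∙ (g ∙ y)        ≡⟨ ∙-assoc z _ _ ⟩
        z ∙ (a ^ω ∙ (g ∙ y))      ≡⟨ cong (z ∙_) (trans (sym (∙-assoc _ g y)) (cong (_∙ y) (sym eq))) ⟩
        z ∙ (a ^ω ∙ y)            ≡⟨ p≡ ⟨
        p                         ∎)
        (⊗⁺ (uncountableCofinality P) P (uncountable⁺ P (∙∈ z∈ (ω∈ (proj₂ (chain p∈ j)))) g∈ fix) (∙∈ g∈ y∈))
        where
        open ≡-Reasoning
        a = proj₁ (chain p∈ j)

-- Infinite pigeonhole and Ramsey's theorem for pairs

module Combinatorics where
  open import Data.Nat.Base using (zero; suc)

  ¬∀⇒∃¬ : ∀ {a} ⦃ _ : EM a ⦄ {A : Set a} {P : A → Set a} → ¬ (∀ x → P x) → ∃[ x ] ¬ P x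
  ¬∀⇒∃¬ ⦃ e ⦄ {P = P} h = decidable-stable (em _) λ none → h λ x → decidable-stable (em (P x)) λ ¬p → none (x , ¬p)

  module _ {c} {C : Set c} {_≼_ : C → C → Set c}
           (_⊔_ : C → C → C) (left : ∀ x y → x ≼ (x ⊔ y)) (right : ∀ x y → y ≼ (x ⊔ y)) (c₀ : C) where

    -- Stated for any order with upper bounds, since it is applied to ℕ for the pigeonhole principle
    -- and to the points of an initial segment in `absorber`.
    finite-bound : {A : Set} (F : Finite A) {Q : A → C → Set c} →
                   (∀ {t x y} → Q t x → x ≼ y → Q t y) → (∀ t → ∃ (Q t)) → ∃[ x ] ∀ t → Q t x
    finite-bound {A} F {Q} up h = let x , hx = go id in
      x , λ t → subst (λ t → Q t x) (Finite.strictlyInverseʳ F t) (hx (Finite.to F t))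
      where
      go : ∀ {n} (f : Fin n → Fin (Finite.size F)) → ∃[ x ] ∀ i → Q (Finite.from F (f i)) x
      go {zero}  f = c₀ , λ ()
      go {suc n} f with h (Finite.from F (f Fin.zero)) | go (f ∘ Fin.suc)
      ... | x , hx | y , hy = x ⊔ y , λ { Fin.zero → up hx (left x y) ; (Fin.suc i) → up (hy i) (right x y) }

  Infinite : (ℕ → Set) → Set
  Infinite H = ∀ n → ∃[ m ] n ℕ.≤ m × H m

  StrictlyIncreasing : (ℕ → ℕ) → Set
  StrictlyIncreasing h = ∀ n → h n ℕ.< h (suc n)

  strictlyIncreasing-< : ∀ {h} → StrictlyIncreasing h → ∀ {m n} → m ℕ.< n → h m ℕ.< h n
  strictlyIncreasing-< inc {m} {suc n} (s≤s m≤n) with ℕ.m≤n⇒m<n∨m≡n m≤n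
  ... | inj₁ m<n  = ℕ.<-trans (strictlyIncreasing-< inc m<n) (inc n)
  ... | inj₂ refl = inc m

  enumerate : {H : ℕ → Set} → Infinite H → ∃[ h ] StrictlyIncreasing h × (∀ n → H (h n))
  enumerate {H} inf = h , (λ n → proj₁ (proj₂ (inf (suc (h n))))) , h∈
    where
    h : ℕ → ℕ
    h zero    = proj₁ (inf 0)
    h (suc n) = proj₁ (inf (suc (h n)))
    h∈ : ∀ n → H (h n)
    h∈ zero    = proj₂ (proj₂ (inf 0))
    h∈ (suc n) = proj₂ (proj₂ (inf (suc (h n))))

  module _ ⦃ _ : EM 0ℓ ⦄ {A : Set} (F : Finite A) where

    infinite-pigeonhole : ∀ {H} → Infinite H → (f : ℕ → A) → ∃[ c ] Infinite (λ m → H m × f m ≡ c)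
    infinite-pigeonhole {H} inf f = decidable-stable (em _) λ none →
      let n , h = finite-bound ℕ._⊔_ ℕ.m≤m⊔n ℕ.m≤n⊔m 0 F
                    {Q = λ c n → ∀ m → n ℕ.≤ m → ¬ (H m × f m ≡ c)}
                    (λ k x≤y m y≤m → k m (ℕ.≤-trans x≤y y≤m))
                    (λ c → let n , k = ¬∀⇒∃¬ (λ i → none (c , i)) in n , λ m n≤m p → k (m , n≤m , p))
          m , n≤m , hm = inf n
      in h (f m) m n≤m (hm , refl)

    constant-subsequence : (f : ℕ → A) → ∃₂ λ c h → StrictlyIncreasing h × (∀ n → f (h n) ≡ c)
    constant-subsequence f with infinite-pigeonhole {λ _ → Data.Unit.Base.⊤} (λ n → n , ℕ.≤-refl , _) f
      where import Data.Unit.Base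
    ... | c , inf with enumerate inf
    ...   | h , inc , h∈ = c , h , inc , λ n → proj₂ (h∈ n)

    module _ (f : ℕ → ℕ → A) where
      private
        State : Set₁
        State = ∃ Infinite

        module Step (S : State) where
          H : ℕ → Set
          H = proj₁ S

          inf : Infinite H
          inf = proj₂ S

          start : ℕ
          start = proj₁ (inf 0)

          start∈ : H start
          start∈ = proj₂ (proj₂ (inf 0))

          later : Infinite (λ m → H m × start ℕ.< m)
          later n with inf (n ℕ.⊔ suc start)
          ... | m , le , hm = m , ℕ.m⊔n≤o⇒m≤o n _ le , hm , ℕ.m⊔n≤o⇒n≤o n _ le

          colour : A
          colour = proj₁ (infinite-pigeonhole later (f start))

          next : State
          next = _ , proj₂ (infinite-pigeonhole later (f start))

        open Step

        states : ℕ → State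
        states zero    = (λ _ → ℕ.zero ≡ ℕ.zero) , λ n → n , ℕ.≤-refl , refl
        states (suc n) = next (states n)

        states-⊇ : ∀ {m n} → m ℕ.≤ n → ∀ {x} → proj₁ (states n) x → proj₁ (states m) x
        states-⊇ {n = zero}  z≤n h = h
        states-⊇ {n = suc n} m≤n h with ℕ.m≤n⇒m<n∨m≡n m≤n
        ... | inj₁ (s≤s lt) = states-⊇ lt (proj₁ (proj₁ h))
        ... | inj₂ refl     = h

        abstract
          -- Each infinite set is thinned to members beyond its first element s m that form pairs of
          -- one colour with s m. All later choices stay in the thinned set, so the colour of a pair
          -- depends on its smaller element only.
          prehomogeneous : ∃₂ λ (s : ℕ → ℕ) (k : ℕ → A) →
                           ∀ {m n} → m ℕ.< n → s m ℕ.< s n × f (s m) (s n) ≡ k m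
          prehomogeneous = (λ n → start (states n)) , (λ n → colour (states n)) , λ {m} {n} lt →
            let (_ , s<) , eq = states-⊇ {suc m} {n} lt (start∈ (states n)) in s< , eq

      ramsey : ∃₂ λ c h → StrictlyIncreasing h × (∀ {m n} → m ℕ.< n → f (h m) (h n) ≡ c)
      ramsey with prehomogeneous
      ... | s , k , pre with constant-subsequence k
      ...   | c , h , inc , eq = c , s ∘ h , (λ n → proj₁ (pre (inc n))) ,
          λ {m} lt → trans (proj₂ (pre (strictlyIncreasing-< inc lt))) (eq m)

open Combinatorics

-- Initial segments of a well-order and their cofinal sequences

module WellOrder {a} ⦃ _ : EM a ⦄ (B : Ordinal a) where
  open import Data.Nat.Base using (zero; suc)
  open Ordinal B hiding (trans)
  private module B = Ordinal B

  ≤-<-trans : ∀ {x y z} → ¬ y < x → y < z → x < z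
  ≤-<-trans {x} {y} y≮x y<z with compare x y
  ... | tri< x<y _ _ = B.trans x<y y<z
  ... | tri≈ _ x≈y _ = <-respˡ-≈ (Eq.sym x≈y) y<z
  ... | tri> _ _ y<x = contradiction y<x y≮x

  <-≤-trans : ∀ {x y z} → x < y → ¬ z < y → x < z
  <-≤-trans {x} {y} {z} x<y z≮y with compare y z
  ... | tri< y<z _ _ = B.trans x<y y<z
  ... | tri≈ _ y≈z _ = <-respʳ-≈ y≈z x<y
  ... | tri> _ _ z<y = contradiction z<y z≮y

  ≮-trans : ∀ {x y z} → ¬ y < x → ¬ z < y → ¬ z < x
  ≮-trans y≮x z≮y z<x = z≮y (<-≤-trans z<x y≮x)

  ≮⇒<⊎≈ : ∀ {x y} → ¬ y < x → x < y ⊎ x ≈ y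
  ≮⇒<⊎≈ {x} {y} y≮x with compare x y
  ... | tri< x<y _ _ = inj₁ x<y
  ... | tri≈ _ x≈y _ = inj₂ x≈y
  ... | tri> _ _ y<x = contradiction y<x y≮x

  private
    maximum : ∀ x y → Σ Carrier λ m → ¬ m < x × ¬ m < y × (m ≡ x ⊎ m ≡ y)
    maximum x y with compare x y
    ... | tri< x<y _ _ = y , asym x<y , irrefl Eq.refl , inj₂ refl
    ... | tri≈ _ x≈y _ = x , irrefl Eq.refl , irrefl x≈y , inj₁ refl
    ... | tri> _ _ y<x = x , irrefl Eq.refl , asym y<x , inj₁ refl

  infixl 6 _⊔_
  _⊔_ : Carrier → Carrier → Carrier
  x ⊔ y = proj₁ (maximum x y)

  x⊔y≮x : ∀ x y → ¬ x ⊔ y < x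
  x⊔y≮x x y = proj₁ (proj₂ (maximum x y))

  x⊔y≮y : ∀ x y → ¬ x ⊔ y < y
  x⊔y≮y x y = proj₁ (proj₂ (proj₂ (maximum x y)))

  ⊔-∈ : ∀ {p} (P : Carrier → Set p) {x y} → P x → P y → P (x ⊔ y)
  ⊔-∈ P {x} {y} px py with proj₂ (proj₂ (proj₂ (maximum x y)))
  ... | inj₁ eq = subst P (sym eq) px
  ... | inj₂ eq = subst P (sym eq) py

  minimal : (P : Carrier → Set a) → ∃ P → ∃[ y ] P y × (∀ z → z < y → ¬ P z)
  minimal P (x , px) = go (wellFounded x) px
    where
    go : ∀ {x} → Acc _<_ x → P x → ∃[ y ] P y × (∀ z → z < y → ¬ P z)
    go {x} (acc rec) px with em (∃[ z ] z < x × P z)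
    ... | yes (z , z<x , pz) = go (rec z<x) pz
    ... | no none            = x , px , λ z z<x pz → none (z , z<x , pz)

  Initial : (Carrier → Set a) → Set a
  Initial D = ∀ {x y} → D y → ¬ y < x → D x

  <-initial : ∀ b → Initial (_< b)
  <-initial b y<b y≮x = ≤-<-trans y≮x y<b

  HasMaximum : (Carrier → Set a) → Set a
  HasMaximum D = ∃[ m ] D m × (∀ x → D x → ¬ m < x)

  -- The sequence may be constant, so a segment with a maximum qualifies. Case distinctions
  -- therefore treat maxima separately.
  HasCofinalSequence : (Carrier → Set a) → Set a
  HasCofinalSequence D = Σ (ℕ → Carrier) λ f → (∀ n → D (f n)) × (∀ x → D x → ∃[ n ] ¬ f n < x)

  Increasing : (ℕ → Carrier) → Set a
  Increasing s = ∀ {m n} → m ℕ.< n → s m < s n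

  increasing : ∀ {s : ℕ → Carrier} → (∀ n → s n < s (suc n)) → Increasing s
  increasing inc {m} {suc n} (s≤s m≤n) with ℕ.m≤n⇒m<n∨m≡n m≤n
  ... | inj₁ m<n  = B.trans (increasing inc m<n) (inc n)
  ... | inj₂ refl = inc m

  Exhausts : (Carrier → Set a) → (ℕ → Carrier) → Set a
  Exhausts D s = (∀ n → D (s n)) × Increasing s × (∀ x → D x → ∃[ n ] x < s n)

  exhausts-subsequence : ∀ {D s h} → Exhausts D s → StrictlyIncreasing h → Exhausts D (s ∘ h)
  exhausts-subsequence {D} {s} {h} (s∈ , inc , cof) h-inc =
    s∈ ∘ h , inc ∘ strictlyIncreasing-< h-inc , λ x x∈ →
      let n , x<sn = cof x x∈ in n , <-≤-trans x<sn (sn≤shn n)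
    where
    n≤hn : ∀ n → n ℕ.≤ h n
    n≤hn zero    = z≤n
    n≤hn (suc n) = ℕ.≤-<-trans (n≤hn n) (h-inc n)
    sn≤shn : ∀ n → ¬ s (h n) < s n
    sn≤shn n with ℕ.m≤n⇒m<n∨m≡n (n≤hn n)
    ... | inj₁ n<hn = asym (inc n<hn)
    ... | inj₂ eq   = irrefl (Eq.reflexive (cong s (sym eq)))

  module _ {D : Carrier → Set a} (initial : Initial D) (noMax : ¬ HasMaximum D) where

    greater : ∀ {x} → D x → ∃[ y ] D y × x < y
    greater {x} x∈ = decidable-stable (em _) λ none →
      noMax (x , x∈ , λ y y∈ x<y → none (y , y∈ , x<y))

    successor : ∀ {x} → D x → ∃[ y ] D y × x < y × (∀ z → z < y → ¬ x < z)
    successor {x} x∈ =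
      let z , z∈ , x<z = greater x∈
          y , x<y , min = minimal (x <_) (z , x<z)
      in y , initial z∈ (λ z<y → min z z<y x<z) , x<y , min

    -- The next member is the immediate successor of the larger of `s n` and `f n`. The last
    -- component is the point of this choice: the segment below each later member has a maximum, so
    -- blocks between members never end at a limit.
    exhaustion : HasCofinalSequence D → ∀ a → D a → ∃[ s ] s 0 ≡ a × Exhausts D s ×
                 (∀ n → HasMaximum (_< s (suc n)))
    exhaustion (f , f∈ , cof) a a∈ = proj₁ ∘ s , refl ,
      (proj₂ ∘ s , increasing (λ n → ≤-<-trans (x⊔y≮x _ (f n)) (proj₁ (proj₂ (next n)))) ,
       λ x x∈ → let n , fn≮x = cof x x∈ in
         suc n , ≤-<-trans fn≮x (≤-<-trans (x⊔y≮y _ (f n)) (proj₁ (proj₂ (next n))))) ,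
      λ n → _ , proj₁ (proj₂ (next n)) , proj₂ (proj₂ (next n))
      where
      s : ℕ → ∃ D
      s⊔f∈ : ∀ n → D (proj₁ (s n) ⊔ f n)
      s⊔f∈ n = ⊔-∈ D (proj₂ (s n)) (f∈ n)
      s zero    = a , a∈
      s (suc n) = let y , y∈ , _ = successor (s⊔f∈ n) in y , y∈
      next : ∀ n → D (proj₁ (s (suc n))) × (proj₁ (s n) ⊔ f n) < proj₁ (s (suc n)) ×
             (∀ z → z < proj₁ (s (suc n)) → ¬ (proj₁ (s n) ⊔ f n) < z)
      next n = proj₂ (successor (s⊔f∈ n))

    module _ (noSeq : ¬ HasCofinalSequence D) where

      -- A sequence without a strict bound in `D` would be cofinal, so the least strict bound exists
      -- in `D`.
      supremum : (f : ℕ → Carrier) → (∀ n → D (f n)) →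
                 ∃[ c ] D c × (∀ n → f n < c) × (∀ x → x < c → ∃[ n ] ¬ f n < x)
      supremum f f∈ =
        let x , x∈ , f<x = bounded
            c , f<c , min = minimal (λ x → ∀ n → f n < x) (x , f<x)
        in c , initial x∈ (λ x<c → min x x<c f<x) , f<c ,
           λ x x<c → decidable-stable (em _) λ none →
             min x x<c λ n → decidable-stable (em _) λ fn≮x → none (n , fn≮x)
        where
        bounded : ∃[ x ] D x × (∀ n → f n < x)
        bounded = decidable-stable (em _) λ none → noSeq (f , f∈ , λ x x∈ →
          decidable-stable (em _) λ none′ → none (x , x∈ , λ n →
            decidable-stable (em _) λ fn≮x → none′ (n , fn≮x)))

-- Sums over a well-order: Ramsey decomposition and reflection

module Blocks (d : ℕ) {a} ⦃ _ : EM 0ℓ ⦄ ⦃ _ : EM a ⦄ (W : StrictTotalOrder a a a) (B : Ordinal a)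
  (π : StrictTotalOrder.Carrier W → Ordinal.Carrier B)
  (π-cong : ∀ {x y} → StrictTotalOrder._≈_ W x y → Ordinal._≈_ B (π x) (π y))
  (π-mono : ∀ {x y} → StrictTotalOrder._<_ W x y → ¬ Ordinal._<_ B (π y) (π x)) where
  open import Data.Nat.Base using (zero; suc)

  open Types d
  open Semantics d
  open Ordinal B hiding (trans)
  open WellOrder B
  private
    module B = Ordinal B
    module W = StrictTotalOrder W

  π-reflects : ∀ {x y} → π x < π y → x W.< y
  π-reflects {x} {y} lt with W.compare x y
  ... | tri< x<y _ _ = x<y
  ... | tri≈ _ x≈y _ = contradiction lt (irrefl (π-cong x≈y))
  ... | tri> _ _ y<x = contradiction lt (π-mono y<x)

  -- The order `W` is regarded as the sum over `B` of the fibres of `π`, and cuts are made between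
  -- fibres only. The right end is an initial segment, so that bounded intervals and all of `W` are
  -- treated alike.
  from : Carrier → (Carrier → Set a) → W.Carrier → Set a
  from a D w = ¬ π w < a × D (π w)

  ⟦_,_⟧ : Carrier → Carrier → W.Carrier → Set a
  ⟦ a , b ⟧ = from a (_< b)

  fibre : Carrier → W.Carrier → Set a
  fibre i w = π w ≈ i

  from-split : ∀ {D a b} → Initial D → D b → ¬ b < a → Sum W (from a D) ⟦ a , b ⟧ (from b D)
  from-split {D} {a} {b} initial b∈ b≮a = record
    { split   = split
    ; left    = λ (πw≮a , πw<b) → πw≮a , initial b∈ (asym πw<b)
    ; right   = λ (πw≮b , πw∈) → ≮-trans b≮a πw≮b , πw∈
    ; ordered = λ (_ , πx<b) (πy≮b , _) → π-reflects (<-≤-trans πx<b πy≮b)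
    }
    where
    split : ∀ {w} → from a D w → ⟦ a , b ⟧ w ⊎ from b D w
    split {w} (πw≮a , πw∈) with em (π w < b)
    ... | yes πw<b = inj₁ (πw≮a , πw<b)
    ... | no πw≮b  = inj₂ (πw≮b , πw∈)

  module _ {χ : W.Carrier → Fin d} where

    tp-from-split : ∀ q {D a b} → Initial D → D b → ¬ b < a →
                    tp W q χ (from a D) ≡ tp W q χ ⟦ a , b ⟧ ∙ tp W q χ (from b D)
    tp-from-split q initial b∈ b≮a = tp-sum W q (from-split initial b∈ b≮a)

    tp-fibre : ∀ q {D m} → Initial D → D m → (∀ x → D x → ¬ m < x) → tp W q χ (from m D) ≡ tp W q χ (fibre m)
    tp-fibre q {D} {m} initial m∈ max = tp-≗ W q to
      (λ eq → irrefl eq , initial m∈ (irrefl (Eq.sym eq)))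
      where
      to : ∀ {w} → from m D w → fibre m w
      to {w} (πw≮m , πw∈) with ≮⇒<⊎≈ (max (π w) πw∈)
      ... | inj₁ πw<m = contradiction πw<m πw≮m
      ... | inj₂ eq   = eq

  blocks-ordered : ∀ {s} → Increasing s → Ordered W (λ n → ⟦ s n , s (suc n) ⟧)
  blocks-ordered {s} inc {m} {n} m<n (_ , πx<) (πy≮ , _) =
    π-reflects (<-≤-trans πx< (≮-trans (sm≤sn m<n) πy≮))
    where
    sm≤sn : m ℕ.< n → ¬ s n < s (suc m)
    sm≤sn m<n with ℕ.m≤n⇒m<n∨m≡n m<n
    ... | inj₁ lt   = asym (inc lt)
    ... | inj₂ refl = irrefl Eq.refl

  from⇒blocks : ∀ {D s} → Exhausts D s → ∀ {w} → from (s 0) D w → ∃[ n ] ⟦ s n , s (suc n) ⟧ w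
  from⇒blocks {D} {s} (_ , _ , cof) {w} (πw≮ , πw∈) = let n , lt = cof (π w) πw∈ in go n lt
    where
    go : ∀ n → π w < s n → ∃[ n ] ⟦ s n , s (suc n) ⟧ w
    go zero    lt = contradiction lt πw≮
    go (suc n) lt with em (π w < s n)
    ... | yes lt′ = go n lt′
    ... | no v≮c    = n , v≮c , lt

  blocks⇒from : ∀ {D s} → Initial D → Exhausts D s → ∀ {n w} → ⟦ s n , s (suc n) ⟧ w → from (s 0) D w
  blocks⇒from {D} {s} initial (s∈ , inc , _) {n} (πw≮ , πw<) = ≮-trans (s0≤sn n) πw≮ , initial (s∈ (suc n)) (asym πw<)
    where
    s0≤sn : ∀ n → ¬ s n < s 0
    s0≤sn zero    = irrefl Eq.refl
    s0≤sn (suc n) = asym (inc (s≤s z≤n))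

  tp-blocks : ∀ q {χ D s e} → Initial D → Exhausts D s → (∀ n → tp W q χ ⟦ s n , s (suc n) ⟧ ≡ e) →
              tp W q χ (from (s 0) D) ≡ e ^ω
  tp-blocks q {χ} {D} {s} {e} initial ex@(_ , inc , _) h = trans
    (tp-≗ W q {J = ⋃ W (λ n → ⟦ s n , s (suc n) ⟧)} (from⇒blocks ex) (λ (n , i) → blocks⇒from initial ex {n} i))
    (tp-⋃ W q (blocks-ordered inc) h)

  tp-ramsey : ∀ q χ {D s} → Initial D → Exhausts D s → ∃₂ λ i j → 0 ℕ.< i × i ℕ.< j ×
              tp W q χ (from (s 0) D) ≡ tp W q χ ⟦ s 0 , s i ⟧ ∙ tp W q χ ⟦ s i , s j ⟧ ^ω
  tp-ramsey q χ {D} {s} initial ex@(s∈ , inc , _)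
    with ramsey (Ty-finite q) (λ i j → tp W q χ ⟦ s i , s j ⟧)
  -- Index 1 and not 0 of the homogeneous subsequence, because `h 0` may be 0 and the first interval
  -- must not be empty.
  ... | e , h , h-inc , homogeneous = h 1 , h 2 , ℕ.≤-<-trans z≤n (h-inc 0) , h-inc 1 ,
    trans (tp-from-split q initial (s∈ (h 1)) (asym (inc (ℕ.≤-<-trans z≤n (h-inc 0)))))
      (cong (_ ∙_) (trans (tp-blocks q initial (exhausts-subsequence {h = h ∘ suc} ex (h-inc ∘ suc)) λ n → homogeneous (h′ n))
        (cong _^ω (sym (homogeneous (h′ 0))))))
    where
    h′ : ∀ n → suc n ℕ.< suc (suc n)
    h′ n = ℕ.n<1+n (suc n)

  -- Every initial segment without maximum and without cofinal ω-sequence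
  -- has a closed unbounded set of points c that cannot be told apart from
  -- its end.
  module Reflection (q : ℕ) (χ : W.Carrier → Fin d) {D : Carrier → Set a} (initial : Initial D)
                    (noMax : ¬ HasMaximum D) (noSeq : ¬ HasCofinalSequence D) where

    before : Carrier → W.Carrier → W.Carrier → Set a
    before c w v = ¬ π v < c × v W.< w

    after : W.Carrier → W.Carrier → Set a
    after w v = w W.< v × D (π v)

    Data : Carrier → W.Carrier → Ty q × Fin d × Ty q
    Data c w = tp W q χ (before c w) , χ w , tp W q χ (after w)

    -- A closure step as in the theorem of Löwenheim and Skolem: whatever a point from c on looks
    -- like, seen from c and from the end of `D`, some point between c and c′ looks the same.
    Absorbs : Carrier → Carrier → Set a
    Absorbs c c′ = ∀ w → ¬ π w < c → D (π w) → ∃[ w′ ] ¬ π w′ < c × π w′ < c′ × Data c w′ ≡ Data c w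

    -- There are finitely many triples, and one witness for each that occurs is enough. The
    -- witnesses have a common bound in `D`, which has no maximum.
    absorber : ∀ {c} → D c → ∃[ c′ ] D c′ × c < c′ × Absorbs c c′
    absorber {c} c∈ =
      let (x , x∈) , h = finite-bound {_≼_ = λ x y → ¬ proj₁ y < proj₁ x}
                           (λ (x , x∈) (y , y∈) → x ⊔ y , ⊔-∈ D x∈ y∈) (λ (x , _) (y , _) → x⊔y≮x x y)
                           (λ (x , _) (y , _) → x⊔y≮y x y) (c , c∈) (Triple-finite q) {Bound}
                           (λ b le w πw≮c πw∈ eq → let w′ , i , lt , eq′ = b w πw≮c πw∈ eq in w′ , i , <-≤-trans lt le , eq′)
                           bound
          y , y∈ , lt = greater initial noMax (⊔-∈ D c∈ x∈)
      in y , y∈ , ≤-<-trans (x⊔y≮x c x) lt , λ w πw≮c πw∈ →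
         let w′ , i , lt′ , eq = h (Data c w) w πw≮c πw∈ refl in
         w′ , i , B.trans (<-≤-trans lt′ (x⊔y≮y c x)) lt , eq
      where
      Bound : Ty q × Fin d × Ty q → ∃ D → Set a
      Bound t (x , _) = ∀ w → ¬ π w < c → D (π w) → Data c w ≡ t →
                        ∃[ w′ ] ¬ π w′ < c × π w′ < x × Data c w′ ≡ t
      bound : ∀ t → ∃ (Bound t)
      bound t with em (∃[ w ] ¬ π w < c × D (π w) × Data c w ≡ t)
      ... | no none = (c , c∈) , λ w πw≮c πw∈ eq → contradiction (w , πw≮c , πw∈ , eq) none
      ... | yes (w , πw≮c , πw∈ , eq) = let x , x∈ , lt = greater initial noMax πw∈ in
        (x , x∈) , λ _ _ _ _ → w , πw≮c , lt , eq

    Eventual : Carrier → (W.Carrier → Set a) → Set a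
    Eventual c U = ∀ w → ¬ π w < c → U w

    _∩π_ : (W.Carrier → Set a) → (Carrier → Set a) → W.Carrier → Set a
    (U ∩π E) w = U w × E (π w)

    tp-lower : ∀ {k n} {I J : W.Carrier → Set a} → k ℕ.≤′ n → tp W n χ I ≡ tp W n χ J → tp W k χ I ≡ tp W k χ J
    tp-lower ℕ.≤′-refl     eq = eq
    tp-lower (ℕ.≤′-step l) eq = tp-lower l (cong proj₁ eq)

    π-≤ : ∀ {x y} → x W.< y → ∀ {E} → Initial E → E (π y) → E (π x)
    π-≤ lt initial′ = λ h → initial′ h (π-mono lt)

    below-split : ∀ {E U c w} → Initial E → E (π w) → ¬ π w < c → Eventual c U →
                  Sum W (below W (U ∩π E) w) (U ∩π (_< c)) (before c w)
    below-split {E} {U} {c} {w} initial′ πw∈ πw≮c ev = record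
      { split   = split
      ; left    = λ (u , lt) → let v<w = π-reflects (<-≤-trans lt πw≮c) in (u , π-≤ v<w initial′ πw∈) , v<w
      ; right   = λ (v≮c , v<w) → (ev _ v≮c , π-≤ v<w initial′ πw∈) , v<w
      ; ordered = λ (_ , lt) (v≮c , _) → π-reflects (<-≤-trans lt v≮c)
      }
      where
      split : ∀ {v} → below W (U ∩π E) w v → (U ∩π (_< c)) v ⊎ before c w v
      split {v} ((u , _) , v<w) with em (π v < c)
      ... | yes lt = inj₁ (u , lt)
      ... | no v≮c   = inj₂ (v≮c , v<w)

    module Limit {y : ℕ → Carrier} (y-inc : Increasing y) (y-absorbs : ∀ n → Absorbs (y n) (y (suc n)))
                 {c} (c∈ : D c) (y<c : ∀ n → y n < c) (cof : ∀ x → x < c → ∃[ n ] ¬ y n < x) where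

      c⊆D : ∀ {x} → x < c → D x
      c⊆D lt = initial c∈ (asym lt)

      -- Induction on the rank. Intervals alone would not do for U: naming a point w replaces U by
      -- its part above w, which again contains everything from a later `y m` on.
      reflects-tp : ∀ k → k ℕ.≤ q → ∀ {U n} → Eventual (y n) U →
                    tp W k χ (U ∩π (_< c)) ≡ tp W k χ (U ∩π D)
      reflects-tp zero    _ _ = refl
      reflects-tp (suc k) k<q {U} {n} ev = cong₂ _,_ (reflects-tp k k≤q ev) (ℙ-ext
        (λ t h → triples⁺ W (to t (triples⁻ W h)))
        (λ t h → triples⁺ W (back t (triples⁻ W h))))
        where
        k≤q : k ℕ.≤ q
        k≤q = ℕ.<⇒≤ k<q

        same-below : ∀ {w} → π w < c → tp W k χ (below W (U ∩π (_< c)) w) ≡ tp W k χ (below W (U ∩π D) w)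
        same-below lt = tp-≗ W k (λ ((u , v<c) , v<w) → (u , c⊆D v<c) , v<w)
          (λ ((u , _) , v<w) → (u , π-≤ v<w (<-initial c) lt) , v<w)

        same-above : ∀ {w} → π w < c → tp W k χ (above W (U ∩π (_< c)) w) ≡ tp W k χ (above W (U ∩π D) w)
        same-above {w} lt = let m , v≮c = cof (π w) lt in trans
          (tp-≗ W k (λ ((u , e) , l) → (u , l) , e) (λ ((u , l) , e) → (u , e) , l))
          -- From this index on, points lie beyond both `y n`, so that they belong to U, and w.
          (trans (reflects-tp k k≤q {λ v → U v × w W.< v} {suc (m ℕ.⊔ n)} (λ v v≮ →
            ev v (≮-trans (asym (y-inc (s≤s (ℕ.m≤n⊔m m n)))) v≮) ,
            π-reflects (≤-<-trans v≮c (<-≤-trans (y-inc (s≤s (ℕ.m≤m⊔n m n))) v≮))))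
          (tp-≗ W k (λ ((u , l) , e) → (u , e) , l) (λ ((u , e) , l) → (u , l) , e)))

        to : ∀ t → Realised W k χ (U ∩π (_< c)) t → Realised W k χ (U ∩π D) t
        to _ (w , (u , lt) , refl , refl , refl) =
          w , (u , c⊆D lt) , refl , sym (same-below lt) , sym (same-above lt)

        after-eq : ∀ {w} → ¬ π w < y n → tp W k χ (above W (U ∩π D) w) ≡ tp W k χ (after w)
        after-eq v≮c = tp-≗ W k (λ ((_ , e) , l) → l , e)
          (λ (l , e) → (ev _ (λ lt → π-mono l (<-≤-trans lt v≮c)) , e) , l)

        back : ∀ t → Realised W k χ (U ∩π D) t → Realised W k χ (U ∩π (_< c)) t
        back _ (w , (u , πw∈) , refl , refl , refl) with em (π w < c)
        ... | yes lt = w , (u , lt) , refl , same-below lt , same-above lt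
        ... | no πw≮c =
          -- A point not below c is replaced by an absorbed copy below `y (suc n)`. Before `y n`
          -- both have the same part of U, and from there on their data agree.
          let w≮ : ¬ π w < y n
              w≮ = λ lt → πw≮c (B.trans lt (y<c n))
              w′ , w′≮ , w′< , eq = y-absorbs n w w≮ πw∈
              w′<c : π w′ < c
              w′<c = B.trans w′< (y<c (suc n))
          in w′ , (ev w′ w′≮ , w′<c) , cong (proj₁ ∘ proj₂) eq ,
             trans (tp-sum W k (below-split (<-initial c) w′<c w′≮ ev))
               (trans (cong (_ ∙_) (tp-lower (ℕ.≤⇒≤′ k≤q) (cong proj₁ eq)))
                 (sym (tp-sum W k (below-split initial πw∈ w≮ ev)))) ,
             trans (same-above w′<c) (trans (after-eq w′≮)
               (trans (tp-lower (ℕ.≤⇒≤′ k≤q) (cong (proj₂ ∘ proj₂) eq)) (sym (after-eq w≮))))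

    Reflecting : Carrier → Set (lsuc a)
    Reflecting c = ∀ {x U} → x < c → Eventual x U → tp W q χ (U ∩π (_< c)) ≡ tp W q χ (U ∩π D)

    limit-reflecting : ∀ {y c} → Increasing y → (∀ n → Absorbs (y n) (y (suc n))) → D c →
                       (∀ n → y n < c) → (∀ x → x < c → ∃[ n ] ¬ y n < x) → Reflecting c
    limit-reflecting y-inc y-absorbs c∈ y<c cof {x} x<c ev = let n , v≮c = cof x x<c in
      Limit.reflects-tp y-inc y-absorbs c∈ y<c cof q ℕ.≤-refl {n = n} (λ w w≮ → ev w (≮-trans v≮c w≮))

    module _ {c₀ : Carrier} (c₀∈ : D c₀) where

      private
        absorbers : ℕ → ∃ D
        absorbers zero    = c₀ , c₀∈
        absorbers (suc n) = let y , y∈ , _ = absorber (proj₂ (absorbers n)) in y , y∈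

      -- The supremum of infinitely many absorbers. `Absorbs c₀ c` is recorded as well, because
      -- suprema of sequences of such points must be reflecting in their turn.
      reflecting : ∃[ c ] D c × c₀ < c × Absorbs c₀ c × Reflecting c
      reflecting =
        let c , c∈ , y<c , cof = supremum initial noMax noSeq (proj₁ ∘ absorbers) (proj₂ ∘ absorbers)
            step = λ n → proj₂ (proj₂ (absorber (proj₂ (absorbers n))))
        in c , c∈ , y<c 0 ,
           (λ w w≮ w∈ → let w′ , i , lt , eq = proj₂ (step 0) w w≮ w∈ in w′ , i , B.trans lt (y<c 1) , eq) ,
           limit-reflecting (increasing (proj₁ ∘ step)) (proj₂ ∘ step) c∈ y<c cof

    module _ {a₀ : Carrier} (a₀∈ : D a₀) where

      private
        reflectors : ℕ → ∃ D
        reflectors zero    = a₀ , a₀∈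
        reflectors (suc n) = let c , c∈ , _ = reflecting (proj₂ (reflectors n)) in c , c∈

        z : ℕ → Carrier
        z = proj₁ ∘ reflectors

        z-inc : Increasing z
        z-inc = increasing (λ n → proj₁ (proj₂ (proj₂ (reflecting (proj₂ (reflectors n))))))

        z-absorbs : ∀ n → Absorbs (z n) (z (suc n))
        z-absorbs n = proj₁ (proj₂ (proj₂ (proj₂ (reflecting (proj₂ (reflectors n))))))

        z-reflecting : ∀ n → Reflecting (z (suc n))
        z-reflecting n = proj₂ (proj₂ (proj₂ (proj₂ (reflecting (proj₂ (reflectors n))))))

      abstract
        -- Among reflecting points z n, a subsequence is chosen whose final parts `from (z n) D`
        -- have one type e. By reflection the intervals between its members have type e too, so e =
        -- e e. The supremum c of all z n is again reflecting: the interval from `z (h 1)` to c has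
        -- type e like the final part, and type e^ω as an ω-sum.
        reflection : ∃₂ λ c₀ c₁ → a₀ < c₀ × c₀ < c₁ × D c₁ × (let e = tp W q χ ⟦ c₀ , c₁ ⟧ in
                     e ∙ e ≡ e × e ^ω ≡ e × tp W q χ (from c₀ D) ≡ e)
        reflection with constant-subsequence (Ty-finite q) (λ n → tp W q χ (from (z n) D))
                      | supremum initial noMax noSeq z (proj₂ ∘ reflectors)
        ... | e , h , h-inc , same | c , c∈ , z<c , cof =
          y 0 , y 1 , z-inc (ℕ.≤-<-trans z≤n (h-inc 0)) , y-inc (ℕ.n<1+n 0) , proj₂ (reflectors (h 2)) ,
          trans (cong₂ _∙_ (tp-y 0) (tp-y 0)) (trans (sym ee) (sym (tp-y 0))) ,
          trans (cong _^ω (tp-y 0)) (trans eω (sym (tp-y 0))) ,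
          trans (same 1) (sym (tp-y 0))
          where
          y : ℕ → Carrier
          -- The start is `h 1` because `h 0` may be 0, and `z 0` is a₀ itself.
          y = z ∘ h ∘ suc

          y-inc : Increasing y
          y-inc = z-inc ∘ strictlyIncreasing-< {h ∘ suc} (h-inc ∘ suc)

          segment : ∀ {b} → Reflecting b → ∀ n → z n < b → tp W q χ ⟦ z n , b ⟧ ≡ tp W q χ (from (z n) D)
          segment r n lt = r lt (λ w w≮ → w≮)

          reflecting-above : ∀ {m n} → m ℕ.< n → Reflecting (z n)
          reflecting-above {n = suc n} _ = z-reflecting n

          tp-y : ∀ n → tp W q χ ⟦ y n , y (suc n) ⟧ ≡ e
          tp-y n = trans (segment (reflecting-above (h-inc (suc n))) (h (suc n)) (y-inc (ℕ.n<1+n n))) (same (suc n))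

          ee : e ≡ e ∙ e
          ee = trans (sym (same 1)) (trans
            (tp-from-split q initial (proj₂ (reflectors (h 2))) (asym (y-inc (ℕ.n<1+n 0))))
            (cong₂ _∙_ (tp-y 0) (same 2)))

          exhausts : Exhausts (_< c) z
          exhausts = z<c , z-inc , λ x x<c → let n , v≮c = cof x x<c in suc n , ≤-<-trans v≮c (z-inc (ℕ.n<1+n n))

          eω : e ^ω ≡ e
          eω = trans (sym (tp-blocks q (<-initial c) (exhausts-subsequence {h = h ∘ suc} exhausts (h-inc ∘ suc)) tp-y))
            (trans (segment (limit-reflecting z-inc z-absorbs c∈ z<c cof) (h 1) (z<c (h 1))) (same 1))

-- Gluing colourings

module Attained (d : ℕ) where
  open import Data.Nat.Base using (zero; suc)
  open Types d
  open Semantics d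

  Colouring : ∀ {a} → StrictTotalOrder a a a → Set a
  Colouring O = Σ (Carrier → Fin d) λ χ → ∀ {x y} → x ≈ y → χ x ≡ χ y
    where open StrictTotalOrder O

  module _ {a} ⦃ _ : EM a ⦄ (O : StrictTotalOrder a a a) where
    open StrictTotalOrder O hiding (trans)

    Attains : ∀ q → (Carrier → Set a) → Ty q → Set a
    Attains q I t = Σ (Colouring O) λ (χ , _) → tp O q χ I ≡ t

    Closed≈ : (Carrier → Set a) → Set a
    Closed≈ I = ∀ {x y} → x ≈ y → I x → I y

    attains-sum : ∀ q {K I J t u} → Sum O K I J → Closed≈ I → Attains q I t → Attains q J u →
                  Attains q K (t ∙ u)
    attains-sum q {K} {I} {J} s I≈ ((χ₁ , cong₁) , refl) ((χ₂ , cong₂′) , refl) =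
      (χ , χ-cong) , trans (tp-sum O q s) (cong₂ _∙_
        (tp-cong O q id id χ-left) (tp-cong O q id id χ-right))
      where
      χ : Carrier → Fin d
      χ x with em (I x)
      ... | yes _ = χ₁ x
      ... | no _  = χ₂ x

      χ-left : ∀ {x} → I x → χ x ≡ χ₁ x
      χ-left {x} i with em (I x)
      ... | yes _ = refl
      ... | no ¬i = contradiction i ¬i

      χ-right : ∀ {x} → J x → χ x ≡ χ₂ x
      χ-right {x} j with em (I x)
      ... | yes i = contradiction (Sum.ordered s i j) (irrefl Eq.refl)
      ... | no _  = refl

      χ-cong : ∀ {x y} → x ≈ y → χ x ≡ χ y
      χ-cong {x} {y} x≈y with em (I x) | em (I y)
      ... | yes _ | yes _ = cong₁ x≈y
      ... | no _  | no _  = cong₂′ x≈y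
      ... | yes i | no ¬i = contradiction (I≈ x≈y i) ¬i
      ... | no ¬i | yes i = contradiction (I≈ (Eq.sym x≈y) i) ¬i

    attains-≗ : ∀ q {I J t} → (∀ {x} → I x → J x) → (∀ {x} → J x → I x) → Attains q I t → Attains q J t
    attains-≗ q f g (χ , eq) = χ , trans (tp-≗ O q g f) eq

    attains-⋃ : ∀ q {I t} ⦃ _ : EM 0ℓ ⦄ → Ordered O I → (∀ n → Closed≈ (I n)) → (∀ n → Attains q (I n) t) →
                Attains q (⋃ O I) (t ^ω)
    attains-⋃ q {I} {t} o I≈ h = (χ , χ-cong) ,
      tp-⋃ O q o (λ n → trans (tp-cong O q id id (χ-on n)) (proj₂ (h n)))
      where
      χ : Carrier → Fin d
      χ x with em (⋃ O I x)
      ... | yes (n , _) = proj₁ (proj₁ (h n)) x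
      ... | no _        = proj₁ (proj₁ (h 0)) x

      unique : ∀ {m n x} → I m x → I n x → m ≡ n
      unique {m} {n} i j with ℕ.<-cmp m n
      ... | tri< m<n _ _ = contradiction (o m<n i j) (irrefl Eq.refl)
      ... | tri≈ _ eq _  = eq
      ... | tri> _ _ n<m = contradiction (o n<m j i) (irrefl Eq.refl)

      χ-on : ∀ n {x} → I n x → χ x ≡ proj₁ (proj₁ (h n)) x
      χ-on n {x} i with em (⋃ O I x)
      ... | yes (m , j) = cong (λ n → proj₁ (proj₁ (h n)) x) (unique j i)
      ... | no none     = contradiction (n , i) none

      χ-cong : ∀ {x y} → x ≈ y → χ x ≡ χ y
      χ-cong {x} {y} x≈y with em (⋃ O I x) | em (⋃ O I y)
      ... | yes (m , i) | yes (n , j) = trans (proj₂ (proj₁ (h m)) x≈y)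
              (cong (λ n → proj₁ (proj₁ (h n)) y) (unique (I≈ m x≈y i) j))
      ... | yes (m , i) | no none     = contradiction (m , I≈ m x≈y i) none
      ... | no none     | yes (n , j) = contradiction (n , I≈ n (Eq.sym x≈y) j) none
      ... | no _        | no _        = proj₂ (proj₁ (h 0)) x≈y

-- The types of sums over a well-order

module BlockTypes (d : ℕ) {a} ⦃ _ : EM 0ℓ ⦄ ⦃ _ : EM a ⦄ (W : StrictTotalOrder a a a) (B : Ordinal a)
  (π : StrictTotalOrder.Carrier W → Ordinal.Carrier B)
  (π-cong : ∀ {x y} → StrictTotalOrder._≈_ W x y → Ordinal._≈_ B (π x) (π y))
  (π-mono : ∀ {x y} → StrictTotalOrder._<_ W x y → ¬ Ordinal._<_ B (π y) (π x)) where
  open import Data.Nat.Base using (zero; suc)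

  open Types d
  open Semantics d
  open Attained d
  open Algebra d
  open Ordinal B hiding (trans)
  open WellOrder B
  open Blocks d W B π π-cong π-mono
  private
    module B = Ordinal B
    module W = StrictTotalOrder W

  -- Induction on the right end. With a last fibre, the interval is at most a shorter one followed
  -- by that fibre. With a cofinal ω-sequence, Ramsey's theorem gives t u^ω for types t, u of
  -- shorter intervals. Otherwise reflection gives the final part the type of an interval that ends
  -- earlier. So closure under products and ω-powers is enough for sums of any length.
  module _ (q : ℕ) (χ : W.Carrier → Fin d) {S : Ty q → Set}
           (S-∙ : ∀ {t u} → S t → S u → S (t ∙ u)) (S-ω : ∀ {t} → S t → S (t ^ω))
           (S-fibre : ∀ i → S (tp W q χ (fibre i))) where

    private
      module _ {D} (initial : Initial D) (IH : ∀ {b} → D b → ∀ {a} → a < b → S (tp W q χ ⟦ a , b ⟧)) where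

        extend : ∀ {a b} → D b → a < b → S (tp W q χ (from b D)) → S (tp W q χ (from a D))
        extend {a} {b} b∈ a<b h = subst S (sym (tp-from-split q {D} {a} {b} initial b∈ (asym a<b))) (S-∙ (IH b∈ a<b) h)

        step-max : ∀ {a m} → D m → (∀ x → D x → ¬ m < x) → a < m ⊎ a ≈ m → D a → S (tp W q χ (from a D))
        step-max {m = m} m∈ max (inj₁ a<m) a∈ =
          extend m∈ a<m (subst S (sym (tp-fibre q {D} {m} initial m∈ max)) (S-fibre m))
        step-max {a} {m} m∈ max (inj₂ a≈m) a∈ =
          subst S (sym (tp-fibre q {D} {a} initial a∈ (λ x x∈ lt → max x x∈ (<-respˡ-≈ a≈m lt)))) (S-fibre a)

        step-sequence : ∀ {s} → Exhausts D s → S (tp W q χ (from (s 0) D))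
        step-sequence {s} ex@(s∈ , inc , _) =
          let i , j , 0<i , i<j , eq = tp-ramsey q χ {D} {s} initial ex in
          subst S (sym eq) (S-∙ (IH (s∈ i) (inc 0<i)) (S-ω (IH (s∈ j) (inc i<j))))

        step-reflection : ¬ HasMaximum D → ¬ HasCofinalSequence D → ∀ {a} → D a → S (tp W q χ (from a D))
        step-reflection noMax noSeq a∈ =
          let c₀ , c₁ , a<c₀ , c₀<c₁ , c₁∈ , _ , _ , eq = Reflection.reflection q χ initial noMax noSeq a∈ in
          extend (initial c₁∈ (asym c₀<c₁)) a<c₀ (subst S (sym eq) (IH c₁∈ c₀<c₁))

        step : ∀ {a} → D a → S (tp W q χ (from a D))
        step {a} a∈ with em (HasMaximum D)
        ... | yes (m , m∈ , max) = step-max m∈ max (≮⇒<⊎≈ (max a a∈)) a∈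
        ... | no noMax with em (HasCofinalSequence D)
        ...   | no noSeq = step-reflection noMax noSeq a∈
        ...   | yes seq  = let s , s0 , ex , _ = exhaustion initial noMax seq a a∈ in
          subst (λ b → S (tp W q χ (from b D))) s0 (step-sequence ex)

      closed-interval : ∀ {b} → Acc _<_ b → ∀ {a} → a < b → S (tp W q χ ⟦ a , b ⟧)
      closed-interval {b} (acc rec) = step (<-initial b) (λ c<b → closed-interval (rec c<b))

    closed-from : ∀ {D} → Initial D → ∀ {a} → D a → S (tp W q χ (from a D))
    closed-from initial = step initial (λ {b} _ → closed-interval (wellFounded b))

    closed-segment : ∀ {a b} → a < b → S (tp W q χ ⟦ a , b ⟧)
    closed-segment {b = b} = closed-interval (wellFounded b)

  from-closed≈ : ∀ {D a} → Initial D → Closed≈ W (from a D)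
  from-closed≈ initial x≈y (πx≮ , πx∈) =
    (λ lt → πx≮ (<-respˡ-≈ (Eq.sym (π-cong x≈y)) lt)) , initial πx∈ (irrefl (π-cong x≈y))

  attains-split : ∀ q {D a b t u} → Initial D → D b → ¬ b < a →
                  Attains W q ⟦ a , b ⟧ t → Attains W q (from b D) u → Attains W q (from a D) (t ∙ u)
  attains-split q {b = b} initial b∈ b≮a = attains-sum W q (from-split initial b∈ b≮a) (from-closed≈ (<-initial b))

  attains-blocks : ∀ q {D s t} → Initial D → Exhausts D s → (∀ n → Attains W q ⟦ s n , s (suc n) ⟧ t) →
                   Attains W q (from (s 0) D) (t ^ω)
  attains-blocks q {D} {s} initial ex@(_ , inc , _) h = attains-≗ W q
    (λ (n , i) → blocks⇒from initial ex {n} i) (from⇒blocks ex)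
    (attains-⋃ W q {λ n → ⟦ s n , s (suc n) ⟧} (blocks-ordered inc) (λ n → from-closed≈ (<-initial (s (suc n)))) h)

  -- `fibre⁺` asks for one colouring with the same type on all fibres at once. The fibres will be
  -- copies of a single order.
  module _ {q : ℕ} {X : Tys q}
           (fibre⁻ : ∀ ((χ , _) : Colouring W) i → X ∋ tp W q χ (fibre i))
           (fibre⁺ : ∀ {t} → X ∋ t → Σ (Colouring W) λ (χ , _) → ∀ i → tp W q χ (fibre i) ≡ t) where

    attains-fibre : ∀ {D m t} → Initial D → D m → (∀ x → D x → ¬ m < x) → X ∋ t → Attains W q (from m D) t
    attains-fibre {m = m} initial m∈ max t∈ = let χ , h = fibre⁺ t∈ in
      χ , trans (tp-fibre q initial m∈ max) (h m)

    module _ {D s} (initial : Initial D) (ex : Exhausts D s) (succ : ∀ n z → z < s (suc n) → ¬ s n < z) where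

      private
        s∈ = proj₁ ex
        inc = proj₁ (proj₂ ex)

        s-≤ : ∀ k i → ¬ s (k ℕ.+ i) < s i
        s-≤ zero    i = irrefl Eq.refl
        s-≤ (suc k) i = asym (inc (s≤s (ℕ.m≤n+m i k)))

        s-split : ∀ k i → s (suc i) < s (suc (suc k ℕ.+ i)) × ¬ s (suc i) < s i
        s-split k i = inc (s≤s (s≤s (ℕ.m≤n+m i k))) , asym (inc (ℕ.n<1+n i))

        tp-one : ∀ χ i → tp W q χ ⟦ s i , s (suc i) ⟧ ≡ tp W q χ (fibre (s i))
        tp-one χ i = tp-fibre q (<-initial _) (inc (ℕ.n<1+n i)) (succ i)

        empty : ∀ {χ} b → tp W q χ ⟦ b , b ⟧ ≡ ε
        empty b = tp-empty W q (λ w (≮b , <b) → ≮b <b)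

        segment-star : ∀ ((χ , _) : Colouring W) k i → star X ∋ tp W q χ ⟦ s i , s (k ℕ.+ i) ⟧
        segment-plus : ∀ ((χ , _) : Colouring W) k i → plus X ∋ tp W q χ ⟦ s i , s (suc k ℕ.+ i) ⟧

        segment-star χ zero    i = subst (star X ∋_) (sym (empty (s i))) (star-[] X)
        segment-star χ (suc k) i = plus⇒star X (segment-plus χ k i)

        segment-plus χ zero i = subst (plus X ∋_) (sym (tp-one (proj₁ χ) i)) (plus-unit X (fibre⁻ χ (s i)))
        segment-plus χ (suc k) i = subst (plus X ∋_)
          (sym (trans (tp-from-split q (<-initial _) (proj₁ (s-split k i)) (proj₂ (s-split k i)))
            (cong (_∙ tp W q (proj₁ χ) ⟦ s (suc i) , s (suc (suc k ℕ.+ i)) ⟧) (tp-one (proj₁ χ) i))))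
          (⊗⁺ X (star X) (fibre⁻ χ (s i)) (subst (λ n → star X ∋ tp W q (proj₁ χ) ⟦ s (suc i) , s n ⟧)
            (cong suc (ℕ.+-suc k i)) (segment-star χ (suc k) (suc i))))

        -- The length k must not depend on i, as the same word is laid out at infinitely many places
        -- of the sequence.
        attains-plus : ∀ {x t} → X ∋ x → Star (X ∋_) t → ∃[ k ] ∀ i → Attains W q ⟦ s i , s (suc k ℕ.+ i) ⟧ (x ∙ t)
        attains-plus {x} x∈ [] = 0 , λ i → subst (Attains W q _) (sym (ε-identityʳ x))
          (attains-fibre (<-initial _) (inc (ℕ.n<1+n i)) (succ i) x∈)
        attains-plus x∈ (_∷_ {y} {u} y∈ t) with attains-plus y∈ t
        ... | k , h = suc k , λ i → attains-split q (<-initial _) (proj₁ (s-split k i)) (proj₂ (s-split k i))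
          (attains-fibre (<-initial _) (inc (ℕ.n<1+n i)) (succ i) x∈)
          (subst (λ n → Attains W q ⟦ s (suc i) , s n ⟧ (y ∙ u)) (cong suc (ℕ.+-suc k i)) (h (suc i)))

        attains-star : Colouring W → ∀ {t} → Star (X ∋_) t → ∃[ k ] ∀ i → Attains W q ⟦ s i , s (k ℕ.+ i) ⟧ t
        attains-star χ []       = 0 , λ i → χ , empty (s i)
        attains-star χ (x∈ ∷ t) = let k , h = attains-plus x∈ t in suc k , h

      ωSums-tp : ∀ ((χ , _) : Colouring W) → ωSums X ∋ tp W q χ (from (s 0) D)
      ωSums-tp χ = let i , j , _ , i<j , eq = tp-ramsey q (proj₁ χ) {D} {s} initial ex in
        subst (ωSums X ∋_) (sym eq) (ωSums⁺ X
        (subst (λ n → star X ∋ tp W q (proj₁ χ) ⟦ s 0 , s n ⟧) (ℕ.+-identityʳ i) (segment-star χ i 0))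
        (subst (λ n → plus X ∋ tp W q (proj₁ χ) ⟦ s i , s n ⟧)
          (trans (sym (ℕ.+-suc (j ℕ.∸ suc i) i)) (ℕ.m∸n+n≡m i<j)) (segment-plus χ (j ℕ.∸ suc i) i)))

      private
        module _ {u e : Ty q} {k m : ℕ} (h : ∀ i → Attains W q ⟦ s i , s (k ℕ.+ i) ⟧ u)
                 (g : ∀ i → Attains W q ⟦ s i , s (suc m ℕ.+ i) ⟧ e) where

          r : ℕ → ℕ
          -- The index at which copy n of the period starts, after a prefix of k fibres; `k ℕ.+ 0`
          -- is the form in which `h 0` states the end of the prefix.
          r n = n ℕ.* suc m ℕ.+ (k ℕ.+ 0)

          r-inc : StrictlyIncreasing r
          r-inc n = ℕ.+-monoˡ-< (k ℕ.+ 0) (s≤s (ℕ.m≤n+m (n ℕ.* suc m) m))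

          attains-ultimately-constant : Attains W q (from (s 0) D) (u ∙ e ^ω)
          attains-ultimately-constant = attains-split q initial (s∈ (k ℕ.+ 0)) (s-≤ k 0) (h 0)
            (attains-blocks q initial (exhausts-subsequence {h = r} ex r-inc)
              (λ n → subst (λ n′ → Attains W q ⟦ s (r n) , s n′ ⟧ e)
                (sym (ℕ.+-assoc (suc m) (n ℕ.* suc m) (k ℕ.+ 0))) (g (r n))))

      ωSums-attains : ∀ {t} → ωSums X ∋ t → Attains W q (from (s 0) D) t
      ωSums-attains {t} t∈ =
        let u , e , u∈ , e∈ , t≡ = ωSums⁻ X t∈
            x , v , x∈ , v∈ , e≡ = ⊗⁻ X (star X) e∈
            k , h = attains-star (proj₁ (fibre⁺ x∈)) (star⁻ X u∈)
            m , g = attains-plus x∈ (star⁻ X v∈)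
        in subst (Attains W q (from (s 0) D)) (trans (cong (λ e → u ∙ e ^ω) (sym e≡)) (sym t≡))
             (attains-ultimately-constant {k = k} {m} h g)

    module _ (XX : X ⊗ X ≡ X) (Xω : X ≡ ωSums X) where

      private
        ω∈ : ∀ {t} → X ∋ t → X ∋ t ^ω
        ω∈ {t} t∈ = subst (X ∋_) (ω-absorb t) (subst (_∋ _) (sym Xω) (idempotent-ωSums⁺ XX t∈ t∈))

        uncountable⊆ : ∀ {t} → uncountableCofinality X ∋ t → X ∋ t
        uncountable⊆ t∈ = let _ , _ , s∈ , e∈ , _ , t≡ = uncountable⁻ X t∈ in
          subst (X ∋_) (sym t≡) (idempotent-∙ XX s∈ e∈)

        in-interval : ∀ ((χ , _) : Colouring W) {a b} → a < b → X ∋ tp W q χ ⟦ a , b ⟧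
        in-interval χ = closed-segment q (proj₁ χ) {X ∋_} (idempotent-∙ XX) ω∈ (fibre⁻ χ)

      limit-tp : ∀ ((χ , _) : Colouring W) {D} → Initial D → ∀ {a} → D a → X ∋ tp W q χ (from a D)
      limit-tp χ = closed-from q (proj₁ χ) {X ∋_} (idempotent-∙ XX) ω∈ (fibre⁻ χ)

      uncountable-tp : ∀ ((χ , _) : Colouring W) {D} → Initial D → ¬ HasMaximum D → ¬ HasCofinalSequence D →
                       ∀ {a} → D a → uncountableCofinality X ∋ tp W q χ (from a D)
      uncountable-tp χ initial noMax noSeq {b} b∈ =
        let c₀ , c₁ , b<c₀ , c₀<c₁ , c₁∈ , ee , eω , eq = Reflection.reflection q (proj₁ χ) initial noMax noSeq b∈
            c₀∈ = initial c₁∈ (asym c₀<c₁)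
        in subst (uncountableCofinality X ∋_)
             (sym (trans (tp-from-split q initial c₀∈ (asym b<c₀)) (cong (tp W q (proj₁ χ) ⟦ b , c₀ ⟧ ∙_) eq)))
             (uncountable⁺ X (in-interval χ b<c₀) (in-interval χ c₀<c₁) (ee , eω))

      -- Both clauses are proved in one induction. `uncountable` is claimed whatever the cofinality
      -- of `D`, because it is applied to the part before a maximum, about whose cofinality nothing
      -- is known.
      record Attainable (D : Carrier → Set a) (b : Carrier) : Set a where
        field
          uncountable : ∀ {t} → uncountableCofinality X ∋ t → Attains W q (from b D) t
          limit       : HasMaximum D ⊎ HasCofinalSequence D → ∀ {t} → X ∋ t → Attains W q (from b D) t

      open Attainable

      private
        module _ {D} (initial : Initial D) (IH : ∀ {b} → D b → ∀ {a} → a < b → Attainable (_< b) a) {a} (a∈ : D a) where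

          -- By `uncountable-⊗`, t = u v with v in `X` for the last fibre and u a type that the part
          -- before it attains for any cofinality.
          attains-max : ∀ {m} → D m → (∀ x → D x → ¬ m < x) → a < m ⊎ a ≈ m → ∀ {t} → X ∋ t → Attains W q (from a D) t
          attains-max m∈ max (inj₂ a≈m) t∈ = attains-fibre initial a∈ (λ x x∈ lt → max x x∈ (<-respˡ-≈ a≈m lt)) t∈
          attains-max m∈ max (inj₁ a<m) t∈ =
            let u , v , u∈ , v∈ , t≡ = ⊗⁻ (uncountableCofinality X) X (uncountable-⊗ XX Xω t∈) in
            subst (Attains W q (from a D)) (sym t≡) (attains-split q initial m∈ (asym a<m)
              (uncountable (IH m∈ a<m) u∈) (attains-fibre initial m∈ max v∈))

          limit-max : HasMaximum D → ∀ {t} → X ∋ t → Attains W q (from a D) t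
          limit-max (m , m∈ , max) = attains-max m∈ max (≮⇒<⊎≈ (max a a∈))

          -- Write t = u e^ω. The blocks have to attain u and e, which are arbitrary in `X`; they do
          -- so by the inductive hypothesis, since `exhaustion` makes each end with a maximum.
          limit-sequence : ¬ HasMaximum D → HasCofinalSequence D → ∀ {t} → X ∋ t → Attains W q (from a D) t
          limit-sequence noMax seq {t} t∈ =
            let s , s0 , ex@(s∈ , inc , _) , succ = exhaustion initial noMax seq a a∈
                u , e , u∈ , e∈ , t≡ = idempotent-ωSums⁻ XX (subst (_∋ t) Xω t∈)
                block = λ n {t} → limit (IH (s∈ (suc n)) (inc (ℕ.n<1+n n))) (inj₁ (succ n)) {t}
            in subst₂ (λ b → Attains W q (from b D)) s0 (sym t≡)
                 (attains-split q initial (s∈ 1) (asym (inc (ℕ.n<1+n 0))) (block 0 u∈)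
                   (attains-blocks q initial (exhausts-subsequence {h = suc} ex (λ n → ℕ.n<1+n (suc n)))
                     (λ n → block (suc n) e∈)))

          -- For t = u e, the fibre of the first point gets type u and all later fibres get type e.
          -- As e is fixed, the later fibres together have type e, whatever their number.
          uncountable-case : ¬ HasMaximum D → ∀ {t} → uncountableCofinality X ∋ t → Attains W q (from a D) t
          uncountable-case noMax t∈ =
            let y , y∈ , a<y , succ = successor initial noMax a∈
                u , e , u∈ , e∈ , (ee , eω) , t≡ = uncountable⁻ X t∈
                χ , h = fibre⁺ e∈
            in subst (Attains W q (from a D)) (sym t≡)
                 (attains-split q initial y∈ (asym a<y) (attains-fibre (<-initial y) a<y succ u∈)
                   (χ , closed-from q (proj₁ χ) {_≡ e} (λ t≡e u≡e → trans (cong₂ _∙_ t≡e u≡e) ee)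
                          (λ t≡e → trans (cong _^ω t≡e) eω) h initial y∈))

          realises : Attainable D a
          realises .limit (inj₁ max) = limit-max max
          -- A segment with a maximum also has a cofinal sequence, so the two cases overlap.
          realises .limit (inj₂ seq) with em (HasMaximum D)
          ... | yes max  = limit-max max
          ... | no noMax = limit-sequence noMax seq
          realises .uncountable t∈ with em (HasMaximum D)
          ... | yes max  = limit-max max (uncountable⊆ t∈)
          ... | no noMax = uncountable-case noMax t∈

        realises-< : ∀ {b} → Acc _<_ b → ∀ {a} → a < b → Attainable (_< b) a
        realises-< {b} (acc rec) = realises (<-initial b) (λ c<b → realises-< (rec c<b))

      realises-from : ∀ {D} → Initial D → ∀ {a} → D a → Attainable D a
      realises-from initial = realises initial (λ {b} _ → realises-< (wellFounded b))

-- Ordinal arithmetic and the types of colourings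

module Ordinals where
  open import Data.List.Base using (List; []; _∷_; _++_; map)
  open import Data.List.NonEmpty.Base using (_∷_)
  open import Data.List.Relation.Binary.Lex.Core using (Lex-<; base; halt; this; next)
  open import Data.List.Relation.Binary.Pointwise as Pointwise using (Pointwise; []; _∷_)
  open import Data.List.Relation.Unary.All using (All; []; _∷_)
  open import Data.List.Relation.Unary.Linked as Linked using (Linked; []; [-]; _∷_)
  open import Data.Nat.Base using (zero; suc)
  open import Data.Vec.Base using ([])
  open import Defs
  open import Level using (lower)

  private variable
    a b : Level

  infix 4 _≃_
  record _≃_ (O₁ : StrictTotalOrder a a a) (O₂ : StrictTotalOrder b b b) : Set (a ⊔ˡ b) where
    private
      module O₁ = StrictTotalOrder O₁
      module O₂ = StrictTotalOrder O₂
    field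
      to      : O₁.Carrier → O₂.Carrier
      from    : O₂.Carrier → O₁.Carrier
      to-cong : ∀ {x y} → x O₁.≈ y → to x O₂.≈ to y
      to-mono : ∀ {x y} → x O₁.< y → to x O₂.< to y
      to-from : ∀ y → to (from y) O₂.≈ y

    to-comono : ∀ {x y} → to x O₂.< to y → x O₁.< y
    to-comono {x} {y} lt with O₁.compare x y
    ... | tri< x<y _ _ = x<y
    ... | tri≈ _ x≈y _ = contradiction lt (O₂.irrefl (to-cong x≈y))
    ... | tri> _ _ y<x = contradiction lt (O₂.asym (to-mono y<x))

    to-injective : ∀ {x y} → to x O₂.≈ to y → x O₁.≈ y
    to-injective {x} {y} eq with O₁.compare x y
    ... | tri< x<y _ _ = contradiction (to-mono x<y) (O₂.irrefl eq)
    ... | tri≈ _ x≈y _ = x≈y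
    ... | tri> _ _ y<x = contradiction (to-mono y<x) (O₂.irrefl (O₂.Eq.sym eq))

  ≃-sym : {O₁ : StrictTotalOrder a a a} {O₂ : StrictTotalOrder b b b} → O₁ ≃ O₂ → O₂ ≃ O₁
  ≃-sym {O₁ = O₁} {O₂} f = record
    { to      = from f
    ; from    = to f
    ; to-cong = λ x≈y → to-injective f (O₂.Eq.trans (to-from f _) (O₂.Eq.trans x≈y (O₂.Eq.sym (to-from f _))))
    ; to-mono = λ x<y → to-comono f
        (O₂.<-respˡ-≈ (O₂.Eq.sym (to-from f _)) (O₂.<-respʳ-≈ (O₂.Eq.sym (to-from f _)) x<y))
    ; to-from = λ x → to-injective f (to-from f (to f x))
    }
    where
    open _≃_
    module O₂ = StrictTotalOrder O₂

  order : Ordinal a → StrictTotalOrder a a a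
  order = Ordinal.strictTotalOrder

  ≅⇒≃ : {α : Ordinal a} {β : Ordinal b} → α ≅ β → order α ≃ order β
  ≅⇒≃ {α = α} (f , iso) = record
    { to      = f
    ; from    = λ y → proj₁ (surjective y)
    ; to-cong = I.cong
    ; to-mono = I.mono
    ; to-from = λ y → proj₂ (surjective y) (Ordinal.Eq.refl α)
    }
    where
    module I = IsOrderIsomorphism iso
    open I using (surjective)

  module Computation (d : ℕ) where
    open Types d
    open Semantics d
    open Attained d
    open Algebra d
    open _≃_

    Everything : {A : Set a} → A → Set a
    Everything _ = ⊤ₚ

    module _ ⦃ _ : EM a ⦄ (q : ℕ) where

      record Computes (X : Tys q) (O : StrictTotalOrder a a a) : Set a where
        field
          sound    : ∀ ((χ , _) : Colouring O) → X ∋ tp O q χ Everything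
          complete : ∀ {t} → X ∋ t → Attains O q Everything t

    open Computes

    module _ ⦃ _ : EM a ⦄ ⦃ _ : EM b ⦄ {q : ℕ} {O₁ : StrictTotalOrder a a a} {O₂ : StrictTotalOrder b b b} where
      private
        module O₁ = StrictTotalOrder O₁
        module O₂ = StrictTotalOrder O₂

      tp-≃ : (f : O₁ ≃ O₂) ((χ , _) : Colouring O₁) → tp O₁ q χ Everything ≡ tp O₂ q (χ ∘ from f) Everything
      tp-≃ f (χ , χ-cong) = tp-correspondence {R = λ x y → to f x O₂.≈ y}
        (record
          { mono   = λ x~y x′~y′ lt → O₂.<-respˡ-≈ x~y (O₂.<-respʳ-≈ x′~y′ (to-mono f lt))
          ; comono = λ x~y x′~y′ lt → to-comono f (O₂.<-respˡ-≈ (O₂.Eq.sym x~y) (O₂.<-respʳ-≈ (O₂.Eq.sym x′~y′) lt))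
          ; colour = λ x~y → χ-cong (to-injective f (O₂.Eq.trans x~y (O₂.Eq.sym (to-from f _))))
          })
        q ((λ x _ → to f x , ttₚ , O₂.Eq.refl) , (λ y _ → from f y , ttₚ , to-from f y))

    pull : {O₁ : StrictTotalOrder a a a} {O₂ : StrictTotalOrder b b b} → O₁ ≃ O₂ → Colouring O₁ → Colouring O₂
    pull f (χ , χ-cong) = χ ∘ from f , χ-cong ∘ to-cong (≃-sym f)

    computes-≃ : ⦃ _ : EM a ⦄ ⦃ _ : EM b ⦄ {q : ℕ} {X : Tys q}
                 {O₁ : StrictTotalOrder a a a} {O₂ : StrictTotalOrder b b b} →
                 O₁ ≃ O₂ → Computes q X O₁ → Computes q X O₂
    computes-≃ {X = X} f C = record
      { sound    = λ χ → subst (X ∋_) (sym (tp-≃ (≃-sym f) χ)) (sound C (pull (≃-sym f) χ))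
      ; complete = λ t∈ → let χ , eq = complete C t∈ in pull f χ , trans (sym (tp-≃ f χ)) eq
      }

    module _ ⦃ _ : EM a ⦄ ⦃ _ : EM b ⦄ ⦃ _ : EM (a ⊔ˡ b) ⦄ {q : ℕ} (α : Ordinal a) (β : Ordinal b) where
      private
        module α = Ordinal α
        module β = Ordinal β
        module α+β = Ordinal (α + β)
        O = order (α + β)

        data Left : α+β.Carrier → Set (a ⊔ˡ b) where
          left : ∀ x → Left (inj₁ x)

        data Right : α+β.Carrier → Set (a ⊔ˡ b) where
          right : ∀ y → Right (inj₂ y)

        halves : Sum O Everything Left Right
        halves = record
          { split   = λ { {inj₁ x} _ → inj₁ (left x) ; {inj₂ y} _ → inj₂ (right y) }
          ; left    = λ _ → ttₚ
          ; right   = λ _ → ttₚ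
          ; ordered = λ { (left x) (right y) → ₁∼₂ }
          }

        tp-left : ∀ χ → tp O q χ Left ≡ tp (order α) q (χ ∘ inj₁) Everything
        tp-left χ = tp-correspondence {R = λ z x → z ≡ inj₁ x}
          (record
            { mono   = λ { refl refl (₁∼₁ lt) → lt }
            ; comono = λ { refl refl lt → ₁∼₁ lt }
            ; colour = λ { refl → refl }
            })
          q ((λ { _ (left x) → x , ttₚ , refl }) , λ x _ → inj₁ x , left x , refl)

        tp-right : ∀ χ → tp O q χ Right ≡ tp (order β) q (χ ∘ inj₂) Everything
        tp-right χ = tp-correspondence {R = λ z y → z ≡ inj₂ y}
          (record
            { mono   = λ { refl refl (₂∼₂ lt) → lt }
            ; comono = λ { refl refl lt → ₂∼₂ lt }
            ; colour = λ { refl → refl }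
            })
          q ((λ { _ (right y) → y , ttₚ , refl }) , λ y _ → inj₂ y , right y , refl)

        tp-+ : ∀ χ → tp O q χ Everything ≡
               tp (order α) q (χ ∘ inj₁) Everything ∙ tp (order β) q (χ ∘ inj₂) Everything
        tp-+ χ = trans (tp-sum O q halves) (cong₂ _∙_ (tp-left χ) (tp-right χ))

      computes-+ : {X Y : Tys q} → Computes q X (order α) → Computes q Y (order β) → Computes q (X ⊗ Y) O
      computes-+ {X} {Y} C D = record
        { sound    = λ (χ , χ-cong) → subst ((X ⊗ Y) ∋_) (sym (tp-+ χ))
            (⊗⁺ X Y (sound C (χ ∘ inj₁ , χ-cong ∘ inj₁)) (sound D (χ ∘ inj₂ , χ-cong ∘ inj₂)))
        ; complete = λ t∈ →
            let u , v , u∈ , v∈ , t≡ = ⊗⁻ X Y t∈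
                (χ₁ , cong₁) , eq₁ = complete C u∈
                (χ₂ , cong₂′) , eq₂ = complete D v∈
            in ([ χ₁ , χ₂ ]′ , λ { (inj₁ eq) → cong₁ eq ; (inj₂ eq) → cong₂′ eq }) ,
               trans (tp-+ [ χ₁ , χ₂ ]′) (trans (cong₂ _∙_ eq₁ eq₂) (sym t≡))
        }

    computes-𝟎 : ⦃ _ : EM a ⦄ {q : ℕ} → Computes {a} q (single ε) (order 𝟎)
    computes-𝟎 {q = q} = record
      { sound    = λ _ → ⟪⟫⁺ (_≟ᵗ ε) (tp-empty (order 𝟎) q (λ ()))
      ; complete = λ t∈ → ((λ ()) , λ { {()} }) , trans (tp-empty (order 𝟎) q (λ ())) (sym (⟪⟫⁻ (_≟ᵗ ε) t∈))
      }

    -- The order `W` is the product M · B, that is, B copies of M. A colouring of M repeated in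
    -- every copy provides `fibre⁺`.
    module Lexicographic ⦃ _ : EM 0ℓ ⦄ ⦃ _ : EM a ⦄ {q : ℕ} (B : Ordinal a) (M : StrictTotalOrder 0ℓ 0ℓ 0ℓ)
                         {X : Tys q} (C : Computes q X M) where
      private
        module B = Ordinal B
        module M = StrictTotalOrder M

      W : StrictTotalOrder a a a
      W = ×-strictTotalOrder (order B) M

      private
        module W = StrictTotalOrder W

      proj₁-mono : ∀ {x y} → x W.< y → ¬ proj₁ y B.< proj₁ x
      proj₁-mono (inj₁ lt)       = B.asym lt
      proj₁-mono (inj₂ (eq , _)) = B.irrefl (B.Eq.sym eq)

      open WellOrder B
      open Blocks d W B proj₁ proj₁ proj₁-mono renaming (from to final)
      open BlockTypes d W B proj₁ proj₁ proj₁-mono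

      tp-fibre-× : ∀ ((χ , _) : Colouring W) i → tp W q χ (fibre i) ≡ tp M q (λ m → χ (i , m)) Everything
      tp-fibre-× (χ , χ-cong) i = tp-correspondence {R = λ w m → proj₁ w B.≈ i × proj₂ w M.≈ m}
        (record
          { mono   = λ { (b≈i , _) (b′≈i , _) (inj₁ lt) →
                           contradiction lt (B.irrefl (B.Eq.trans b≈i (B.Eq.sym b′≈i)))
                       ; (_ , m) (_ , m′) (inj₂ (_ , lt)) → M.<-respˡ-≈ m (M.<-respʳ-≈ m′ lt) }
          ; comono = λ (b≈i , m) (b′≈i , m′) lt → inj₂ (B.Eq.trans b≈i (B.Eq.sym b′≈i) ,
                       M.<-respˡ-≈ (M.Eq.sym m) (M.<-respʳ-≈ (M.Eq.sym m′) lt))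
          ; colour = χ-cong
          })
        q ((λ (_ , m) b≈i → m , ttₚ , b≈i , M.Eq.refl) , (λ m _ → (i , m) , B.Eq.refl , B.Eq.refl , M.Eq.refl))

      fibre⁻ : ∀ ((χ , _) : Colouring W) i → X ∋ tp W q χ (fibre i)
      fibre⁻ (χ , χ-cong) i = subst (X ∋_) (sym (tp-fibre-× (χ , χ-cong) i))
        (sound C ((λ m → χ (i , m)) , λ eq → χ-cong (B.Eq.refl , eq)))

      fibre⁺ : ∀ {t} → X ∋ t → Σ (Colouring W) λ (χ , _) → ∀ i → tp W q χ (fibre i) ≡ t
      fibre⁺ t∈ = let (χ , χ-cong) , eq = complete C t∈
                      χ′ : Colouring W
                      χ′ = χ ∘ proj₂ , λ eq → χ-cong (proj₂ eq)
                  in χ′ , λ i → trans (tp-fibre-× χ′ i) eq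

      private
        everything-initial : Initial Everything
        everything-initial _ _ = ttₚ

        module _ {b₀ : B.Carrier} (least : ∀ b → ¬ b B.< b₀) where

          tp-final : ∀ {χ} → tp W q χ (final b₀ Everything) ≡ tp W q χ Everything
          tp-final = tp-≗ W q (λ _ → ttₚ) (λ {w} _ → least (proj₁ w) , ttₚ)

          computes-final : ∀ {Y} → (∀ ((χ , _) : Colouring W) → Y ∋ tp W q χ (final b₀ Everything)) →
                           (∀ {t} → Y ∋ t → Attains W q (final b₀ Everything) t) → Computes q Y W
          computes-final {Y} f g = record
            { sound    = λ χ → subst (Y ∋_) tp-final (f χ)
            ; complete = λ t∈ → let χ , eq = g t∈ in χ , trans (sym tp-final) eq
            }

      computes-ω : ∀ {s} → Exhausts Everything s → (∀ n z → z B.< s (suc n) → ¬ s n B.< z) →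
                   (∀ b → ¬ b B.< s 0) → Computes q (ωSums X) W
      computes-ω ex succ least = computes-final least
        (ωSums-tp fibre⁻ fibre⁺ everything-initial ex succ) (ωSums-attains fibre⁻ fibre⁺ everything-initial ex succ)

      module _ (XX : X ⊗ X ≡ X) (Xω : X ≡ ωSums X) (b : B.Carrier) where

        private
          bottom : ∃[ b₀ ] ∀ b → ¬ b B.< b₀
          bottom = let b₀ , _ , least = minimal Everything (b , ttₚ) in b₀ , λ b lt → least b lt ttₚ

        computes-limit : HasCofinalSequence Everything → Computes q X W
        computes-limit seq = let b₀ , least = bottom in computes-final least
          (λ χ → limit-tp fibre⁻ fibre⁺ XX Xω χ everything-initial ttₚ)
          (Attainable.limit (realises-from fibre⁻ fibre⁺ XX Xω everything-initial ttₚ) (inj₂ seq))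

        computes-uncountable : ¬ HasMaximum Everything → ¬ HasCofinalSequence Everything →
                               Computes q (uncountableCofinality X) W
        computes-uncountable noMax noSeq = let b₀ , least = bottom in computes-final least
          (λ χ → uncountable-tp fibre⁻ fibre⁺ XX Xω χ everything-initial noMax noSeq ttₚ)
          (Attainable.uncountable (realises-from fibre⁻ fibre⁺ XX Xω everything-initial ttₚ))

  -- ω ^ c is the lexicographic product of the sums of the powers with
  -- exponents outside an initial segment γ of c, and ω ^ γ.
  module Split (γ : Ordinal 0ℓ) (c : Ordinal a) (ι : ∣ γ ∣ → ∣ c ∣)
               (ι-cong : ∀ {i j} → Ordinal._≈_ γ i j → Ordinal._≈_ c (ι i) (ι j))
               (ι-mono : ∀ {i j} → Ordinal._<_ γ i j → Ordinal._<_ c (ι i) (ι j))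
               (ι-view : ∀ x → (∃[ i ] Ordinal._≈_ c x (ι i)) ⊎ (∀ i → Ordinal._<_ c (ι i) x)) where
    private
      module γ = Ordinal γ
      module c = Ordinal c
      module γ×ℕ = StrictTotalOrder (×-strictTotalOrder (order γ) ℕ.<-strictTotalOrder)
      module c×ℕ = StrictTotalOrder (×-strictTotalOrder (order c) ℕ.<-strictTotalOrder)

      Above : c.Carrier × ℕ → Set a
      Above (x , _) = ∀ i → ι i c.< x

      Decreasingᶜ : List (c.Carrier × ℕ) → Set a
      Decreasingᶜ = Linked (λ s t → proj₁ t c.< proj₁ s)

      Decreasingᵞ : List (γ.Carrier × ℕ) → Set
      Decreasingᵞ = Linked (λ s t → proj₁ t γ.< proj₁ s)

      ι-comono : ∀ {i j} → ι i c.< ι j → i γ.< j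
      ι-comono {i} {j} lt with γ.compare i j
      ... | tri< i<j _ _ = i<j
      ... | tri≈ _ i≈j _ = contradiction lt (c.irrefl (ι-cong i≈j))
      ... | tri> _ _ j<i = contradiction lt (c.asym (ι-mono j<i))

      embed : List (γ.Carrier × ℕ) → List (c.Carrier × ℕ)
      embed = map (λ (i , n) → ι i , n)

      embed-decreasing : ∀ {v} → Decreasingᵞ v → Decreasingᶜ (embed v)
      embed-decreasing []       = []
      embed-decreasing [-]      = [-]
      embed-decreasing (lt ∷ d) = ι-mono lt ∷ embed-decreasing d

      embed-decreasing⁻ : ∀ v → Decreasingᶜ (embed v) → Decreasingᵞ v
      embed-decreasing⁻ []           []       = []
      embed-decreasing⁻ (_ ∷ [])     [-]      = [-]
      embed-decreasing⁻ (_ ∷ _ ∷ v) (lt ∷ d) = ι-comono lt ∷ embed-decreasing⁻ (_ ∷ v) d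

      ++-decreasing : ∀ {u v} → Decreasingᶜ u → All Above u → Decreasingᵞ v → Decreasingᶜ (u ++ embed v)
      ++-decreasing []       _        e  = embed-decreasing e
      ++-decreasing [-]      _        [] = [-]
      ++-decreasing [-]      (t ∷ []) e@[-]     = t _ ∷ embed-decreasing e
      ++-decreasing [-]      (t ∷ []) e@(_ ∷ _) = t _ ∷ embed-decreasing e
      ++-decreasing (lt ∷ d) (_ ∷ ts) e  = lt ∷ ++-decreasing d ts e

      ++-decreasing⁻ : ∀ u {w} → Decreasingᶜ (u ++ w) → Decreasingᶜ u × Decreasingᶜ w
      ++-decreasing⁻ []          d        = [] , d
      ++-decreasing⁻ (_ ∷ [])    d        = [-] , Linked.tail d
      ++-decreasing⁻ (_ ∷ y ∷ u) (lt ∷ d) = let d₁ , d₂ = ++-decreasing⁻ (y ∷ u) d in lt ∷ d₁ , d₂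

      decreasing-resp : ∀ {u w} → Pointwise c×ℕ._≈_ u w → Decreasingᶜ w → Decreasingᶜ u
      decreasing-resp []                         []       = []
      decreasing-resp (_ ∷ [])                   [-]      = [-]
      decreasing-resp ((x≈ , _) ∷ (y≈ , n≡) ∷ p) (lt ∷ d) =
        c.<-respˡ-≈ (c.Eq.sym y≈) (c.<-respʳ-≈ (c.Eq.sym x≈) lt) ∷ decreasing-resp ((y≈ , n≡) ∷ p) d

      ++-mono₁ : ∀ {u u′} v {v′} → All Above u′ → Lex-< c×ℕ._≈_ c×ℕ._<_ u u′ →
                 Lex-< c×ℕ._≈_ c×ℕ._<_ (u ++ embed v) (u′ ++ embed v′)
      ++-mono₁ _       _        (base ())
      ++-mono₁ []      _        halt        = halt
      ++-mono₁ (_ ∷ _) (t ∷ _)  halt        = this (inj₁ (t _))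
      ++-mono₁ v       _        (this lt)   = this lt
      ++-mono₁ v       (_ ∷ ts) (next eq p) = next eq (++-mono₁ v ts p)

      ++-mono₂ : ∀ {u u′ v v′} → Pointwise c×ℕ._≈_ u u′ → Lex-< γ×ℕ._≈_ γ×ℕ._<_ v v′ →
                 Lex-< c×ℕ._≈_ c×ℕ._<_ (u ++ embed v) (u′ ++ embed v′)
      ++-mono₂ (eq ∷ p) l                            = next eq (++-mono₂ p l)
      ++-mono₂ []       halt                         = halt
      ++-mono₂ []       (this (inj₁ lt))             = this (inj₁ (ι-mono lt))
      ++-mono₂ []       (this (inj₂ (eq , lt)))      = this (inj₂ (ι-cong eq , lt))
      ++-mono₂ []       (next (eq , n≡) l)           = next (ι-cong eq , n≡) (++-mono₂ [] l)

      embed-cong : ∀ {v v′} → Pointwise γ×ℕ._≈_ v v′ → Pointwise c×ℕ._≈_ (embed v) (embed v′)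
      embed-cong []              = []
      embed-cong ((eq , n≡) ∷ p) = (ι-cong eq , n≡) ∷ embed-cong p

      separate : ∀ z → Decreasingᶜ z → ∃₂ λ u v → All Above u × Pointwise c×ℕ._≈_ (u ++ embed v) z
      separate []            d = [] , [] , [] , []
      separate ((x , n) ∷ z) d with ι-view x | separate z (Linked.tail d)
      ... | inj₂ t        | u , v , ts , p = (x , n) ∷ u , v , t ∷ ts , (c.Eq.refl , refl) ∷ p
      ... | inj₁ (i , eq) | [] , v , _ , p = [] , (i , n) ∷ v , [] , (c.Eq.sym eq , refl) ∷ p
      -- Exponents decrease, so none outside γ can follow one inside γ.
      separate ((x , n) ∷ (y′ , _) ∷ z) (y′<x ∷ d) | inj₁ (i , eq) | (y , _) ∷ u , v , t ∷ _ , (y≈y′ , _) ∷ _ =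
        contradiction (c.trans (c.<-respˡ-≈ (c.Eq.sym y≈y′) (c.<-respʳ-≈ eq y′<x)) (t i)) (c.irrefl c.Eq.refl)

    High : Ordinal a
    High = record
      { strictTotalOrder = On.strictTotalOrder (order (ω^ c)) high
      ; wellFounded      = On.wellFounded high (Ordinal.wellFounded (ω^ c))
      }
      where
      high : Σ ∣ ω^ c ∣ (All Above ∘ proj₁) → ∣ ω^ c ∣
      high = proj₁

    split-≃ : ×-strictTotalOrder (order High) (order (ω^ γ)) ≃ order (ω^ c)
    split-≃ = record
      { to      = λ (((u , d) , ts) , (v , e)) → u ++ embed v , ++-decreasing d ts e
      ; from    = λ (z , d) →
          let u , v , ts , p = separate z d
              d₁ , d₂ = ++-decreasing⁻ u (decreasing-resp p d)
          in ((u , d₁) , ts) , (v , embed-decreasing⁻ v d₂)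
      ; to-cong = λ (p , r) → Pointwise.++⁺ p (embed-cong r)
      ; to-mono = λ { {(_ , ts) , (v , _)} {(_ , ts′) , _} (inj₁ lt) → ++-mono₁ v ts′ lt
                    ; (inj₂ (p , lt)) → ++-mono₂ p lt }
      ; to-from = λ (z , d) → proj₂ (proj₂ (proj₂ (separate z d)))
      }

  module FiniteExponent (n : ℕ) where

    private
      inject-view : ∀ x → (∃[ i ] x ≡ inject₁ {n} i) ⊎ (∀ i → inject₁ {n} i Fin.< x)
      inject-view x with view x
      ... | ‵fromℕ     = inj₂ λ i → subst₂ ℕ._<_ (sym (Fin.toℕ-inject₁ i)) (sym (Fin.toℕ-fromℕ n)) (Fin.toℕ<n i)
      ... | ‵inject₁ j = inj₁ (j , refl)

      inject-mono : {i j : Fin n} → i Fin.< j → inject₁ i Fin.< inject₁ j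
      inject-mono {i} {j} = subst₂ ℕ._<_ (sym (Fin.toℕ-inject₁ i)) (sym (Fin.toℕ-inject₁ j))

      inject-cong : {i j : Fin n} → i ≡ j → inject₁ i ≡ inject₁ j
      inject-cong = cong inject₁

    open Split (fin n) (fin (suc n)) inject₁ inject-cong inject-mono inject-view public

    private
      module High = Ordinal High

      highest : ∀ i → inject₁ {n} i Fin.< fromℕ n
      highest i = subst₂ ℕ._<_ (sym (Fin.toℕ-inject₁ i)) (sym (Fin.toℕ-fromℕ n)) (Fin.toℕ<n i)

      above⇒highest : ∀ {x} → (∀ i → inject₁ {n} i Fin.< x) → x ≡ fromℕ n
      above⇒highest {x} t with view x
      ... | ‵fromℕ     = refl
      ... | ‵inject₁ j = contradiction (t j) (ℕ.<-irrefl refl)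

    -- The element ω^n · k. An entry m in the list stands for the coefficient m + 1, hence the
    -- shift. These are all elements of `High`, which therefore has order type ω.
    multiple : ℕ → High.Carrier
    multiple zero    = ([] , []) , []
    multiple (suc m) = ((fromℕ n , m) ∷ [] , [-]) , highest ∷ []

    multiple-surjective : ∀ z → ∃[ k ] z High.≈ multiple k
    multiple-surjective (([] , _) , _)                = 0 , []
    multiple-surjective (((x , m) ∷ [] , _) , t ∷ []) = suc m , (above⇒highest t , refl) ∷ []
    multiple-surjective (((x , m) ∷ (y , _) ∷ _ , y<x ∷ _) , t ∷ t′ ∷ _) =
      contradiction y<x (ℕ.<-irrefl (cong toℕ (trans (above⇒highest t′) (sym (above⇒highest t)))))

    multiple-step : ∀ k → multiple k High.< multiple (suc k)
    multiple-step zero    = halt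
    multiple-step (suc k) = this (inj₂ (refl , ℕ.n<1+n k))

    module _ ⦃ _ : EM 0ℓ ⦄ where
      open WellOrder High

      multiple-inc : ∀ {m n} → m ℕ.< n → multiple m High.< multiple n
      multiple-inc = increasing {multiple} multiple-step

      multiple-exhausts : Exhausts (λ _ → ⊤ₚ) multiple
      multiple-exhausts = (λ _ → ttₚ) , (λ {m} {n} → multiple-inc {m} {n}) , λ z _ →
        let k , eq = multiple-surjective z in
        suc k , High.<-respˡ-≈ {multiple (suc k)} {multiple k} {z} (High.Eq.sym {z} {multiple k} eq) (multiple-step k)

      multiple-reflects : ∀ i j → multiple i High.< multiple j → i ℕ.< j
      multiple-reflects i j lt with ℕ.<-cmp i j
      ... | tri< i<j _ _  = i<j
      ... | tri≈ _ refl _ = contradiction lt (High.irrefl {multiple i} {multiple i} (High.Eq.refl {multiple i}))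
      ... | tri> _ _ j<i  = contradiction lt (High.asym {multiple j} {multiple i} (multiple-inc j<i))

      multiple-successive : ∀ k z → z High.< multiple (suc k) → ¬ multiple k High.< z
      multiple-successive k z z< <z = let j , eq = multiple-surjective z in
        ℕ.<-irrefl refl (ℕ.<-≤-trans
          (multiple-reflects k j (High.<-respʳ-≈ {multiple k} {z} {multiple j} eq <z))
          (ℕ.s≤s⁻¹ (multiple-reflects j (suc k) (High.<-respˡ-≈ {multiple (suc k)} {z} {multiple j} eq z<))))

      multiple-least : ∀ z → ¬ z High.< multiple 0
      multiple-least z z< = let j , eq = multiple-surjective z in
        contradiction (multiple-reflects j 0 (High.<-respˡ-≈ {multiple 0} {z} {multiple j} eq z<)) λ ()

  module _ (d : ℕ) ⦃ _ : EM 0ℓ ⦄ where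
    open Types d
    open Semantics d
    open Attained d
    open Algebra d
    open Computation d

    -- ω^0 has the empty list as its only element, and ω^(n+1) is ω^n · ω by `split-≃` with n as an
    -- initial segment of n + 1.
    computes-ω^ : ∀ {q} n → Computes q (ω^-types n) (order (ω^ fin n))
    computes-ω^ {q} zero = record
      { sound    = λ χ → subst (points ∋_) (sym (tp-one χ)) (points⁺ (proj₁ χ ([] , [])))
      ; complete = λ t∈ → let c , t≡ = points⁻ t∈ in
                            ((λ _ → c) , λ _ → refl) , trans (tp-one ((λ _ → c) , λ _ → refl)) (sym t≡)
      }
      where
      one-element : ∀ (x : ∣ ω^ fin 0 ∣) → x ≡ ([] , [])
      one-element ([] , []) = refl

      tp-one : ∀ ((χ , _) : Colouring (order (ω^ fin 0))) → tp (order (ω^ fin 0)) q χ Everything ≡ point (χ ([] , []))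
      tp-one (χ , _) = tp-point (order (ω^ fin 0)) q ttₚ
        (λ {y} {z} _ _ lt → Ordinal.irrefl (ω^ fin 0) {y} {z}
          (Ordinal.Eq.reflexive (ω^ fin 0) (trans (one-element y) (sym (one-element z)))) lt)
        (λ {y} _ → cong χ (one-element y))
    computes-ω^ (suc n) = computes-≃ split-≃
      (Lexicographic.computes-ω High (order (ω^ fin n)) (computes-ω^ n) {multiple}
        multiple-exhausts multiple-successive multiple-least)
      where open FiniteExponent n

  -- The finite ordinals form an initial segment of every infinite one.
  module InfiniteExponent (c : Ordinal a) (ω≼c : ω ≼ c) where
    private
      module c = Ordinal c

      record Embedding : Set a where
        field
          ι      : ℕ → c.Carrier
          ι-mono : ∀ {m n} → m ℕ.< n → ι m c.< ι n
          ι-view : ∀ x → (∃[ n ] x c.≈ ι n) ⊎ (∀ n → ι n c.< x)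

      embedding : ω ≼ c → Embedding
      embedding (inj₂ (f , iso)) = record
        { ι      = f
        ; ι-mono = mono
        ; ι-view = λ x → let n , eq = surjective x in inj₁ (n , c.Eq.sym (eq refl))
        }
        where open IsOrderIsomorphism iso
      embedding (inj₁ (b , f , iso)) = record
        { ι      = proj₁ ∘ f
        ; ι-mono = mono
        ; ι-view = ι-view
        }
        where
        open IsOrderIsomorphism iso
        ι-view : ∀ x → (∃[ n ] x c.≈ proj₁ (f n)) ⊎ (∀ n → proj₁ (f n) c.< x)
        ι-view x with c.compare x b
        ... | tri< x<b _ _ = let n , eq = surjective (x , x<b) in inj₁ (n , c.Eq.sym (eq refl))
        ... | tri≈ _ x≈b _ = inj₂ λ n → c.<-respʳ-≈ (c.Eq.sym x≈b) (proj₂ (f n))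
        ... | tri> _ _ b<x = inj₂ λ n → c.trans (proj₂ (f n)) b<x

      open Embedding (embedding ω≼c)

      ι-toℕ-cong : ∀ {K} {i j : Fin K} → i ≡ j → ι (toℕ i) c.≈ ι (toℕ j)
      ι-toℕ-cong refl = c.Eq.refl

      bounded-view : ∀ K x → (∃[ i ] x c.≈ ι (toℕ {K} i)) ⊎ (∀ i → ι (toℕ {K} i) c.< x)
      bounded-view K x with ι-view x
      ... | inj₂ above = inj₂ (above ∘ toℕ)
      ... | inj₁ (n , eq) with n ℕ.<? K
      ...   | yes n<K = inj₁ (Fin.fromℕ< n<K , subst (λ m → x c.≈ ι m) (sym (Fin.toℕ-fromℕ< n<K)) eq)
      ...   | no n≮K  = inj₂ λ i → c.<-respʳ-≈ (c.Eq.sym eq)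
                (ι-mono (ℕ.<-≤-trans (Fin.toℕ<n i) (ℕ.≮⇒≥ n≮K)))

    module _ (K : ℕ) where
      open Split (fin K) c (ι ∘ toℕ) ι-toℕ-cong ι-mono (bounded-view K) public

  -- Multiples of a power of ω, and their cofinality

  module _ (K : ℕ) where
    private
      M : StrictTotalOrder 0ℓ 0ℓ 0ℓ
      M = order (ω^ fin K)

    Divisible : Ordinal a → Set (lsuc a)
    Divisible {a} α = Σ[ B ∈ Ordinal a ] ×-strictTotalOrder (order B) M ≃ order α

    divisible-𝟎 : Divisible {a} 𝟎
    divisible-𝟎 = 𝟎 , record
      { to      = λ ()
      ; from    = λ ()
      ; to-cong = λ { {()} }
      ; to-mono = λ { {()} }
      ; to-from = λ ()
      }

    divisible-+ : {α β : Ordinal a} → Divisible α → Divisible β → Divisible (α + β)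
    divisible-+ {α = α} {β} (B₁ , f₁) (B₂ , f₂) = B₁ + B₂ , record
      { to      = λ { (inj₁ b , m) → inj₁ (F₁.to (b , m)) ; (inj₂ b , m) → inj₂ (F₂.to (b , m)) }
      ; from    = from
      ; to-cong = λ { (inj₁ eq , eq′) → inj₁ (F₁.to-cong (eq , eq′)) ; (inj₂ eq , eq′) → inj₂ (F₂.to-cong (eq , eq′)) }
      ; to-mono = λ
        { (inj₁ ₁∼₂)               → ₁∼₂
        ; (inj₁ (₁∼₁ lt))          → ₁∼₁ (F₁.to-mono (inj₁ lt))
        ; (inj₁ (₂∼₂ lt))          → ₂∼₂ (F₂.to-mono (inj₁ lt))
        ; (inj₂ (inj₁ eq , lt))    → ₁∼₁ (F₁.to-mono (inj₂ (eq , lt)))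
        ; (inj₂ (inj₂ eq , lt))    → ₂∼₂ (F₂.to-mono (inj₂ (eq , lt)))
        }
      ; to-from = λ { (inj₁ x) → inj₁ (F₁.to-from x) ; (inj₂ y) → inj₂ (F₂.to-from y) }
      }
      where
      module F₁ = _≃_ f₁
      module F₂ = _≃_ f₂
      from : ∣ α + β ∣ → ∣ B₁ + B₂ ∣ × StrictTotalOrder.Carrier M
      from (inj₁ x) = inj₁ (proj₁ (F₁.from x)) , proj₂ (F₁.from x)
      from (inj₂ y) = inj₂ (proj₁ (F₂.from y)) , proj₂ (F₂.from y)

    divisible-· : {α : Ordinal a} → Divisible α → ∀ n → Divisible (α · n)
    divisible-· D zero    = divisible-𝟎
    divisible-· {α = α} D (suc n) = divisible-+ {α = α · n} {α} (divisible-· D n) D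

    -- Each term is a multiple of ω^K because K is an initial segment of its infinite exponent, and
    -- ω^K · B₁ + ω^K · B₂ = ω^K · (B₁ + B₂).
    divisible-sum : {E : Set} {⟦_⟧ : E → Ordinal a} → (∀ e → ω ≼ ⟦ e ⟧) → ∀ ts → Divisible (sum ⟦_⟧ ts)
    divisible-sum infinite []       = divisible-𝟎
    divisible-sum {⟦_⟧ = ⟦_⟧} infinite (t ∷ ts) =
      divisible-+ {α = ω^ ⟦ Term.exponent t ⟧ · Term.coefficient t} {sum ⟦_⟧ ts}
        (divisible-· (High K , split-≃ K) (Term.coefficient t)) (divisible-sum infinite ts)
      where open InfiniteExponent ⟦ Term.exponent t ⟧ (infinite (Term.exponent t))

  ·-inhabited : {α : Ordinal a} → ∣ α ∣ → ∀ n → .⦃ NonZero n ⦄ → ∣ α · n ∣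
  ·-inhabited x (suc n) = inj₂ x

  sum-inhabited : {E : Set} {⟦_⟧ : E → Ordinal a} → ∀ t ts → ∣ sum ⟦_⟧ (t ∷ ts) ∣
  sum-inhabited {⟦_⟧ = ⟦_⟧} record { exponent = e ; coefficient = n ; isPositive = positive } ts =
    inj₁ (·-inhabited {α = ω^ ⟦ e ⟧} ([] , []) n ⦃ positive ⦄)

  -- 𝟎 + ω is ω, at any universe level.
  ω≺κ⇒κ⋠ω : {κ : Ordinal a} → ω ≺ κ → ¬ κ ≼ 𝟎 {a} + ω
  -- An embedding of κ in ℕ would give k a height. But infinitely many points `e n` lie below k, and
  -- the one for n = height k has at least that height already.
  ω≺κ⇒κ⋠ω {a} {κ} (k , e , iso) κ≼ω = ℕ.<-irrefl refl (ℕ.≤-<-trans (n≤height _) (height-mono (proj₂ (e (height k)))))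
    where
    open IsOrderIsomorphism iso using (mono)
    module κ = Ordinal κ

    value : ∣ 𝟎 {a} + ω ∣ → ℕ
    value (inj₂ n) = n

    value-mono : ∀ {x y} → Ordinal._<_ (𝟎 {a} + ω) x y → value x ℕ.< value y
    value-mono (₂∼₂ lt) = lt

    heights : κ ≼ 𝟎 {a} + ω → Σ (κ.Carrier → ℕ) λ r → ∀ {x y} → x κ.< y → r x ℕ.< r y
    heights (inj₁ (_ , f , iso′)) = value ∘ proj₁ ∘ f , λ lt → value-mono (IsOrderIsomorphism.mono iso′ lt)
    heights (inj₂ (f , iso′))     = value ∘ f , λ lt → value-mono (IsOrderIsomorphism.mono iso′ lt)

    height : κ.Carrier → ℕ
    height = proj₁ (heights κ≼ω)

    height-mono : ∀ {x y} → x κ.< y → height x ℕ.< height y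
    height-mono = proj₂ (heights κ≼ω)

    n≤height : ∀ n → n ≤ height (proj₁ (e n))
    n≤height zero    = z≤n
    n≤height (suc n) = ℕ.≤-<-trans (n≤height n) (height-mono (mono (ℕ.n<1+n n)))

  -- The cofinality is given for α, whereas the induction runs over B. The exponent is a successor
  -- so that ω^(n+1) itself has a cofinal ω-sequence; a last copy of it would then give α cofinality
  -- ω.
  module CofinalityOfProduct ⦃ _ : EM a ⦄ (n : ℕ) (B α : Ordinal a)
                             (f : ×-strictTotalOrder (order B) (order (ω^ fin (suc n))) ≃ order α) where
    private
      module B = Ordinal B
      module α = Ordinal α
      M = ω^ fin (suc n)
      module M = Ordinal M
      module F = _≃_ f
      W = ×-strictTotalOrder (order B) (order M)
      module W = StrictTotalOrder W
      open WellOrder B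

      Whole : B.Carrier → Set a
      Whole _ = ⊤ₚ

    cofinalMap⇒sequence : CofinalMap ω α → HasCofinalSequence Whole
    cofinalMap⇒sequence (g , _ , cof) = proj₁ ∘ F.from ∘ g , (λ _ → ttₚ) , λ b _ →
      let i , gi≮ = cof (F.to (b , ([] , []))) in
      i , λ lt → gi≮ (α.<-respˡ-≈ (F.to-from (g i)) (F.to-mono (inj₁ lt)))

    private
      -- The minimality in `IsCofinalityOf` speaks of ordinals at the level of α, so ω is replaced
      -- by 𝟎 + ω.
      sequence⇒cofinalMap : (h : ℕ → W.Carrier) → (∀ w → ∃[ n ] ¬ h n W.< w) → CofinalMap (𝟎 {a} + ω) α
      sequence⇒cofinalMap h cof = g , g-cong , λ x →
        let n , h≮ = cof (F.from x) in
        inj₂ n , λ lt → h≮ (F.to-comono (α.<-respʳ-≈ (α.Eq.sym (F.to-from x)) lt))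
        where
        g : ∣ 𝟎 {a} + ω ∣ → α.Carrier
        g (inj₂ n) = F.to (h n)
        g-cong : ∀ {x y} → Ordinal._≈_ (𝟎 {a} + ω) x y → g x α.≈ g y
        g-cong {inj₂ n} (inj₂ refl) = α.Eq.refl

      multiples : ℕ → M.Carrier
      multiples k = (fromℕ n , k) ∷ [] , [-]

      multiples-cofinal : ∀ x → ∃[ k ] ¬ multiples k M.< x
      multiples-cofinal ([] , _)          = 0 , λ ()
      multiples-cofinal ((x , k) ∷ _ , _) = suc k , λ
        { (this (inj₁ n<x))       → ℕ.<-irrefl refl
            (ℕ.<-≤-trans (subst (ℕ._< toℕ x) (Fin.toℕ-fromℕ n) n<x) (ℕ.s≤s⁻¹ (Fin.toℕ<n x)))
        ; (this (inj₂ (_ , k<k))) → ℕ.<-irrefl refl (ℕ.<-trans (ℕ.n<1+n k) k<k)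
        ; (next (_ , ()) _)
        }

    module _ (uncountable : HasCofinality α cf>ω) where

      private
        noCofinalMap : ¬ CofinalMap (𝟎 {a} + ω) α
        noCofinalMap g = let κ , (_ , least) , ω≺κ = uncountable in
          ω≺κ⇒κ⋠ω {κ = κ} ω≺κ (least (𝟎 + ω) g)

      noMaximum : ¬ HasMaximum Whole
      noMaximum (m , _ , max) = noCofinalMap (sequence⇒cofinalMap (λ k → m , multiples k) λ (b , x) →
        let k , k≮ = multiples-cofinal x in
        k , λ { (inj₁ m<b) → max b ttₚ m<b ; (inj₂ (_ , lt)) → k≮ lt })

      noSequence : ¬ HasCofinalSequence Whole
      noSequence (h , _ , cof) = noCofinalMap (sequence⇒cofinalMap (λ k → h k , ([] , [])) λ (b , x) →
        -- The least element of the copy at b may lie below (b , x), so the sequence is first taken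
        -- beyond a larger b′.
        let b′ , _ , b<b′ = greater {Whole} (λ _ _ → ttₚ) noMaximum {b} ttₚ
            k , hk≮b′ = cof b′ ttₚ
        in k , λ { (inj₁ lt) → hk≮b′ (B.trans lt b<b′)
                 ; (inj₂ (eq , _)) → hk≮b′ (B.<-respˡ-≈ (B.Eq.sym eq) b<b′) })

  -- The decision procedure and its correctness

  module Decision (N : Notations) (d : ℕ) where
    open Notations N
    open Types d
    open Algebra d
    open Evaluation d
    open Computation d
    open Computes

    private variable
      q : ℕ

    times : Tys q → ℕ → Tys q
    times X zero    = single ε
    times X (suc n) = times X n ⊗ X

    finiteTypes : List (Term ℕ) → Tys q
    finiteTypes []       = single ε
    finiteTypes (t ∷ ts) = times (ω^-types (Term.exponent t)) (Term.coefficient t) ⊗ finiteTypes ts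

    cofinalityTypes : Cofinality → Tys q
    cofinalityTypes cf=ω = limitTypes
    cofinalityTypes cf>ω = uncountableCofinality limitTypes

    infiniteTypes : List (Term Code) → Tys q
    infiniteTypes []       = single ε
    infiniteTypes (t ∷ ts) = cofinalityTypes (cf (t ∷ ts))

    types : CNF N → Tys q
    types α = infiniteTypes (CNF.infiniteTerms α) ⊗ finiteTypes (CNF.finiteTerms α)

    Realisable : ∀ q → Sentence d → CNF N → Set
    Realisable q σ α = ∃[ t ] types {q} α ∋ t × Sat σ (end t) []

    realisable? : ∀ q σ α → Dec (Realisable q σ α)
    realisable? q σ α = any-Ty λ t → (types α ∋? t) ×-dec Sat? σ (end t) []

    module _ ⦃ _ : EM 0ℓ ⦄ where

      computes-times : ∀ {X : Tys q} {α : Ordinal 0ℓ} → Computes q X (order α) →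
                       ∀ n → Computes q (times X n) (order (α · n))
      computes-times C zero    = computes-𝟎
      computes-times {α = α} C (suc n) = computes-+ (α · n) α (computes-times C n) C

      computes-finite : ∀ ts → Computes q (finiteTypes ts) (order (sum fin ts))
      computes-finite []       = computes-𝟎
      computes-finite (t ∷ ts) = computes-+ (ω^ fin (Term.exponent t) · Term.coefficient t) (sum fin ts)
        (computes-times (computes-ω^ d (Term.exponent t)) (Term.coefficient t)) (computes-finite ts)

    module _ {ℓ : Level} ⦃ _ : EM 0ℓ ⦄ ⦃ _ : EM ℓ ⦄ (I : Interpretation ℓ N) where
      open Interpretation I

      computes-cofinality : ∀ {α : Ordinal ℓ} → Divisible (threshold q) α → ∣ α ∣ → ∀ κ → HasCofinality α κ →
                            Computes q (cofinalityTypes κ) (order α)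
      computes-cofinality {q} {α} (B , f) x cf=ω (g , _) = computes-≃ f
        (Lexicographic.computes-limit B _ (computes-ω^ d (threshold q)) limitTypes-idempotent limitTypes-stable
          (proj₁ (_≃_.from f x)) (CofinalityOfProduct.cofinalMap⇒sequence _ B α f g))
      computes-cofinality {q} {α} (B , f) x cf>ω h = computes-≃ f
        (Lexicographic.computes-uncountable B _ (computes-ω^ d (threshold q)) limitTypes-idempotent limitTypes-stable
          (proj₁ (_≃_.from f x)) (CofinalityOfProduct.noMaximum _ B α f h) (CofinalityOfProduct.noSequence _ B α f h))

      computes-infinite : ∀ ts → DecreasingExponents ⟦_⟧ ts → Computes q (infiniteTypes ts) (order (sum ⟦_⟧ ts))
      computes-infinite []       _          = computes-𝟎
      computes-infinite {q} (t ∷ ts) decreasing = computes-cofinality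
        (divisible-sum (threshold q) infinite (t ∷ ts)) (sum-inhabited {⟦_⟧ = ⟦_⟧} t ts)
        (cf (t ∷ ts)) (cf-correct (t ∷ ts) decreasing)

      computes-ordinal : ∀ α → IsCNF I α → Computes q (types α) (order (ordinalOf I α))
      computes-ordinal α (decreasing , _) = computes-+ (sum ⟦_⟧ (CNF.infiniteTerms α)) (sum fin (CNF.finiteTerms α))
        (computes-infinite (CNF.infiniteTerms α) decreasing) (computes-finite (CNF.finiteTerms α))

      -- Both directions go through the type of rank q: `computes-ordinal` says which types the
      -- colourings of α have, and `⊨⇔Sat` that the type determines whether σ holds.
      realisable⇔ : ∀ σ → rank σ ≤ q → ∀ α → IsCNF I α →
        Realisable q σ α ⇔ (Σ[ A ∈ ColouredOrdinal d ℓ ] (ColouredOrdinal.ordinal A ≅ ordinalOf I α) × (A ⊨ σ))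
      realisable⇔ {q} σ rank≤ α isCNF = mk⇔ to from
        where
        O = ordinalOf I α
        module O = Ordinal O
        C : Computes q (types α) (order O)
        C = computes-ordinal α isCNF

        to : Realisable q σ α → Σ[ A ∈ ColouredOrdinal d ℓ ] (ColouredOrdinal.ordinal A ≅ O) × (A ⊨ σ)
        to (t , t∈ , sat) =
          let (χ , χ-cong) , tp≡ = complete C t∈
              A = record
                { ordinal   = O
                ; Colour    = λ i x → Lift ℓ (χ x ≡ i)
                ; respects  = λ x≈y (lift eq) → lift (trans (sym (χ-cong x≈y)) eq)
                ; partition = λ x → χ x , lift refl , λ (lift eq) → eq
                }
          in A , (id , Identity.isOrderIsomorphism _ _ O.Eq.refl) ,
             proj₂ (⊨⇔Sat A σ rank≤) (subst (λ t → Sat σ (end t) []) (sym tp≡) sat)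

        from : Σ[ A ∈ ColouredOrdinal d ℓ ] (ColouredOrdinal.ordinal A ≅ O) × (A ⊨ σ) → Realisable q σ α
        from (A , iso , A⊨σ) =
          _ , sound (computes-≃ (≃-sym (≅⇒≃ {α = ColouredOrdinal.ordinal A} {O} iso)) C) (colourOf A , colourOf-cong A) ,
          proj₁ (⊨⇔Sat A σ rank≤) A⊨σ

  does-true⇔ : {P : Set} (D : Dec P) → does D ≡ true ⇔ P
  does-true⇔ D = mk⇔ (witness D) (dec-true D)
    where
    witness : ∀ {P : Set} (D : Dec P) → does D ≡ true → P
    witness (yes p) _ = p

  lower-EM : ∀ {ℓ} ℓ′ → ExcludedMiddle (ℓ ⊔ˡ ℓ′) → EM ℓ
  lower-EM ℓ′ lem = record { em = λ P → map′ lower lift (lem {Lift ℓ′ P}) }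

open Ordinals using (module Decision; does-true⇔; lower-EM)

open import Defs
open import Level using (suc)

theorem13 : (ℓ : Level) (N : Notations) →
    Σ[ decide ∈ ((d q : ℕ) → Sentence d → CNF N → Bool) ]
    (ExcludedMiddle (suc ℓ) →
    (I : Interpretation ℓ N) (d q : ℕ) → 1 ≤ d →
    (Σ⁺ : List (Sentence d)) → IsΣ⁺ ℓ d q Σ⁺ →
    (σ : Sentence d) → σ ∈ Σ⁺ →
    (α : CNF N) → IsCNF I α →
    (decide d q σ α ≡ true ⇔
    (Σ[ A ∈ ColouredOrdinal d ℓ ]
    (ColouredOrdinal.ordinal A ≅ ordinalOf I α) × (A ⊨ σ))))
theorem13 ℓ N = (λ d q σ α → does (realisable? d q σ α)) ,
  λ lem I d q _ Σ⁺ isΣ⁺ σ σ∈ α isCNF →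
    let instance em-0 = lower-EM (suc ℓ) lem
                 em-ℓ = lower-EM (suc ℓ) lem
        -- Evaluation on types of rank q is faithful for sentences of rank at most q, and a
        -- characteristic sentence is one of these.
        rank≤ = proj₁ (proj₂ (proj₂ (IsΣ⁺.characteristic isΣ⁺ σ∈)))
    in realisable⇔ d I σ rank≤ α isCNF ⇔-∘ does-true⇔ (realisable? d q σ α)
  where open Decision N
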